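{- Let $n,m,r,\lambda$ be positive integers with $m>5$ and $n\ge 6.285214\,m$. Any partial $r$-factorization of $\lambda K_m^5$ (with respect to $n$) can be extended to a connected $r$-factorization of $\lambda K_n^5$ if and only if $(n,r,\lambda)$ is $5$-admissible and no component of any color class of $\lambda K_m^5$ is $r$-regular.
   Context: $\lambda K_n^h$: $n$ vertices, every $h$-subset an edge of multiplicity $\lambda$; $\lambda K_m^h$ is its sub-hypergraph induced on a fixed set of $m$ vertices. Degree counts edges containing a vertex. An $r$-factor is a spanning sub-hypergraph in which every vertex has degree $r$. With $k=\lambda\binom{n-1}{h-1}/r$, a partial $r$-factorization of $\lambda K_m^h$ is a coloring of its edges with colors from $[k]$ such that each vertex has degree at most $r$ in every color class (color classes are spanning sub-hypergraphs on all $m$ vertices; components include isolated vertices). It extends to a connected $r$-factorization of $\lambda K_n^h$ if some coloring of all edges of $\lambda K_n^h$ with colors from $[k]$ agrees with it on $\lambda K_m^h$ and every color class is a connected $r$-factor. $(n,r,\lambda)$ is $h$-admissible if $h\mid rn$ and $r\mid\lambda\binom{n-1}{h-1}$. -}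

module Defs where

open import Data.Nat using (ℕ; zero; suc; _+_; _*_; _∸_; _≤_; _<_; _<?_; NonZero)
open import Data.Nat.Divisibility using (_∣_)
open import Data.Nat.DivMod using (_/_)
open import Data.Nat.Combinatorics using (_C_)
open import Data.Bool using (Bool; true; false; if_then_else_; _∧_)
open import Data.Fin using (Fin; toℕ; fromℕ<)
open import Data.Fin.Subset using (Subset; ∣_∣; _∈_)
open import Data.Fin.Subset.Properties using (_∈?_)
open import Data.Vec using (Vec; []; _∷_; tabulate; lookup)
open import Data.Product using (Σ; _×_; _,_; proj₁; proj₂)
open import Relation.Nullary using (Dec; yes; no; does; ¬_)
open import Relation.Binary.PropositionalEquality using (_≡_)
import Data.Nat as ℕ
import Data.Fin as F

sumSub : (N : ℕ) → (Subset N → ℕ) → ℕ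
sumSub zero f = f []
sumSub (suc N) f = sumSub N (λ S → f (true ∷ S)) + sumSub N (λ S → f (false ∷ S))

sumFin : (l : ℕ) → (Fin l → ℕ) → ℕ
sumFin zero f = 0
sumFin (suc l) f = f F.zero + sumFin l (λ i → f (F.suc i))

-- Edges of  l K_N^h : an h-subset of the vertex set Fin N together with a
-- copy index in Fin l (multiplicity l).
Edge : (h l N : ℕ) → Set
Edge h l N = Σ (Subset N) (λ S → ∣ S ∣ ≡ h) × Fin l

vertices : ∀ {h l N} → Edge h l N → Subset N
vertices e = proj₁ (proj₁ e)

countEdges : (h l N : ℕ) → (Edge h l N → Bool) → ℕ
countEdges h l N f = sumSub N (λ S → contrib S (∣ S ∣ ℕ.≟ h))
  where
  contrib : (S : Subset N) → Dec (∣ S ∣ ≡ h) → ℕ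
  contrib S (yes p) = sumFin l (λ i → if f ((S , p) , i) then 1 else 0)
  contrib S (no _) = 0

degree : ∀ {h l N k} → (Edge h l N → Fin k) → Fin k → Fin N → ℕ
degree {h} {l} {N} Col j v =
  countEdges h l N (λ e → does (v ∈? vertices e) ∧ does (Col e F.≟ j))

data Reach {h l N k : ℕ} (Col : Edge h l N → Fin k) (j : Fin k) :
           Fin N → Fin N → Set where
  here : ∀ {u} → Reach Col j u u
  step : ∀ {u w v} (e : Edge h l N) → Col e ≡ j →
         u ∈ vertices e → w ∈ vertices e → Reach Col j w v → Reach Col j u v

Connected : ∀ {h l N k} → (Edge h l N → Fin k) → Fin k → Set
Connected {N = N} Col j = (u v : Fin N) → Reach Col j u v

numColours : (h n r lam : ℕ) → .{{_ : NonZero r}} → ℕ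
numColours h n r lam = (lam * ((n ∸ 1) C (h ∸ 1))) / r

IsPartialFactorization : ∀ {h l m k} → ℕ → (Edge h l m → Fin k) → Set
IsPartialFactorization {m = m} {k = k} r c =
  (j : Fin k) (v : Fin m) → degree c j v ≤ r

-- The fixed m vertices are the first m vertices of Fin n.
embed : (m n : ℕ) → Subset m → Subset n
embed m n S = tabulate (λ (x : Fin n) → pick (toℕ x <? m))
  where
  pick : ∀ {x} → Dec (x < m) → Bool
  pick (yes p) = lookup S (fromℕ< p)
  pick (no _) = false

Agrees : ∀ {h l m n k} → (Edge h l n → Fin k) → (Edge h l m → Fin k) → Set
Agrees {h} {l} {m} {n} Col c =
  (S : Subset m) (p : ∣ S ∣ ≡ h) (q : ∣ embed m n S ∣ ≡ h) (i : Fin l) →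
  Col ((embed m n S , q) , i) ≡ c ((S , p) , i)

ExtendsToConnectedFactorization :
  ∀ {h l m k} → (n r : ℕ) → (Edge h l m → Fin k) → Set
ExtendsToConnectedFactorization {h} {l} {m} {k} n r c =
  Σ (Edge h l n → Fin k) λ Col →
    Agrees Col c × ((j : Fin k) → ((v : Fin n) → degree Col j v ≡ r) × Connected Col j)

Admissible : (h n r lam : ℕ) → Set
Admissible h n r lam = (h ∣ r * n) × (r ∣ lam * ((n ∸ 1) C (h ∸ 1)))

-- No component of any colour class of c is r-regular.  The component of v in
-- colour class j is the set of vertices reachable from v; it is r-regular iff
-- every vertex in it has degree r in colour j.
NoRegularComponent : ∀ {h l m k} → ℕ → (Edge h l m → Fin k) → Set
NoRegularComponent {m = m} {k = k} r c =
  (j : Fin k) (v : Fin m) → ¬ ((w : Fin m) → Reach c j v w → degree c j w ≡ r)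

{-# OPTIONS --safe #-}
module Submission where

-- Amalgamate the a = n − m new vertices into one vertex of which an edge may contain several copies
-- (its hinges).  The edges meeting the old vertices are coloured greedily, those with more old
-- vertices first: an edge with i old vertices is blocked only if its vertices carry a full set of
-- coloured edges.  For i = 3, 4 this is excluded by Markov's inequality, and for i = 2 by
-- C(n − 1, 4) ≤ 2 C(n − m, 4), the source of the constant 1 / (1 − 2^(−1/4)).  The number of
-- remaining edges in each colour is then forced.  New vertices are split off one at a time: each
-- edge passes a hinge on with probability t / N, where t is its number of hinges and N the number
-- of vertices still amalgamated, and this fractional choice is rounded to an integral one that
-- keeps the edge multiplicities, the degrees, and caps on the hinges taken from each connected
-- piece (blob) of a colour class; the caps keep every colour class connected through the
-- amalgamated vertex.  The rounding is an orientation problem, solved by reversing paths.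
-- Conversely, a regular component of a colour class cannot be joined to a new vertex.

open import Defs
open import Data.Nat using (ℕ; zero; suc; _+_; _*_; _∸_; _≤_; _<_; z≤n; s≤s; _<?_; _≤?_; _≟_; NonZero; >-nonZero; ≢-nonZero⁻¹)
open import Data.Nat.Properties hiding (_≟_; _≤?_; _<?_)
open import Data.Nat.Combinatorics using (_C_; nCk+nC[k+1]≡[n+1]C[k+1])
open import Data.Nat.Divisibility using (_∣_; divides)
open import Data.Nat.DivMod using (m/n*n≡m)
open import Data.Nat.Tactic.RingSolver using (solve-∀)
open import Data.Bool using (Bool; true; false; if_then_else_; _∧_; _∨_; not)
import Data.Bool.Properties as Bool
open import Data.Fin using (Fin; zero; suc; toℕ; splitAt; join; reduce≥; _↑ˡ_; _↑ʳ_)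
import Data.Fin.Properties as Fin
open import Data.Fin.Subset using (Subset; ∣_∣; _∈_)
open import Data.Fin.Subset.Properties using (_∈?_; anySubset?)
open import Data.Vec using ([]; _∷_; lookup; replicate; _++_; take; drop)
import Data.Vec.Properties as Vec
open import Data.Sum using (_⊎_; inj₁; inj₂; swap; [_,_]′)
import Data.Sum.Properties as Sum
open import Data.Product using (∃; _×_; _,_; proj₁; proj₂)
import Data.Product.Properties as Product
open import Data.Unit using (tt)
open import Data.Empty using (⊥; ⊥-elim)
open import Function using (_∘_; _$_; id)
open import Function.Bundles using (_⇔_; mk⇔)
open import Relation.Nullary using (Dec; yes; no; does; ¬_)
open import Relation.Nullary.Decidable using (map′; _⊎-dec_; _×-dec_; ¬?; dec-false; dec-true)
open import Relation.Binary using (DecidableEquality)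
open import Relation.Binary.PropositionalEquality
open import Algebra.Properties.CommutativeSemigroup +-commutativeSemigroup using (interchange)

-- Finite sums

-- Fair rounding alone would not keep the colour classes connected: the new vertex might use up
-- every hinge of the blobs that it meets. Consider the bipartite graph whose nodes are the blobs
-- and the N amalgamated vertices and whose edges are the hinges. It needs at least as many edges as
-- a spanning tree, which is the inequality `spare` of `Joined`, and every blob needs a hinge, which
-- is `attached`. The caps carry both through a splitting. At the start, `attached` amounts to the
-- absence of r-regular components, and `spare` follows from r ≥ 2; r = 1 is impossible because the
-- component of any edge would be 1-regular. The rounding exists because multiplicities constrain
-- rows, while degrees and caps constrain columns and groups nested in columns: two laminar
-- families. Old degrees need no constraint, as passing a hinge keeps the old vertices of an edge.
-- For i = 2, Markov's inequality would ask for n - 1 ≥ 8 (m - 1), so the edges with a single old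
-- vertex are counted exactly. They have to be at least half of the edges at that vertex, and for
-- this n / (n - m) ≤ 2^(1/4) is enough.

⟦_⟧ : Bool → ℕ
⟦ b ⟧ = if b then 1 else 0

-- Codes of finite types, so that sums, searches and equality tests are defined once by recursion.
data Shape : Set where
  fin sub : ℕ → Shape
  _⊕_ _⊗_ : Shape → Shape → Shape

infixr 5 _⊕_
infixr 6 _⊗_

El : Shape → Set
El (fin n) = Fin n
El (sub n) = Subset n
El (A ⊕ B) = El A ⊎ El B
El (A ⊗ B) = El A × El B

∑ : (A : Shape) → (El A → ℕ) → ℕ
∑ (fin n) f = sumFin n f
∑ (sub n) f = sumSub n f
∑ (A ⊕ B) f = ∑ A (f ∘ inj₁) + ∑ B (f ∘ inj₂)
∑ (A ⊗ B) f = ∑ A λ a → ∑ B λ b → f (a , b)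

equal? : (A : Shape) → DecidableEquality (El A)
equal? (fin n) = Fin._≟_
equal? (sub n) = Vec.≡-dec Bool._≟_
equal? (A ⊕ B) = Sum.≡-dec (equal? A) (equal? B)
equal? (A ⊗ B) = Product.≡-dec (equal? A) (equal? B)

search : (A : Shape) {P : El A → Set} → (∀ x → Dec (P x)) → Dec (∃ P)
search (fin n) P? = Fin.any? P?
search (sub n) P? = anySubset? P?
search (A ⊕ B) P? = map′ (λ { (inj₁ (a , p)) → inj₁ a , p ; (inj₂ (b , p)) → inj₂ b , p })
  (λ { (inj₁ a , p) → inj₁ (a , p) ; (inj₂ b , p) → inj₂ (b , p) })
  (search A (P? ∘ inj₁) ⊎-dec search B (P? ∘ inj₂))
search (A ⊗ B) P? = map′ (λ { (a , b , p) → (a , b) , p }) (λ { ((a , b) , p) → a , b , p })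
  (search A λ a → search B λ b → P? (a , b))

∑-cong : ∀ A {f g} → (∀ x → f x ≡ g x) → ∑ A f ≡ ∑ A g
∑-cong (fin zero) p = refl
∑-cong (fin (suc n)) p = cong₂ _+_ (p zero) (∑-cong (fin n) (p ∘ suc))
∑-cong (sub zero) p = p []
∑-cong (sub (suc n)) p = cong₂ _+_ (∑-cong (sub n) (p ∘ (true ∷_))) (∑-cong (sub n) (p ∘ (false ∷_)))
∑-cong (A ⊕ B) p = cong₂ _+_ (∑-cong A (p ∘ inj₁)) (∑-cong B (p ∘ inj₂))
∑-cong (A ⊗ B) p = ∑-cong A λ a → ∑-cong B λ b → p (a , b)

∑-mono : ∀ A {f g} → (∀ x → f x ≤ g x) → ∑ A f ≤ ∑ A g
∑-mono (fin zero) p = z≤n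
∑-mono (fin (suc n)) p = +-mono-≤ (p zero) (∑-mono (fin n) (p ∘ suc))
∑-mono (sub zero) p = p []
∑-mono (sub (suc n)) p = +-mono-≤ (∑-mono (sub n) (p ∘ (true ∷_))) (∑-mono (sub n) (p ∘ (false ∷_)))
∑-mono (A ⊕ B) p = +-mono-≤ (∑-mono A (p ∘ inj₁)) (∑-mono B (p ∘ inj₂))
∑-mono (A ⊗ B) p = ∑-mono A λ a → ∑-mono B λ b → p (a , b)

∑-zero : ∀ A {f} → (∀ x → f x ≡ 0) → ∑ A f ≡ 0
∑-zero (fin zero) p = refl
∑-zero (fin (suc n)) p = cong₂ _+_ (p zero) (∑-zero (fin n) (p ∘ suc))
∑-zero (sub zero) p = p []
∑-zero (sub (suc n)) p = cong₂ _+_ (∑-zero (sub n) (p ∘ (true ∷_))) (∑-zero (sub n) (p ∘ (false ∷_)))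
∑-zero (A ⊕ B) p = cong₂ _+_ (∑-zero A (p ∘ inj₁)) (∑-zero B (p ∘ inj₂))
∑-zero (A ⊗ B) p = ∑-zero A λ a → ∑-zero B λ b → p (a , b)

∑-+ : ∀ A (f g : El A → ℕ) → ∑ A (λ x → f x + g x) ≡ ∑ A f + ∑ A g
∑-+ (fin zero) f g = refl
∑-+ (fin (suc n)) f g = trans (cong (f zero + g zero +_) (∑-+ (fin n) (f ∘ suc) (g ∘ suc)))
  (interchange (f zero) (g zero) _ _)
∑-+ (sub zero) f g = refl
∑-+ (sub (suc n)) f g = trans (cong₂ _+_ (∑-+ (sub n) _ _) (∑-+ (sub n) _ _))
  (interchange (∑ (sub n) (f ∘ (true ∷_))) _ _ _)
∑-+ (A ⊕ B) f g = trans (cong₂ _+_ (∑-+ A _ _) (∑-+ B _ _)) (interchange (∑ A (f ∘ inj₁)) _ _ _)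
∑-+ (A ⊗ B) f g = trans (∑-cong A λ a → ∑-+ B _ _) (∑-+ A _ _)

∑-* : ∀ A c (f : El A → ℕ) → ∑ A (λ x → c * f x) ≡ c * ∑ A f
∑-* (fin zero) c f = sym (*-zeroʳ c)
∑-* (fin (suc n)) c f = trans (cong (c * f zero +_) (∑-* (fin n) c (f ∘ suc))) (sym (*-distribˡ-+ c _ _))
∑-* (sub zero) c f = refl
∑-* (sub (suc n)) c f = trans (cong₂ _+_ (∑-* (sub n) c _) (∑-* (sub n) c _)) (sym (*-distribˡ-+ c _ _))
∑-* (A ⊕ B) c f = trans (cong₂ _+_ (∑-* A c _) (∑-* B c _)) (sym (*-distribˡ-+ c _ _))
∑-* (A ⊗ B) c f = trans (∑-cong A λ a → ∑-* B c _) (∑-* A c _)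

∑-swap : ∀ A B (f : El A → El B → ℕ) → (∑ A λ a → ∑ B λ b → f a b) ≡ (∑ B λ b → ∑ A λ a → f a b)
∑-swap (fin zero) B f = sym (∑-zero B λ _ → refl)
∑-swap (fin (suc n)) B f = trans (cong (∑ B (f zero) +_) (∑-swap (fin n) B (f ∘ suc))) (sym (∑-+ B _ _))
∑-swap (sub zero) B f = refl
∑-swap (sub (suc n)) B f =
  trans (cong₂ _+_ (∑-swap (sub n) B (f ∘ (true ∷_))) (∑-swap (sub n) B (f ∘ (false ∷_)))) (sym (∑-+ B _ _))
∑-swap (A ⊕ A′) B f =
  trans (cong₂ _+_ (∑-swap A B (f ∘ inj₁)) (∑-swap A′ B (f ∘ inj₂))) (sym (∑-+ B _ _))
∑-swap (A ⊗ A′) B f = trans (∑-cong A λ a → ∑-swap A′ B λ a′ → f (a , a′)) (∑-swap A B _)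

∑-single : ∀ A a {f : El A → ℕ} → (∀ x → x ≢ a → f x ≡ 0) → ∑ A f ≡ f a
∑-single (fin (suc n)) zero {f} p =
  trans (cong (f zero +_) (∑-zero (fin n) λ x → p (suc x) λ ())) (+-identityʳ _)
∑-single (fin (suc n)) (suc a) {f} p =
  cong₂ _+_ (p zero λ ()) (∑-single (fin n) a λ x x≢a → p (suc x) (x≢a ∘ Fin.suc-injective))
∑-single (sub zero) [] p = refl
∑-single (sub (suc n)) (true ∷ a) {f} p = trans
  (cong₂ _+_ (∑-single (sub n) a λ x x≢a → p (true ∷ x) (x≢a ∘ Vec.∷-injectiveʳ))
             (∑-zero (sub n) λ x → p (false ∷ x) λ ())) (+-identityʳ _)
∑-single (sub (suc n)) (false ∷ a) p =
  cong₂ _+_ (∑-zero (sub n) λ x → p (true ∷ x) λ ())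
            (∑-single (sub n) a λ x x≢a → p (false ∷ x) (x≢a ∘ Vec.∷-injectiveʳ))
∑-single (A ⊕ B) (inj₁ a) p = trans
  (cong₂ _+_ (∑-single A a λ x x≢a → p (inj₁ x) (x≢a ∘ Sum.inj₁-injective))
             (∑-zero B λ x → p (inj₂ x) λ ())) (+-identityʳ _)
∑-single (A ⊕ B) (inj₂ b) p =
  cong₂ _+_ (∑-zero A λ x → p (inj₁ x) λ ())
            (∑-single B b λ x x≢b → p (inj₂ x) (x≢b ∘ Sum.inj₂-injective))
∑-single (A ⊗ B) (a , b) p = trans
  (∑-single A a λ x x≢a → ∑-zero B λ y → p (x , y) (x≢a ∘ cong proj₁))
  (∑-single B b λ y y≢b → p (a , y) (y≢b ∘ cong proj₂))

δ : ∀ A → El A → El A → ℕ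
δ A x y = ⟦ does (equal? A x y) ⟧

δ-refl : ∀ A x → δ A x x ≡ 1
δ-refl A x with equal? A x x
... | yes _ = refl
... | no x≢x = ⊥-elim (x≢x refl)

δ-≢ : ∀ A {x y} → x ≢ y → δ A x y ≡ 0
δ-≢ A {x} {y} x≢y with equal? A x y
... | yes x≡y = ⊥-elim (x≢y x≡y)
... | no _ = refl

δ-sym : ∀ A x y → δ A x y ≡ δ A y x
δ-sym A x y with equal? A x y
... | yes refl = sym (δ-refl A x)
... | no x≢y = sym (δ-≢ A (x≢y ∘ sym))

δ-pos : ∀ A {x y} → 0 < δ A x y → x ≡ y
δ-pos A {x} {y} p with equal? A x y
... | yes x≡y = x≡y

δ-subst : ∀ A x y (f : El A → ℕ) → δ A x y * f x ≡ δ A x y * f y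
δ-subst A x y f with equal? A x y
... | yes refl = refl
... | no _ = refl

∑-δ : ∀ A a (f : El A → ℕ) → ∑ A (λ x → δ A x a * f x) ≡ f a
∑-δ A a f = trans (∑-single A a λ x x≢a → cong (_* f x) (δ-≢ A x≢a))
  (trans (cong (_* f a) (δ-refl A a)) (+-identityʳ _))

∑-δʳ : ∀ A a (f : El A → ℕ) → ∑ A (λ x → δ A a x * f x) ≡ f a
∑-δʳ A a f = trans (∑-cong A λ x → cong (_* f x) (δ-sym A a x)) (∑-δ A a f)

∑-δ-1 : ∀ A a → ∑ A (λ x → δ A x a) ≡ 1
∑-δ-1 A a = trans (∑-single A a λ x → δ-≢ A) (δ-refl A a)

∑-*ʳ : ∀ A c (f : El A → ℕ) → ∑ A (λ x → f x * c) ≡ ∑ A f * c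
∑-*ʳ A c f = trans (∑-cong A λ x → *-comm (f x) c) (trans (∑-* A c f) (*-comm c _))

∑-fibres : ∀ A B (g : El A → El B) (f : El A → ℕ) →
  ∑ A f ≡ ∑ B (λ b → ∑ A λ a → δ B (g a) b * f a)
∑-fibres A B g f = trans (∑-cong A λ a → sym (∑-δʳ B (g a) (λ _ → f a))) (∑-swap A B _)

∑-term : ∀ A (f : El A → ℕ) a → f a ≤ ∑ A f
∑-term A f a = subst (_≤ ∑ A f) (∑-δ A a f) (∑-mono A bound)
  where
  bound : ∀ x → δ A x a * f x ≤ f x
  bound x with equal? A x a
  ... | yes _ = ≤-reflexive (+-identityʳ _)
  ... | no _ = z≤n

∑-strict : ∀ A {f g : El A → ℕ} a → (∀ x → f x ≤ g x) → f a < g a → ∑ A f < ∑ A g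
∑-strict A {f} {g} a f≤g fa<ga = subst (_≤ ∑ A g)
  (trans (∑-+ A (λ x → δ A x a) f) (cong (_+ ∑ A f) (∑-δ-1 A a))) (∑-mono A bound)
  where
  bound : ∀ x → δ A x a + f x ≤ g x
  bound x with equal? A x a
  ... | yes refl = fa<ga
  ... | no _ = f≤g x

∑-pos : ∀ A {f : El A → ℕ} → 0 < ∑ A f → ∃ λ x → 0 < f x
∑-pos A {f} 0<∑ with search A (λ x → 0 <? f x)
... | yes p = p
... | no ¬p = ⊥-elim (<-irrefl (sym (∑-zero A λ x → n≤0⇒n≡0 (≮⇒≥ λ 0<fx → ¬p (x , 0<fx)))) 0<∑)

∑-tight : ∀ A {f g : El A → ℕ} → (∀ x → f x ≤ g x) → ∑ A g ≤ ∑ A f → ∀ x → f x ≡ g x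
∑-tight A f≤g ∑g≤∑f x with m≤n⇒m<n∨m≡n (f≤g x)
... | inj₂ eq = eq
... | inj₁ lt = ⊥-elim (<⇒≱ (∑-strict A x f≤g lt) ∑g≤∑f)

∑-const : ∀ n c → ∑ (fin n) (λ _ → c) ≡ n * c
∑-const zero c = refl
∑-const (suc n) c = cong (c +_) (∑-const n c)

-- Integral orientations

insert : ∀ A → El A → (El A → Bool) → El A → Bool
insert A w X v = X v ∨ does (equal? A v w)

insert-self : ∀ A w X → insert A w X w ≡ true
insert-self A w X with equal? A w w
... | yes _ = Bool.∨-zeroʳ (X w)
... | no w≢w = ⊥-elim (w≢w refl)

insert-⊇ : ∀ A w X v → X v ≡ true → insert A w X v ≡ true
insert-⊇ A w X v p rewrite p = refl

insert-true : ∀ A w X v → insert A w X v ≡ true → X v ≡ true ⊎ v ≡ w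
insert-true A w X v p with X v | equal? A v w
... | true | _ = inj₁ refl
... | false | yes v≡w = inj₂ v≡w

insert-false : ∀ A w X v → insert A w X v ≡ false → X v ≡ false × v ≢ w
insert-false A w X v p with X v | equal? A v w
... | false | no v≢w = refl , v≢w

-- Saturation carries the invariant `Q` along, so that a reachable set and the objects witnessing
-- reachability are built together. Every step lowers the number of elements outside `X`.
closure : ∀ A {R : El A → El A → Set} → (∀ u w → Dec (R u w)) → (Q : (El A → Bool) → Set) →
  (∀ X u w → X u ≡ true → X w ≡ false → R u w → Q X → Q (insert A w X)) →
  ∀ X → Q X → ∃ λ Y → Q Y × (∀ v → X v ≡ true → Y v ≡ true) ×
    (∀ u w → Y u ≡ true → R u w → Y w ≡ true)
closure A {R} R? Q grow = λ X → go (missing X) X ≤-refl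
  where
  missing : (El A → Bool) → ℕ
  missing X = ∑ A λ v → ⟦ not (X v) ⟧
  shrink : ∀ X w v → ⟦ not (insert A w X v) ⟧ ≤ ⟦ not (X v) ⟧
  shrink X w v with X v | equal? A v w
  ... | true | _ = z≤n
  ... | false | yes _ = z≤n
  ... | false | no _ = s≤s z≤n
  shrink-w : ∀ X w → X w ≡ false → ⟦ not (insert A w X w) ⟧ < ⟦ not (X w) ⟧
  shrink-w X w p rewrite insert-self A w X | p = s≤s z≤n
  go : ∀ n X → missing X ≤ n → Q X → ∃ λ Y → Q Y × (∀ v → X v ≡ true → Y v ≡ true) ×
    (∀ u w → Y u ≡ true → R u w → Y w ≡ true)
  go n X le q with search (A ⊗ A) {λ (u , w) → X u ≡ true × X w ≡ false × R u w}
    (λ (u , w) → (X u Bool.≟ true) ×-dec (X w Bool.≟ false) ×-dec R? u w)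
  ... | no ¬p = X , q , (λ _ → id) , λ u w Xu r → Bool.¬-not λ Xw → ¬p ((u , w) , Xu , Xw , r)
  ... | yes ((u , w) , Xu , Xw , r) with n | ∑-strict A w (shrink X w) (shrink-w X w Xw)
  ...   | zero | lt = ⊥-elim (<⇒≱ (≤-trans lt le) z≤n)
  ...   | suc n′ | lt with go n′ (insert A w X) (≤-pred (≤-trans lt le)) (grow X u w Xu Xw r q)
  ...     | Y , qY , X⊆Y , closed = Y , qY , (λ v → X⊆Y v ∘ insert-⊇ A w X v) , closed

-- c u w counts the edges between u and w that are oriented from u to w.
Orientation : Shape → Set
Orientation A = El A → El A → ℕ

out : ∀ A → Orientation A → El A → ℕ
out A c v = ∑ A (c v)

-- Both changes are written as additions because subtraction in ℕ truncates; `0 < c u w` makes it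
-- exact.
reverse-edge : ∀ A (c : Orientation A) u w → 0 < c u w →
  ∃ λ c′ → ∀ a b → c′ a b + δ A a u * δ A b w ≡ c a b + δ A a w * δ A b u
reverse-edge A c u w 0<c = (λ a b → c a b + δ A a w * δ A b u ∸ δ A a u * δ A b w) ,
  λ a b → m∸n+n≡m (≤-trans (bound a b) (m≤m+n (c a b) _))
  where
  bound : ∀ a b → δ A a u * δ A b w ≤ c a b
  bound a b with equal? A a u | equal? A b w
  ... | yes refl | yes refl = 0<c
  ... | yes _ | no _ = z≤n
  ... | no _ | _ = z≤n

-- c can be changed, inside X, by reversing the edges of a path from s to w.
Reversible : ∀ A → Orientation A → El A → (El A → Bool) → El A → Set
Reversible A c s X w = ∃ λ c′ →
  (∀ u v → c′ u v + c′ v u ≡ c u v + c v u) ×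
  (∀ u v → X v ≡ false → c′ u v ≡ c u v) ×
  (∀ v → out A c′ v + δ A v s ≡ out A c v + δ A v w)

-- Since w ∉ X, reversing inside X has not consumed the edge u → w.
reversible-extend : ∀ A c s X u w → X u ≡ true → X w ≡ false → 0 < c u w →
  Reversible A c s X u → Reversible A c s (insert A w X) w
reversible-extend A c s X u w Xu Xw 0<c (c′ , pairs , fixed , degrees)
  with reverse-edge A c′ u w (subst (0 <_) (sym (fixed u w Xw)) 0<c)
... | c″ , upd = c″ , pairs″ , fixed″ , degrees″
  where
  pairs″ : ∀ a b → c″ a b + c″ b a ≡ c a b + c b a
  pairs″ a b = +-cancelʳ-≡ (δ A a u * δ A b w + δ A b u * δ A a w) _ _ $ begin
    c″ a b + c″ b a + (δ A a u * δ A b w + δ A b u * δ A a w) ≡⟨ lem (c″ a b) _ _ _ ⟩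
    (c″ a b + δ A a u * δ A b w) + (c″ b a + δ A b u * δ A a w) ≡⟨ cong₂ _+_ (upd a b) (upd b a) ⟩
    (c′ a b + δ A a w * δ A b u) + (c′ b a + δ A b w * δ A a u)
        ≡⟨ lem₂ (c′ a b) (c′ b a) (δ A a w) (δ A b u) (δ A b w) (δ A a u) ⟩
    c′ a b + c′ b a + (δ A a u * δ A b w + δ A b u * δ A a w)
        ≡⟨ cong (_+ (δ A a u * δ A b w + δ A b u * δ A a w)) (pairs a b) ⟩
    c a b + c b a + (δ A a u * δ A b w + δ A b u * δ A a w) ∎
    where
    open ≡-Reasoning
    lem : ∀ x y p q → x + y + (p + q) ≡ (x + p) + (y + q)
    lem = solve-∀
    lem₂ : ∀ x y p q r t → (x + p * q) + (y + r * t) ≡ x + y + (t * r + q * p)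
    lem₂ = solve-∀
  fixed″ : ∀ a b → insert A w X b ≡ false → c″ a b ≡ c a b
  fixed″ a b p with insert-false A w X b p
  ... | Xb , b≢w = trans (+-cancelʳ-≡ 0 _ _ (begin
    c″ a b + 0 ≡⟨ cong (c″ a b +_) (zero-at (δ A a u) (δ-≢ A b≢w)) ⟨
    c″ a b + δ A a u * δ A b w ≡⟨ upd a b ⟩
    c′ a b + δ A a w * δ A b u ≡⟨ cong (c′ a b +_) (zero-at (δ A a w) (δ-≢ A b≢u)) ⟩
    c′ a b + 0 ∎)) (fixed a b Xb)
    where
    open ≡-Reasoning
    zero-at : ∀ m {n} → n ≡ 0 → m * n ≡ 0
    zero-at m refl = *-zeroʳ m
    b≢u : b ≢ u
    b≢u refl with trans (sym Xu) Xb
    ... | ()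
  degree-step : ∀ v → out A c″ v + δ A v u ≡ out A c′ v + δ A v w
  degree-step v = begin
    out A c″ v + δ A v u ≡⟨ cong (out A c″ v +_) (total u w) ⟨
    out A c″ v + ∑ A (λ b → δ A v u * δ A b w) ≡⟨ ∑-+ A (c″ v) _ ⟨
    ∑ A (λ b → c″ v b + δ A v u * δ A b w) ≡⟨ ∑-cong A (upd v) ⟩
    ∑ A (λ b → c′ v b + δ A v w * δ A b u) ≡⟨ ∑-+ A (c′ v) _ ⟩
    out A c′ v + ∑ A (λ b → δ A v w * δ A b u) ≡⟨ cong (out A c′ v +_) (total w u) ⟩
    out A c′ v + δ A v w ∎
    where
    open ≡-Reasoning
    total : ∀ x y → ∑ A (λ b → δ A v x * δ A b y) ≡ δ A v x
    total x y = trans (∑-* A (δ A v x) _) (trans (cong (δ A v x *_) (∑-δ-1 A y)) (*-identityʳ _))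
  degrees″ : ∀ v → out A c″ v + δ A v s ≡ out A c v + δ A v w
  degrees″ v = +-cancelʳ-≡ (δ A v u) _ _ $ begin
    out A c″ v + δ A v s + δ A v u ≡⟨ lem (out A c″ v) _ _ ⟩
    out A c″ v + δ A v u + δ A v s ≡⟨ cong (_+ δ A v s) (degree-step v) ⟩
    out A c′ v + δ A v w + δ A v s ≡⟨ lem (out A c′ v) _ _ ⟩
    out A c′ v + δ A v s + δ A v w ≡⟨ cong (_+ δ A v w) (degrees v) ⟩
    out A c v + δ A v u + δ A v w ≡⟨ lem (out A c v) _ _ ⟩
    out A c v + δ A v w + δ A v u ∎
    where
    open ≡-Reasoning
    lem : ∀ x y z → x + y + z ≡ x + z + y
    lem = solve-∀

reversible-weaken : ∀ A c s X w v → Reversible A c s X v → Reversible A c s (insert A w X) v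
reversible-weaken A c s X w v (c′ , pairs , fixed , degrees) =
  c′ , pairs , (λ a b p → fixed a b (proj₁ (insert-false A w X b p))) , degrees

-- `X` is what directed paths from `s` can reach. Saturation makes it a cut that no edge leaves, and
-- on such a cut the out-degrees count inner edges only.
reversible-region : ∀ A c s → ∃ λ X → X s ≡ true × (∀ w → X w ≡ true → Reversible A c s X w) ×
  (∀ u w → X u ≡ true → X w ≡ false → c u w ≡ 0)
reversible-region A c s
  with closure A (λ u w → 0 <? c u w) (λ X → ∀ w → X w ≡ true → Reversible A c s X w) grow
         (insert A s (λ _ → false)) start
  where
  grow : ∀ X u w → X u ≡ true → X w ≡ false → 0 < c u w → (∀ v → X v ≡ true → Reversible A c s X v) →
    ∀ v → insert A w X v ≡ true → Reversible A c s (insert A w X) v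
  grow X u w Xu Xw 0<c rev v p with insert-true A w X v p
  ... | inj₁ Xv = reversible-weaken A c s X w v (rev v Xv)
  ... | inj₂ refl = reversible-extend A c s X u v Xu Xw 0<c (rev u Xu)
  start : ∀ w → insert A s (λ _ → false) w ≡ true → Reversible A c s _ w
  start w p with insert-true A s (λ _ → false) w p
  ... | inj₂ refl = c , (λ _ _ → refl) , (λ _ _ _ → refl) , λ _ → refl
... | X , rev , X⊇ , closed = X , X⊇ s (insert-self A s _) , rev , λ u w Xu Xw → n≤0⇒n≡0 $ ≮⇒≥ λ 0<c →
  case-absurd (trans (sym Xw) (closed u w Xu 0<c))
  where
  case-absurd : false ≡ true → ⊥
  case-absurd ()

inside : ∀ A → Orientation A → (El A → Bool) → ℕ
inside A c X = ∑ A λ u → ∑ A λ w → ⟦ X u ⟧ * (⟦ X w ⟧ * c u w)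

inside-double : ∀ A c X → inside A c X + inside A c X ≡
  ∑ A λ u → ∑ A λ w → ⟦ X u ⟧ * (⟦ X w ⟧ * (c u w + c w u))
inside-double A c X = begin
  inside A c X + inside A c X ≡⟨ cong (inside A c X +_) (∑-swap A A _) ⟩
  inside A c X + (∑ A λ u → ∑ A λ w → ⟦ X w ⟧ * (⟦ X u ⟧ * c w u)) ≡⟨ ∑-+ A _ _ ⟨
  ∑ A (λ u → (∑ A λ w → ⟦ X u ⟧ * (⟦ X w ⟧ * c u w)) + (∑ A λ w → ⟦ X w ⟧ * (⟦ X u ⟧ * c w u)))
    ≡⟨ ∑-cong A (λ u → trans (sym (∑-+ A _ _)) (∑-cong A λ w → lem ⟦ X u ⟧ ⟦ X w ⟧ (c u w) (c w u))) ⟩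
  ∑ A (λ u → ∑ A λ w → ⟦ X u ⟧ * (⟦ X w ⟧ * (c u w + c w u))) ∎
  where
  open ≡-Reasoning
  lem : ∀ x y p q → x * (y * p) + y * (x * q) ≡ x * (y * (p + q))
  lem = solve-∀

-- Only the sum of the two directions of a pair is known to scale, so the count is symmetrised by
-- doubling it.
inside-scale : ∀ A D (c e : Orientation A) → (∀ u w → e u w + e w u ≡ D * (c u w + c w u)) →
  ∀ X → inside A e X ≡ D * inside A c X
inside-scale A D c e pairs X = *-cancelˡ-≡ _ _ 2 $ begin
  2 * inside A e X ≡⟨ cong (inside A e X +_) (+-identityʳ _) ⟩
  inside A e X + inside A e X ≡⟨ inside-double A e X ⟩
  (∑ A λ u → ∑ A λ w → ⟦ X u ⟧ * (⟦ X w ⟧ * (e u w + e w u)))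
    ≡⟨ ∑-cong A (λ u → ∑-cong A λ w → trans (cong (λ z → ⟦ X u ⟧ * (⟦ X w ⟧ * z)) (pairs u w))
         (lem ⟦ X u ⟧ ⟦ X w ⟧ D _)) ⟩
  (∑ A λ u → ∑ A λ w → D * (⟦ X u ⟧ * (⟦ X w ⟧ * (c u w + c w u))))
    ≡⟨ trans (∑-cong A λ u → ∑-* A D _) (∑-* A D _) ⟩
  D * (∑ A λ u → ∑ A λ w → ⟦ X u ⟧ * (⟦ X w ⟧ * (c u w + c w u))) ≡⟨ cong (D *_) (inside-double A c X) ⟨
  D * (inside A c X + inside A c X) ≡⟨ lem₂ D (inside A c X) ⟩
  2 * (D * inside A c X) ∎
  where
  open ≡-Reasoning
  lem : ∀ x y D p → x * (y * (D * p)) ≡ D * (x * (y * p))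
  lem = solve-∀
  lem₂ : ∀ D p → D * (p + p) ≡ 2 * (D * p)
  lem₂ = solve-∀

out-within : ∀ A → Orientation A → (El A → Bool) → ℕ
out-within A c X = ∑ A λ u → ⟦ X u ⟧ * out A c u

inside-≤-out : ∀ A c X → inside A c X ≤ out-within A c X
inside-≤-out A c X = ∑-mono A λ u → ≤-trans (≤-reflexive (∑-* A ⟦ X u ⟧ _))
  (*-monoʳ-≤ ⟦ X u ⟧ (∑-mono A λ w → bound (X w) (c u w)))
  where
  bound : ∀ b n → ⟦ b ⟧ * n ≤ n
  bound true n = ≤-reflexive (+-identityʳ n)
  bound false n = z≤n

inside-closed : ∀ A c X → (∀ u w → X u ≡ true → X w ≡ false → c u w ≡ 0) →
  inside A c X ≡ out-within A c X
inside-closed A c X closed = ∑-cong A λ u → trans (∑-* A ⟦ X u ⟧ _) (inner u)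
  where
  inner : ∀ u → ⟦ X u ⟧ * ∑ A (λ w → ⟦ X w ⟧ * c u w) ≡ ⟦ X u ⟧ * out A c u
  inner u with X u in Xu
  ... | false = refl
  ... | true = cong (λ z → z + 0) (∑-cong A λ w → entry w)
    where
    entry : ∀ w → ⟦ X w ⟧ * c u w ≡ c u w
    entry w with X w in Xw
    ... | true = +-identityʳ _
    ... | false = sym (closed u w Xu Xw)

module _ (A : Shape) (D : ℕ) .{{_ : NonZero D}} (c₀ e : Orientation A) (b : El A → ℕ)
  (pairs : ∀ u w → e u w + e w u ≡ D * (c₀ u w + c₀ w u))
  (degrees : ∀ v → out A e v ≡ D * b v) where

  private
    Reoriented : Orientation A → Set
    Reoriented c = ∀ u w → c u w + c w u ≡ c₀ u w + c₀ w u

    pairs′ : ∀ c → Reoriented c → ∀ u w → e u w + e w u ≡ D * (c u w + c w u)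
    pairs′ c re u w = trans (pairs u w) (cong (D *_) (sym (re u w)))

    e-within : ∀ X → out-within A e X ≡ D * ∑ A (λ v → ⟦ X v ⟧ * b v)
    e-within X = trans (∑-cong A λ v → trans (cong (⟦ X v ⟧ *_) (degrees v)) (lem ⟦ X v ⟧ D (b v))) (∑-* A D _)
      where
      lem : ∀ x D p → x * (D * p) ≡ D * (x * p)
      lem = solve-∀

    -- The cut condition: as no edge of `c` leaves `X`, its out-degrees there count the edges inside
    -- `X`. In `e` there are D times as many of these, and they are part of the out-degrees
    -- prescribed for `e`.
    closed-bound : ∀ c → Reoriented c → ∀ X → (∀ u w → X u ≡ true → X w ≡ false → c u w ≡ 0) →
      out-within A c X ≤ ∑ A λ v → ⟦ X v ⟧ * b v
    closed-bound c re X closed = *-cancelˡ-≤ D $ begin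
      D * out-within A c X ≡⟨ cong (D *_) (inside-closed A c X closed) ⟨
      D * inside A c X ≡⟨ inside-scale A D c e (pairs′ c re) X ⟨
      inside A e X ≤⟨ inside-≤-out A e X ⟩
      out-within A e X ≡⟨ e-within X ⟩
      D * ∑ A (λ v → ⟦ X v ⟧ * b v) ∎
      where open ≤-Reasoning

    all-within : ∀ f → ∑ A (λ v → 1 * f v) ≡ ∑ A f
    all-within f = ∑-cong A λ v → +-identityʳ _

    totals : ∀ c → Reoriented c → ∑ A b ≤ ∑ A (out A c)
    totals c re = *-cancelˡ-≤ D $ begin
      D * ∑ A b ≡⟨ cong (D *_) (all-within b) ⟨
      D * ∑ A (λ v → 1 * b v) ≡⟨ e-within (λ _ → true) ⟨
      out-within A e (λ _ → true) ≡⟨ inside-closed A e (λ _ → true) (λ _ _ _ ()) ⟨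
      inside A e (λ _ → true) ≡⟨ inside-scale A D c e (pairs′ c re) (λ _ → true) ⟩
      D * inside A c (λ _ → true) ≡⟨ cong (D *_) (inside-closed A c (λ _ → true) (λ _ _ _ ())) ⟩
      D * out-within A c (λ _ → true) ≡⟨ cong (D *_) (all-within (out A c)) ⟩
      D * ∑ A (out A c) ∎
      where open ≤-Reasoning

    excess : Orientation A → ℕ
    excess c = ∑ A λ v → out A c v ∸ b v

    -- One unit moves from `s` to `t`: the surplus at `s` falls, and the shortage at `t` keeps `t`
    -- from gaining a surplus.
    improve : ∀ c s t c′ → b s < out A c s → out A c t < b t →
      (∀ v → out A c′ v + δ A v s ≡ out A c v + δ A v t) → excess c′ < excess c
    improve c s t c′ s-over t-under deg = ∑-strict A s bound strict
      where
      s≢t : s ≢ t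
      s≢t refl = <-asym s-over t-under
      bound : ∀ v → out A c′ v ∸ b v ≤ out A c v ∸ b v
      bound v with equal? A v s | equal? A v t | deg v
      ... | no _ | yes refl | d = ≤-trans (≤-reflexive (m≤n⇒m∸n≡0 (≤-trans (≤-reflexive
              (trans (sym (+-identityʳ _)) (trans d (+-comm _ 1)))) t-under))) z≤n
      ... | yes _ | yes _ | d = ∸-monoˡ-≤ (b v) (≤-reflexive (+-cancelʳ-≡ 1 _ _ d))
      ... | yes _ | no _ | d = ∸-monoˡ-≤ (b v) (≤-trans (m≤m+n _ 1) (≤-reflexive (trans d (+-identityʳ _))))
      ... | no _ | no _ | d = ∸-monoˡ-≤ (b v) (≤-reflexive (+-cancelʳ-≡ 0 _ _ d))
      strict : out A c′ s ∸ b s < out A c s ∸ b s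
      strict with deg s
      ... | d rewrite δ-refl A s | δ-≢ A s≢t = begin-strict
        out A c′ s ∸ b s <⟨ ∸-monoˡ-< (≤-reflexive c′+1) (≤-pred (≤-trans s-over (≤-reflexive (sym c′+1)))) ⟩
        out A c s ∸ b s ∎
        where
        open ≤-Reasoning
        c′+1 : suc (out A c′ s) ≡ out A c s
        c′+1 = trans (+-comm 1 _) (trans d (+-identityʳ _))

    balance : ∀ n c → Reoriented c → excess c ≤ n → ∃ λ c → Reoriented c × (∀ v → out A c v ≡ b v)
    balance n c re le with search A (λ v → b v <? out A c v)
    -- Without a surplus anywhere, the totals leave no shortage either.
    ... | no ¬over = c , re , ∑-tight A (λ v → ≮⇒≥ λ o → ¬over (v , o)) (totals c re)
    ... | yes (s , s-over) with reversible-region A c s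
    ...   | X , Xs , rev , closed with search A {λ t → X t ≡ true × out A c t < b t}
              (λ t → (X t Bool.≟ true) ×-dec (out A c t <? b t))
    -- If `X` had no shortage, the surplus at `s` would push the out-degrees within `X` above the
    -- bound for a cut that no edge leaves.
    ...     | no ¬under = ⊥-elim (<⇒≱ (∑-strict A s bound strict) (closed-bound c re X closed))
      where
      bound : ∀ v → ⟦ X v ⟧ * b v ≤ ⟦ X v ⟧ * out A c v
      bound v with X v in Xv
      ... | false = z≤n
      ... | true = *-monoʳ-≤ 1 (≮⇒≥ λ u → ¬under (v , Xv , u))
      strict : ⟦ X s ⟧ * b s < ⟦ X s ⟧ * out A c s
      strict rewrite Xs = *-monoʳ-< 1 s-over
    ...     | yes (t , Xt , t-under) with rev t Xt
    ...       | c′ , re′ , _ , deg with n | improve c s t c′ s-over t-under deg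
    ...         | zero | lt = ⊥-elim (<⇒≱ (≤-trans lt le) z≤n)
    ...         | suc n′ | lt = balance n′ c′ (λ u w → trans (re′ u w) (re u w)) (≤-pred (≤-trans lt le))

  -- e / D is a fractional orientation with integral out-degrees.
  integral-orientation : ∃ λ c → (∀ u w → c u w + c w u ≡ c₀ u w + c₀ w u) × (∀ v → out A c v ≡ b v)
  integral-orientation = balance (excess c₀) c₀ (λ _ _ → refl) ≤-refl

-- Integral rounding

-- Orient a network: rows → (column, group) → column; the capacity of a group becomes the number
-- of edges between the group and its column.
module _ (A K G : Shape) (D : ℕ) .{{_ : NonZero D}} (x F : El A → El K → ℕ) (R : El A → ℕ) (r : ℕ)
  (grp : El K → El A → El G) (cap : El K → El G → ℕ)
  (F≤x : ∀ S j → F S j ≤ D * x S j)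
  (F-row : ∀ S → ∑ K (F S) ≡ D * R S)
  (F-col : ∀ j → ∑ A (λ S → F S j) ≡ D * r)
  (F-grp : ∀ j g → ∑ A (λ S → δ G (grp j S) g * F S j) ≤ D * cap j g) where

  private
    Node : Shape
    Node = A ⊕ ((K ⊗ G) ⊕ K)

    f : El K → El G → ℕ
    f j g = ∑ A λ S → δ G (grp j S) g * F S j

    -- `c₀` orients every edge forwards. In `e`, the forward part of the D copies of an edge is the
    -- fractional flow through it, and the backward part is the slack.
    c₀ e : Orientation Node
    c₀ (inj₁ S) (inj₂ (inj₁ (j , g))) = δ G (grp j S) g * x S j
    c₀ (inj₂ (inj₁ (j , g))) (inj₂ (inj₂ j′)) = δ K j j′ * cap j g
    c₀ _ _ = 0
    e (inj₁ S) (inj₂ (inj₁ (j , g))) = δ G (grp j S) g * F S j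
    e (inj₂ (inj₁ (j , g))) (inj₁ S) = δ G (grp j S) g * (D * x S j ∸ F S j)
    e (inj₂ (inj₁ (j , g))) (inj₂ (inj₂ j′)) = δ K j j′ * f j g
    e (inj₂ (inj₂ j′)) (inj₂ (inj₁ (j , g))) = δ K j j′ * (D * cap j g ∸ f j g)
    e _ _ = 0

    b : El Node → ℕ
    b (inj₁ S) = R S
    b (inj₂ (inj₁ (j , g))) = ∑ A λ S → δ G (grp j S) g * x S j
    b (inj₂ (inj₂ j)) = ∑ K (λ j′ → ∑ G λ g → δ K j′ j * cap j′ g) ∸ r

    0≡D*0 : 0 ≡ D * 0
    0≡D*0 = sym (*-zeroʳ D)

    split : ∀ d {p q} → q ≤ D * p → d * q + d * (D * p ∸ q) ≡ D * (d * p)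
    split d {p} {q} q≤ = begin
      d * q + d * (D * p ∸ q) ≡⟨ *-distribˡ-+ d q _ ⟨
      d * (q + (D * p ∸ q)) ≡⟨ cong (d *_) (m+[n∸m]≡n q≤) ⟩
      d * (D * p) ≡⟨ lem d D p ⟩
      D * (d * p) ∎
      where
      open ≡-Reasoning
      lem : ∀ d D p → d * (D * p) ≡ D * (d * p)
      lem = solve-∀

    pairs : ∀ u w → e u w + e w u ≡ D * (c₀ u w + c₀ w u)
    pairs (inj₁ S) (inj₁ _) = 0≡D*0
    pairs (inj₁ S) (inj₂ (inj₁ (j , g))) =
      trans (split (δ G (grp j S) g) (F≤x S j)) (cong (D *_) (sym (+-identityʳ _)))
    pairs (inj₁ S) (inj₂ (inj₂ _)) = 0≡D*0
    pairs (inj₂ (inj₁ (j , g))) (inj₁ S) =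
      trans (+-comm (δ G (grp j S) g * _) _) (split (δ G (grp j S) g) (F≤x S j))
    pairs (inj₂ (inj₁ _)) (inj₂ (inj₁ _)) = 0≡D*0
    pairs (inj₂ (inj₁ (j , g))) (inj₂ (inj₂ j′)) =
      trans (split (δ K j j′) (F-grp j g)) (cong (D *_) (sym (+-identityʳ _)))
    pairs (inj₂ (inj₂ _)) (inj₁ _) = 0≡D*0
    pairs (inj₂ (inj₂ j′)) (inj₂ (inj₁ (j , g))) =
      trans (+-comm (δ K j j′ * _) _) (split (δ K j j′) (F-grp j g))
    pairs (inj₂ (inj₂ _)) (inj₂ (inj₂ _)) = 0≡D*0

    ∑f : ∀ j → ∑ G (f j) ≡ D * r
    ∑f j = trans (sym (∑-fibres A G (grp j) (λ S → F S j))) (F-col j)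

    column-cap : El K → ℕ
    column-cap j = ∑ K λ j′ → ∑ G λ g → δ K j′ j * cap j′ g

    ∑-column : ∀ j (z : El K → El G → ℕ) → ∑ K (λ j′ → ∑ G λ g → δ K j′ j * z j′ g) ≡ ∑ G (z j)
    ∑-column j z = trans (∑-cong K λ j′ → ∑-* G (δ K j′ j) (z j′)) (∑-δ K j (λ j′ → ∑ G (z j′)))

    -- Makes the subtraction in `b` exact, so that the flow `r` can be read back from the leftover
    -- capacity in `y-col`.
    r≤column-cap : ∀ j → r ≤ column-cap j
    r≤column-cap j = *-cancelˡ-≤ D $ begin
      D * r ≡⟨ ∑f j ⟨
      ∑ G (f j) ≤⟨ ∑-mono G (F-grp j) ⟩
      ∑ G (λ g → D * cap j g) ≡⟨ ∑-* G D _ ⟩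
      D * ∑ G (cap j) ≡⟨ cong (D *_) (∑-column j cap) ⟨
      D * column-cap j ∎
      where open ≤-Reasoning

    degrees : ∀ v → out Node e v ≡ D * b v
    degrees (inj₁ S) = begin
      ∑ A (λ _ → 0) + (∑ K (λ j → ∑ G λ g → δ G (grp j S) g * F S j) + ∑ K (λ _ → 0))
        ≡⟨ cong₂ (λ p q → p + (∑ K (λ j → ∑ G λ g → δ G (grp j S) g * F S j) + q))
             (∑-zero A λ _ → refl) (∑-zero K λ _ → refl) ⟩
      ∑ K (λ j → ∑ G λ g → δ G (grp j S) g * F S j) + 0 ≡⟨ +-identityʳ _ ⟩
      ∑ K (λ j → ∑ G λ g → δ G (grp j S) g * F S j) ≡⟨ ∑-cong K (λ j → ∑-δʳ G (grp j S) (λ _ → F S j)) ⟩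
      ∑ K (F S) ≡⟨ F-row S ⟩
      D * R S ∎
      where open ≡-Reasoning
    degrees (inj₂ (inj₁ (j , g))) = begin
      rest + (∑ K (λ _ → ∑ G λ _ → 0) + ∑ K (λ j′ → δ K j j′ * f j g))
        ≡⟨ cong₂ (λ p q → rest + (p + q)) (∑-zero K λ _ → ∑-zero G λ _ → refl) (∑-δʳ K j (λ _ → f j g)) ⟩
      rest + f j g ≡⟨ +-comm rest _ ⟩
      f j g + rest ≡⟨ ∑-+ A _ _ ⟨
      ∑ A (λ S → δ G (grp j S) g * F S j + δ G (grp j S) g * (D * x S j ∸ F S j))
        ≡⟨ ∑-cong A (λ S → split (δ G (grp j S) g) (F≤x S j)) ⟩
      ∑ A (λ S → D * (δ G (grp j S) g * x S j)) ≡⟨ ∑-* A D _ ⟩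
      D * ∑ A (λ S → δ G (grp j S) g * x S j) ∎
      where
      open ≡-Reasoning
      rest = ∑ A λ S → δ G (grp j S) g * (D * x S j ∸ F S j)
    degrees (inj₂ (inj₂ j)) = begin
      ∑ A (λ _ → 0) + (flow + ∑ K (λ _ → 0))
        ≡⟨ cong₂ (λ p q → p + (flow + q)) (∑-zero A λ _ → refl) (∑-zero K λ _ → refl) ⟩
      flow + 0 ≡⟨ +-identityʳ _ ⟩
      flow ≡⟨ m+n∸n≡m flow (D * r) ⟨
      flow + D * r ∸ D * r ≡⟨ cong (_∸ D * r) total ⟩
      D * column-cap j ∸ D * r ≡⟨ *-distribˡ-∸ D (column-cap j) r ⟨
      D * (column-cap j ∸ r) ∎
      where
      open ≡-Reasoning
      flow = ∑ K λ j′ → ∑ G λ g → δ K j′ j * (D * cap j′ g ∸ f j′ g)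
      total : flow + D * r ≡ D * column-cap j
      total = begin
        flow + D * r ≡⟨ cong₂ _+_ (∑-column j (λ j′ g → D * cap j′ g ∸ f j′ g)) (sym (∑f j)) ⟩
        ∑ G (λ g → D * cap j g ∸ f j g) + ∑ G (f j) ≡⟨ ∑-+ G _ _ ⟨
        ∑ G (λ g → D * cap j g ∸ f j g + f j g) ≡⟨ ∑-cong G (λ g → m∸n+n≡m (F-grp j g)) ⟩
        ∑ G (λ g → D * cap j g) ≡⟨ ∑-* G D _ ⟩
        D * ∑ G (cap j) ≡⟨ cong (D *_) (∑-column j cap) ⟨
        D * column-cap j ∎

    module Read (c : Orientation Node) (cp : ∀ u w → c u w + c w u ≡ c₀ u w + c₀ w u)
      (co : ∀ v → out Node c v ≡ b v) where

      w : El A → El K → El G → ℕ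
      w S j g = c (inj₁ S) (inj₂ (inj₁ (j , g)))

      y : El A → El K → ℕ
      y S j = ∑ G (w S j)

      null : ∀ u w → c₀ u w ≡ 0 → c₀ w u ≡ 0 → c u w ≡ 0
      null u w p q = m+n≡0⇒m≡0 _ (trans (cp u w) (cong₂ _+_ p q))

      w-pair : ∀ S j g → w S j g + c (inj₂ (inj₁ (j , g))) (inj₁ S) ≡ δ G (grp j S) g * x S j
      w-pair S j g = trans (cp _ _) (+-identityʳ _)

      w-bound : ∀ S j g → w S j g ≤ δ G (grp j S) g * x S j
      w-bound S j g = ≤-trans (m≤m+n _ _) (≤-reflexive (w-pair S j g))

      w-off : ∀ S j g → grp j S ≢ g → w S j g ≡ 0
      w-off S j g ne = n≤0⇒n≡0 (≤-trans (w-bound S j g) (≤-reflexive (cong (_* x S j) (δ-≢ G ne))))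

      w≡δy : ∀ S j g → δ G (grp j S) g * y S j ≡ w S j g
      w≡δy S j g with equal? G (grp j S) g
      ... | yes refl = trans (+-identityʳ _) (∑-single G (grp j S) λ g ne → w-off S j g (ne ∘ sym))
      ... | no ne = sym (w-off S j g ne)

      y≤x : ∀ S j → y S j ≤ x S j
      y≤x S j = ≤-trans (∑-mono G (w-bound S j)) (≤-reflexive (∑-δʳ G (grp j S) (λ _ → x S j)))

      y-row : ∀ S → ∑ K (y S) ≡ R S
      y-row S = begin
        ∑ K (y S) ≡⟨ +-identityʳ _ ⟨
        ∑ K (y S) + 0 ≡⟨ cong₂ (λ p q → p + (∑ K (y S) + q))
          (∑-zero A λ S′ → null (inj₁ S) (inj₁ S′) refl refl)
          (∑-zero K λ j → null (inj₁ S) (inj₂ (inj₂ j)) refl refl) ⟨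
        out Node c (inj₁ S) ≡⟨ co (inj₁ S) ⟩
        R S ∎
        where open ≡-Reasoning

      through : El K → El G → El K → ℕ
      through j g j′ = c (inj₂ (inj₁ (j , g))) (inj₂ (inj₂ j′))

      conserve : ∀ j g → ∑ K (through j g) ≡ ∑ A (λ S → w S j g)
      conserve j g = +-cancelˡ-≡ back _ _ $ begin
        back + ∑ K (through j g) ≡⟨ cong (λ p → back + (p + ∑ K (through j g)))
          (∑-zero K λ j′ → ∑-zero G λ g′ → null (inj₂ (inj₁ (j , g))) (inj₂ (inj₁ (j′ , g′))) refl refl) ⟨
        out Node c (inj₂ (inj₁ (j , g))) ≡⟨ co (inj₂ (inj₁ (j , g))) ⟩
        ∑ A (λ S → δ G (grp j S) g * x S j) ≡⟨ ∑-cong A (λ S → w-pair S j g) ⟨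
        ∑ A (λ S → w S j g + c (inj₂ (inj₁ (j , g))) (inj₁ S)) ≡⟨ ∑-+ A _ _ ⟩
        ∑ A (λ S → w S j g) + back ≡⟨ +-comm _ back ⟩
        back + ∑ A (λ S → w S j g) ∎
        where
        open ≡-Reasoning
        back = ∑ A λ S → c (inj₂ (inj₁ (j , g))) (inj₁ S)

      through-pair : ∀ j g j′ → c (inj₂ (inj₂ j′)) (inj₂ (inj₁ (j , g))) + through j g j′ ≡ δ K j j′ * cap j g
      through-pair j g j′ = cp _ _

      through-bound : ∀ j g j′ → through j g j′ ≤ δ K j j′ * cap j g
      through-bound j g j′ = ≤-trans (m≤n+m _ _) (≤-reflexive (through-pair j g j′))

      through-off : ∀ j g j′ → j ≢ j′ → through j g j′ ≡ 0
      through-off j g j′ ne = n≤0⇒n≡0 (≤-trans (through-bound j g j′) (≤-reflexive (cong (_* cap j g) (δ-≢ K ne))))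

      y-grp : ∀ j g → ∑ A (λ S → δ G (grp j S) g * y S j) ≤ cap j g
      y-grp j g = begin
        ∑ A (λ S → δ G (grp j S) g * y S j) ≡⟨ ∑-cong A (λ S → w≡δy S j g) ⟩
        ∑ A (λ S → w S j g) ≡⟨ conserve j g ⟨
        ∑ K (through j g) ≤⟨ ∑-mono K (through-bound j g) ⟩
        ∑ K (λ j′ → δ K j j′ * cap j g) ≡⟨ ∑-δʳ K j (λ _ → cap j g) ⟩
        cap j g ∎
        where open ≤-Reasoning

      y-col : ∀ j → ∑ A (λ S → y S j) ≡ r
      y-col j = begin
        ∑ A (λ S → ∑ G λ g → w S j g) ≡⟨ ∑-swap A G _ ⟩
        ∑ G (λ g → ∑ A λ S → w S j g) ≡⟨ ∑-cong G (λ g → conserve j g) ⟨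
        ∑ G (λ g → ∑ K (through j g)) ≡⟨ ∑-cong G (λ g → ∑-single K j λ j′ ne → through-off j g j′ (ne ∘ sym)) ⟩
        ∑ G (λ g → through j g j) ≡⟨ ∑-cong G (λ g → ∑-single K j λ j′ ne → through-off j′ g j ne) ⟨
        ∑ G (λ g → ∑ K λ j′ → through j′ g j) ≡⟨ ∑-swap G K _ ⟩
        forward ≡⟨ m+n∸m≡n backward forward ⟨
        backward + forward ∸ backward ≡⟨ cong₂ _∸_ total degree-j ⟩
        column-cap j ∸ (column-cap j ∸ r) ≡⟨ m∸[m∸n]≡n (r≤column-cap j) ⟩
        r ∎
        where
        open ≡-Reasoning
        forward = ∑ K λ j′ → ∑ G λ g → through j′ g j
        backward = ∑ K λ j′ → ∑ G λ g → c (inj₂ (inj₂ j)) (inj₂ (inj₁ (j′ , g)))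
        total : backward + forward ≡ column-cap j
        total = trans (sym (∑-+ K _ _)) (∑-cong K λ j′ → trans (sym (∑-+ G _ _))
          (∑-cong G λ g → through-pair j′ g j))
        degree-j : backward ≡ column-cap j ∸ r
        degree-j = begin
          backward ≡⟨ +-identityʳ _ ⟨
          backward + 0 ≡⟨ cong₂ (λ p q → p + (backward + q))
            (∑-zero A λ S → null (inj₂ (inj₂ j)) (inj₁ S) refl refl)
            (∑-zero K λ j′ → null (inj₂ (inj₂ j)) (inj₂ (inj₂ j′)) refl refl) ⟨
          out Node c (inj₂ (inj₂ j)) ≡⟨ co (inj₂ (inj₂ j)) ⟩
          column-cap j ∸ r ∎

  integral-rounding : ∃ λ y → (∀ S j → y S j ≤ x S j) × (∀ S → ∑ K (y S) ≡ R S) ×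
    (∀ j → ∑ A (λ S → y S j) ≡ r) × (∀ j g → ∑ A (λ S → δ G (grp j S) g * y S j) ≤ cap j g)
  integral-rounding with integral-orientation Node D c₀ e b pairs degrees
  ... | c , cp , co = y , y≤x , y-row , y-col , y-grp
    where open Read c cp co

-- Splitting one vertex off the amalgamated vertex

positive? : ∀ n → Dec (0 < n)
positive? zero = no λ ()
positive? (suc n) = yes (s≤s z≤n)

-- ways h N s is the binomial coefficient C(N, h − s), set to 0 when s > h.
ways : ℕ → ℕ → ℕ → ℕ
ways h zero s = ⟦ does (s ≟ h) ⟧
ways h (suc N) s = ways h N s + ways h N (suc s)

ways-large : ∀ h N s → h < s → ways h N s ≡ 0
ways-large h zero s h<s = cong ⟦_⟧ (dec-false (s ≟ h) (<⇒≢ h<s ∘ sym))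
ways-large h (suc N) s h<s = cong₂ _+_ (ways-large h N s h<s) (ways-large h N (suc s) (m<n⇒m<1+n h<s))

ways-shift : ∀ h N s → (h ∸ s) * ways h N (suc s) ≡ (h ∸ suc s) * ways h N (suc s) + ways h N (suc s)
ways-shift h N s with s <? h
... | yes s<h = trans (cong (_* ways h N (suc s)) (trans (+-∸-assoc 1 s<h) refl)) (+-comm (ways h N (suc s)) _)
... | no s≮h rewrite ways-large h N (suc s) (s≤s (≮⇒≥ s≮h)) | *-zeroʳ (h ∸ s) | *-zeroʳ (h ∸ suc s) = refl

-- The absorption identity of binomial coefficients. It makes the row totals of the fractional
-- splitting integral.
ways-absorb : ∀ h N s → (h ∸ s) * ways h (suc N) s ≡ suc N * ways h N (suc s)
ways-absorb h N s = begin
  (h ∸ s) * (ways h N s + ways h N (suc s)) ≡⟨ *-distribˡ-+ (h ∸ s) (ways h N s) _ ⟩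
  (h ∸ s) * ways h N s + (h ∸ s) * ways h N (suc s) ≡⟨ cong ((h ∸ s) * ways h N s +_) (ways-shift h N s) ⟩
  (h ∸ s) * ways h N s + ((h ∸ suc s) * ways h N (suc s) + ways h N (suc s)) ≡⟨ rest N ⟩
  suc N * ways h N (suc s) ∎
  where
  open ≡-Reasoning
  rest : ∀ N → (h ∸ s) * ways h N s + ((h ∸ suc s) * ways h N (suc s) + ways h N (suc s)) ≡ suc N * ways h N (suc s)
  rest zero = cong₂ (λ p q → p + (q + ways h 0 (suc s))) (zero-at s) (zero-at (suc s))
      ∙ sym (+-identityʳ _)
    where
    _∙_ = trans
    zero-at : ∀ s → (h ∸ s) * ways h 0 s ≡ 0
    zero-at s with s <? h
    ... | no s≮h = cong (_* ways h 0 s) (m≤n⇒m∸n≡0 (≮⇒≥ s≮h))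
    ... | yes s<h = trans (cong (λ b → (h ∸ s) * ⟦ b ⟧) (dec-false (s ≟ h) (<⇒≢ s<h))) (*-zeroʳ (h ∸ s))
  rest (suc N) = trans (cong₂ (λ p q → p + (q + ways h (suc N) (suc s))) (ways-absorb h N s) (ways-absorb h N (suc s)))
    (lem N (ways h N (suc s)) (ways h N (suc (suc s))))
    where
    lem : ∀ N p q → suc N * p + (suc N * q + (p + q)) ≡ suc (suc N) * (p + q)
    lem = solve-∀

ways-Vandermonde : ∀ h N q s → ∑ (sub q) (λ S → ways h N (∣ S ∣ + s)) ≡ ways h (q + N) s
ways-Vandermonde h N zero s = refl
ways-Vandermonde h N (suc q) s = trans (+-comm
    (∑ (sub q) λ S → ways h N (suc ∣ S ∣ + s)) _) (cong₂ _+_ (ways-Vandermonde h N q s)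
  (trans (∑-cong (sub q) λ S → cong (ways h N) (sym (+-suc ∣ S ∣ s))) (ways-Vandermonde h N q (suc s))))

-- X S j counts the edges of colour j that contain exactly the vertices S together with
-- h − ∣S∣ copies (hinges) of the vertex representing the N vertices not yet split off.
record Amalgam (h lam r k N M : ℕ) (X : Subset M → Fin k → ℕ) : Set where
  field
    rows : ∀ S → ∑ (fin k) (X S) ≡ lam * ways h N ∣ S ∣
    degrees : ∀ j v → ∑ (sub M) (λ S → ⟦ lookup S v ⟧ * X S j) ≡ r
    hinges : ∀ j → ∑ (sub M) (λ S → (h ∸ ∣ S ∣) * X S j) ≡ N * r

-- y S of the x S edges on S pass one hinge to the new vertex.
split-off : ∀ {M} → (Subset M → ℕ) → (Subset M → ℕ) → Subset (suc M) → ℕ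
split-off x y (true ∷ S) = y S
split-off x y (false ∷ S) = x S ∸ y S

-- An edge loses exactly the hinge that it passes on. Where no hinge is left, `h ∸ suc s` truncates,
-- and the last hypothesis says that nothing is passed.
hinge-split : ∀ h s {x y} → y ≤ x → (h ≤ s → y ≡ 0) → (h ∸ suc s) * y + (h ∸ s) * (x ∸ y) + y ≡ (h ∸ s) * x
hinge-split h s {x} {y} y≤x full with s <? h
... | no s≮h rewrite full (≮⇒≥ s≮h) | *-zeroʳ (h ∸ suc s) = +-identityʳ _
... | yes s<h = begin
  (h ∸ suc s) * y + (h ∸ s) * (x ∸ y) + y ≡⟨ lem (h ∸ suc s) y _ ⟩
  suc (h ∸ suc s) * y + (h ∸ s) * (x ∸ y) ≡⟨ cong (λ t → t * y + (h ∸ s) * (x ∸ y)) (+-∸-assoc 1 s<h) ⟨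
  (h ∸ s) * y + (h ∸ s) * (x ∸ y) ≡⟨ *-distribˡ-+ (h ∸ s) y _ ⟨
  (h ∸ s) * (y + (x ∸ y)) ≡⟨ cong ((h ∸ s) *_) (m+[n∸m]≡n y≤x) ⟩
  (h ∸ s) * x ∎
  where
  open ≡-Reasoning
  lem : ∀ t y z → t * y + z + y ≡ suc t * y + z
  lem = solve-∀

module _ {h lam r k N M : ℕ} {X y : Subset M → Fin k → ℕ} (am : Amalgam h lam r k (suc N) M X)
  (y≤X : ∀ S j → y S j ≤ X S j) (y-rows : ∀ S → ∑ (fin k) (y S) ≡ lam * ways h N (suc ∣ S ∣)) where
  open Amalgam am

  full-unsplit : ∀ S j → h ≤ ∣ S ∣ → y S j ≡ 0
  full-unsplit S j h≤ = n≤0⇒n≡0 (≤-trans (∑-term (fin k) (y S) j) (≤-reflexive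
    (trans (y-rows S) (trans (cong (lam *_) (ways-large h N _ (s≤s h≤))) (*-zeroʳ lam)))))

  -- An edge keeps its old vertices whether or not it passes a hinge, which preserves the old
  -- degrees; the multiplicities of the edges that pass none follow from Pascal's rule.
  amalgam-split : (∀ j → ∑ (sub M) (λ S → y S j) ≡ r) →
    Amalgam h lam r k N (suc M) (λ S j → split-off (λ T → X T j) (λ T → y T j) S)
  amalgam-split y-cols = record { rows = rows′ ; degrees = degrees′ ; hinges = hinges′ }
    where
    rows′ : ∀ S → ∑ (fin k) (λ j → split-off (λ T → X T j) (λ T → y T j) S) ≡ lam * ways h N ∣ S ∣
    rows′ (true ∷ S) = y-rows S
    rows′ (false ∷ S) = +-cancelʳ-≡ (∑ (fin k) (y S)) _ _ $ begin
      ∑ (fin k) (λ j → X S j ∸ y S j) + ∑ (fin k) (y S) ≡⟨ ∑-+ (fin k) _ _ ⟨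
      ∑ (fin k) (λ j → X S j ∸ y S j + y S j) ≡⟨ ∑-cong (fin k) (λ j → m∸n+n≡m (y≤X S j)) ⟩
      ∑ (fin k) (X S) ≡⟨ rows S ⟩
      lam * (ways h N ∣ S ∣ + ways h N (suc ∣ S ∣)) ≡⟨ *-distribˡ-+ lam (ways h N ∣ S ∣) _ ⟩
      lam * ways h N ∣ S ∣ + lam * ways h N (suc ∣ S ∣) ≡⟨ cong (lam * ways h N ∣ S ∣ +_) (y-rows S) ⟨
      lam * ways h N ∣ S ∣ + ∑ (fin k) (y S) ∎
      where open ≡-Reasoning
    degrees′ : ∀ j v → ∑ (sub (suc M)) (λ S → ⟦ lookup S v ⟧ * split-off (λ T → X T j) (λ T → y T j) S) ≡ r
    degrees′ j zero = begin
      ∑ (sub M) (λ S → y S j + 0) + ∑ (sub M) (λ S → 0) ≡⟨ cong₂ _+_ (∑-cong (sub M) λ S → +-identityʳ _) (∑-zero (sub M) λ _ → refl) ⟩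
      ∑ (sub M) (λ S → y S j) + 0 ≡⟨ +-identityʳ _ ⟩
      ∑ (sub M) (λ S → y S j) ≡⟨ y-cols j ⟩
      r ∎
      where open ≡-Reasoning
    degrees′ j (suc v) = begin
      ∑ (sub M) (λ S → ⟦ lookup S v ⟧ * y S j) + ∑ (sub M) (λ S → ⟦ lookup S v ⟧ * (X S j ∸ y S j)) ≡⟨ ∑-+ (sub M) _ _ ⟨
      ∑ (sub M) (λ S → ⟦ lookup S v ⟧ * y S j + ⟦ lookup S v ⟧ * (X S j ∸ y S j))
        ≡⟨ ∑-cong (sub M) (λ S → trans (sym (*-distribˡ-+ ⟦ lookup S v ⟧ (y S j) _)) (cong (⟦ lookup S v ⟧ *_) (m+[n∸m]≡n (y≤X S j)))) ⟩
      ∑ (sub M) (λ S → ⟦ lookup S v ⟧ * X S j) ≡⟨ degrees j v ⟩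
      r ∎
      where open ≡-Reasoning
    hinges′ : ∀ j → ∑ (sub (suc M)) (λ S → (h ∸ ∣ S ∣) * split-off (λ T → X T j) (λ T → y T j) S) ≡ N * r
    hinges′ j = +-cancelʳ-≡ r _ _ $ begin
      ∑ (sub M) (λ S → (h ∸ suc ∣ S ∣) * y S j) + ∑ (sub M) (λ S → (h ∸ ∣ S ∣) * (X S j ∸ y S j)) + r
        ≡⟨ cong₂ _+_ (∑-+ (sub M) _ _) (y-cols j) ⟨
      ∑ (sub M) (λ S → (h ∸ suc ∣ S ∣) * y S j + (h ∸ ∣ S ∣) * (X S j ∸ y S j)) + ∑ (sub M) (λ S → y S j) ≡⟨ ∑-+ (sub M) _ _ ⟨
      ∑ (sub M) (λ S → (h ∸ suc ∣ S ∣) * y S j + (h ∸ ∣ S ∣) * (X S j ∸ y S j) + y S j)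
        ≡⟨ ∑-cong (sub M) (λ S → hinge-split h ∣ S ∣ (y≤X S j) (full-unsplit S j)) ⟩
      ∑ (sub M) (λ S → (h ∸ ∣ S ∣) * X S j) ≡⟨ hinges j ⟩
      r + N * r ≡⟨ +-comm r _ ⟩
      N * r + r ∎
      where open ≡-Reasoning

-- Links run through the vertices already split off only: two edges are not joined by having hinges
-- at the amalgamated vertex.
data Linked {M : ℕ} (x : Subset M → ℕ) : Fin M → Fin M → Set where
  stay : ∀ {u} → Linked x u u
  via : ∀ {u w v} S → 0 < x S → lookup S u ≡ true → lookup S w ≡ true → Linked x w v → Linked x u v

linked-trans : ∀ {M} {x : Subset M → ℕ} {u v w} → Linked x u v → Linked x v w → Linked x u w
linked-trans stay q = q
linked-trans (via S p a b l) q = via S p a b (linked-trans l q)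

linked-sym : ∀ {M} {x : Subset M → ℕ} {u v} → Linked x u v → Linked x v u
linked-sym stay = stay
linked-sym (via S p a b l) = linked-trans (linked-sym l) (via S p b a stay)

hingesAt : ∀ h {M} → (Subset M → ℕ) → (Subset M → Fin (suc M)) → Fin (suc M) → ℕ
hingesAt h {M} x g a = ∑ (sub M) λ S → δ (fin (suc M)) (g S) a * ((h ∸ ∣ S ∣) * x S)

loose : ∀ {M} → (Subset M → ℕ) → (Subset M → Fin (suc M)) → ℕ
loose {M} x g = ∑ (sub M) λ S → δ (fin (suc M)) (g S) zero * x S

-- The vertices are partitioned into linked blobs, each with a hinge; the blob of a vertex v is
-- named ℓ v, and an edge on a nonempty S belongs to the blob g S = suc u.  Every edge with g S = zero
-- consists of hinges only and is a blob of its own.  A blob with d hinges has d − 1 spare ones, and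
-- joining N vertices through the blobs takes N − 1 spare hinges.
record Joined (h N : ℕ) {M : ℕ} (x : Subset M → ℕ) : Set where
  field
    g : Subset M → Fin (suc M)
    ℓ : Fin M → Fin M
    g-zero : ∀ S → 0 < x S → g S ≡ zero → ∣ S ∣ ≡ 0
    g-suc : ∀ S u → 0 < x S → g S ≡ suc u → ∃ λ v → lookup S v ≡ true × Linked x v u
    linked : ∀ v → Linked x v (ℓ v)
    attached : ∀ v → 0 < hingesAt h x g (suc (ℓ v))
    spare : N ≤ suc (∑ (fin M) (λ u → hingesAt h x g (suc u) ∸ 1) + (h ∸ 1) * loose x g)

module Split {h N M : ℕ} {x y : Subset M → ℕ} (jo : Joined h N x) (y≤x : ∀ S → y S ≤ x S)
  (full : ∀ S → h ≤ ∣ S ∣ → y S ≡ 0) where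
  open Joined jo

  x′ : Subset (suc M) → ℕ
  x′ = split-off x y

  y>0⇒x>0 : ∀ S → 0 < y S → 0 < x S
  y>0⇒x>0 S p = <-≤-trans p (y≤x S)

  linked-lift : ∀ {u v} → Linked x u v → Linked x′ (suc u) (suc v)
  linked-lift stay = stay
  linked-lift (via S p a b l) with 0 <? y S
  ... | yes q = via (true ∷ S) q a b (linked-lift l)
  ... | no ¬q = via (false ∷ S) (subst (λ z → 0 < x S ∸ z) (sym (n≤0⇒n≡0 (≮⇒≥ ¬q))) p) a b (linked-lift l)

  joins-new : ∀ S u → 0 < y S → g S ≡ suc u → Linked x′ (suc u) zero
  joins-new S u p gS with g-suc S u (y>0⇒x>0 S p) gS
  ... | v , v∈S , l = linked-trans (linked-sym (linked-lift l)) (via (true ∷ S) p v∈S refl stay)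

  -- Meant for the last vertex, which receives every hinge: since each blob still has one, each blob
  -- meets the new vertex.
  all-joined : (∀ S → 0 < (h ∸ ∣ S ∣) * x S → 0 < y S) → ∀ v → Linked x′ v zero
  all-joined moves zero = stay
  all-joined moves (suc v) with ∑-pos (sub M) (attached v)
  ... | S , p = linked-trans (linked-lift (linked v)) (joins-new S (ℓ v)
    (moves S (right-pos (δ (fin (suc M)) (g S) (suc (ℓ v))) p)) (δ-pos (fin (suc M)) (left-pos _ p)))
    where
    left-pos : ∀ m {n} → 0 < m * n → 0 < m
    left-pos (suc m) _ = s≤s z≤n
    right-pos : ∀ m {n} → 0 < m * n → 0 < n
    right-pos m {zero} p = ⊥-elim (<-irrefl (sym (*-zeroʳ m)) p)
    right-pos m {suc n} p = s≤s z≤n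

  H Y : Fin (suc M) → ℕ
  H = hingesAt h x g
  Y a = ∑ (sub M) λ S → δ (fin (suc M)) (g S) a * y S

  y≤hx : ∀ S → y S ≤ (h ∸ ∣ S ∣) * x S
  y≤hx S with h ≤? ∣ S ∣
  ... | yes h≤ = ≤-trans (≤-reflexive (full S h≤)) z≤n
  ... | no h≰ = ≤-trans (y≤x S) (≤-trans (≤-reflexive (sym (+-identityʳ _)))
    (*-monoˡ-≤ (x S) (m<n⇒0<n∸m (≰⇒> h≰))))

  Y≤H : ∀ a → Y a ≤ H a
  Y≤H a = ∑-mono (sub M) λ S → *-monoʳ-≤ (δ (fin (suc M)) (g S) a) (y≤hx S)

  y-in-Y : ∀ S {a} → g S ≡ a → y S ≤ Y a
  y-in-Y S refl = ≤-trans (≤-reflexive (sym (trans (cong (_* y S) (δ-refl (fin (suc M)) (g S))) (+-identityʳ _))))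
    (∑-term (sub M) (λ T → δ (fin (suc M)) (g T) (g S) * y T) S)

  -- Blobs meeting the new vertex merge into one.
  merge : Fin M → Fin (suc M)
  merge u = if does (positive? (Y (suc u))) then zero else suc u

  merge-touched : ∀ u → 0 < Y (suc u) → merge u ≡ zero
  merge-touched u p with positive? (Y (suc u))
  ... | yes _ = refl
  ... | no ¬p = ⊥-elim (¬p p)

  merge-untouched : ∀ u → Y (suc u) ≡ 0 → merge u ≡ suc u
  merge-untouched u p with positive? (Y (suc u))
  ... | yes q = ⊥-elim (<-irrefl (sym p) q)
  ... | no _ = refl

  touched? : ∀ u → (0 < Y (suc u)) ⊎ (Y (suc u) ≡ 0)
  touched? u with positive? (Y (suc u))
  ... | yes p = inj₁ p
  ... | no ¬p = inj₂ (n≤0⇒n≡0 (≮⇒≥ ¬p))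

  shift : Fin (suc M) → Fin (suc (suc M))
  shift zero = zero
  shift (suc u) = suc (merge u)

  g′ : Subset (suc M) → Fin (suc (suc M))
  g′ (true ∷ S) = suc zero
  g′ (false ∷ S) = shift (g S)

  ℓ′ : Fin (suc M) → Fin (suc M)
  ℓ′ zero = zero
  ℓ′ (suc v) = merge (ℓ v)

  H′ : Fin (suc (suc M)) → ℕ
  H′ = hingesAt h x′ g′

  g-zero′ : ∀ S → 0 < x′ S → g′ S ≡ zero → ∣ S ∣ ≡ 0
  g-zero′ (false ∷ S) p q with g S in gS
  ... | zero = g-zero S (<-≤-trans p (m∸n≤m (x S) (y S))) gS

  touched-linked : ∀ u → 0 < Y (suc u) → Linked x′ (suc u) zero
  touched-linked u p with ∑-pos (sub M) p
  ... | S , q with equal? (fin (suc M)) (g S) (suc u)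
  ...   | yes gS = joins-new S u (subst (0 <_) (+-identityʳ _) q) gS

  linked-merge : ∀ {v} u → Linked x v u → Linked x′ (suc v) (merge u)
  linked-merge u l with touched? u
  ... | inj₁ p rewrite merge-touched u p = linked-trans (linked-lift l) (touched-linked u p)
  ... | inj₂ p rewrite merge-untouched u p = linked-lift l

  g-suc′ : ∀ S u → 0 < x′ S → g′ S ≡ suc u → ∃ λ v → lookup S v ≡ true × Linked x′ v u
  g-suc′ (true ∷ S) .zero p refl = zero , refl , stay
  g-suc′ (false ∷ S) u p q with g S in gS
  g-suc′ (false ∷ S) .(merge w) p refl | suc w with g-suc S w (<-≤-trans p (m∸n≤m (x S) (y S))) gS
  ... | v , v∈S , l = suc v , v∈S , linked-merge w l

  linked′ : ∀ v → Linked x′ v (ℓ′ v)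
  linked′ zero = stay
  linked′ (suc v) = linked-merge (ℓ v) (linked v)

  H′-untouched : ∀ u → Y (suc u) ≡ 0 → H′ (suc (suc u)) ≡ H (suc u)
  H′-untouched u Yu = cong₂ _+_ (∑-zero (sub M) λ S → refl) (∑-cong (sub M) pointwise)
    where
    pointwise : ∀ S → δ (fin (suc (suc M))) (shift (g S)) (suc (suc u)) * ((h ∸ ∣ S ∣) * (x S ∸ y S)) ≡
      δ (fin (suc M)) (g S) (suc u) * ((h ∸ ∣ S ∣) * x S)
    pointwise S with g S in gS
    ... | zero = refl
    ... | suc w with touched? w
    ...   | inj₁ p rewrite merge-touched w p = sym (cong (_* ((h ∸ ∣ S ∣) * x S)) (δ-≢ (fin M) {w} {u}
            λ { refl → <-irrefl (sym Yu) p }))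
    ...   | inj₂ p rewrite merge-untouched w p | n≤0⇒n≡0 (≤-trans (y-in-Y S gS) (≤-reflexive p)) = refl

  touched : Fin M → Bool
  touched u = does (positive? (Y (suc u)))

  -- The share of `S`, lying in blob `a`, in the hinges of the merged blob: a hinge-only edge
  -- retains h - 1 hinges after passing one, and a touched blob brings along every hinge that it
  -- does not pass.
  Φ : Fin (suc M) → Subset M → ℕ
  Φ zero S = (h ∸ 1) * y S
  Φ (suc u) S = ⟦ touched u ⟧ * ((h ∸ ∣ S ∣) * x S ∸ y S)

  ∑Φ≤H′ : ∑ (fin (suc M)) (λ a → ∑ (sub M) λ S → δ (fin (suc M)) (g S) a * Φ a S) ≤ H′ (suc zero)
  ∑Φ≤H′ = begin
    ∑ (fin (suc M)) (λ a → ∑ (sub M) λ S → δ (fin (suc M)) (g S) a * Φ a S) ≡⟨ ∑-swap (fin (suc M)) (sub M) (λ a S → δ (fin (suc M)) (g S) a * Φ a S) ⟩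
    ∑ (sub M) (λ S → ∑ (fin (suc M)) λ a → δ (fin (suc M)) (g S) a * Φ a S)
      ≡⟨ ∑-cong (sub M) (λ S → ∑-δʳ (fin (suc M)) (g S) (λ a → Φ a S)) ⟩
    ∑ (sub M) (λ S → Φ (g S) S) ≤⟨ ∑-mono (sub M) pointwise ⟩
    ∑ (sub M) (λ S → ((h ∸ suc ∣ S ∣) * y S + 0) +
      δ (fin (suc (suc M))) (shift (g S)) (suc zero) * ((h ∸ ∣ S ∣) * (x S ∸ y S))) ≡⟨ ∑-+ (sub M) _ _ ⟩
    H′ (suc zero) ∎
    where
    open ≤-Reasoning
    pointwise : ∀ S → Φ (g S) S ≤ ((h ∸ suc ∣ S ∣) * y S + 0) +
      δ (fin (suc (suc M))) (shift (g S)) (suc zero) * ((h ∸ ∣ S ∣) * (x S ∸ y S))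
    pointwise S with g S in gS
    ... | zero with 0 <? y S
    ...   | yes p rewrite g-zero S (y>0⇒x>0 S p) gS = ≤-trans (m≤m+n _ 0) (m≤m+n _ 0)
    ...   | no ¬p rewrite n≤0⇒n≡0 (≮⇒≥ ¬p) | *-zeroʳ (h ∸ 1) = z≤n
    pointwise S | suc u with positive? (Y (suc u))
    ...   | no _ = z≤n
    ...   | yes _ = ≤-reflexive (trans (+-identityʳ _)
            (trans (cong (_∸ y S) (sym (hinge-split h ∣ S ∣ (y≤x S) (full S))))
              (trans (m+n∸n≡m ((h ∸ suc ∣ S ∣) * y S + (h ∸ ∣ S ∣) * (x S ∸ y S)) (y S))
                  (cong₂ _+_ (sym (+-identityʳ ((h ∸ suc ∣ S ∣) * y S)))
                  (sym (+-identityʳ ((h ∸ ∣ S ∣) * (x S ∸ y S))))))))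

  ∑Φ-suc : ∀ u → ∑ (sub M) (λ S → δ (fin (suc M)) (g S) (suc u) * Φ (suc u) S) ≡ ⟦ touched u ⟧ * (H (suc u) ∸ Y (suc u))
  ∑Φ-suc u = begin
    ∑ (sub M) (λ S → d S * (⟦ touched u ⟧ * (p S ∸ y S))) ≡⟨ ∑-cong (sub M) (λ S → lem (d S) ⟦ touched u ⟧ _) ⟩
    ∑ (sub M) (λ S → ⟦ touched u ⟧ * (d S * (p S ∸ y S))) ≡⟨ ∑-* (sub M) ⟦ touched u ⟧ _ ⟩
    ⟦ touched u ⟧ * ∑ (sub M) (λ S → d S * (p S ∸ y S)) ≡⟨ cong (⟦ touched u ⟧ *_) difference ⟩
    ⟦ touched u ⟧ * (H (suc u) ∸ Y (suc u)) ∎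
    where
    open ≡-Reasoning
    d p : Subset M → ℕ
    d S = δ (fin (suc M)) (g S) (suc u)
    p S = (h ∸ ∣ S ∣) * x S
    lem : ∀ a b c → a * (b * c) ≡ b * (a * c)
    lem = solve-∀
    difference : ∑ (sub M) (λ S → d S * (p S ∸ y S)) ≡ H (suc u) ∸ Y (suc u)
    difference = begin
      ∑ (sub M) (λ S → d S * (p S ∸ y S)) ≡⟨ m+n∸n≡m _ (Y (suc u)) ⟨
      ∑ (sub M) (λ S → d S * (p S ∸ y S)) + Y (suc u) ∸ Y (suc u) ≡⟨ cong (_∸ Y (suc u)) (∑-+ (sub M) _ _) ⟨
      ∑ (sub M) (λ S → d S * (p S ∸ y S) + d S * y S) ∸ Y (suc u) ≡⟨ cong (_∸ Y (suc u)) (∑-cong (sub M) λ S →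
        trans (sym (*-distribˡ-+ (d S) _ (y S))) (cong (d S *_) (m∸n+n≡m (y≤hx S)))) ⟩
      H (suc u) ∸ Y (suc u) ∎

  module _ (2≤h : 2 ≤ h) (n : ℕ) (N≡ : N ≡ suc (suc n))
    (few : ∀ u → Y (suc u) ≤ suc (H (suc u) ∸ N))
    (big : ∃ λ S → 0 < y S × 2 ≤ H (g S)) where

    kept : ∀ u → 0 < Y (suc u) → H (suc u) ∸ Y (suc u) ≤ H′ (suc zero)
    kept u p = ≤-trans (≤-reflexive (sym (trans (∑Φ-suc u)
        (trans (cong (_* (H (suc u) ∸ Y (suc u))) t) (+-identityʳ _)))))
      (≤-trans (∑-term (fin (suc M)) (λ a → ∑ (sub M) λ S → δ (fin (suc M)) (g S) a * Φ a S) (suc u)) ∑Φ≤H′)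
      where
      t : ⟦ touched u ⟧ ≡ 1
      t with positive? (Y (suc u))
      ... | yes _ = refl
      ... | no ¬p = ⊥-elim (¬p p)

    -- For H ≤ N the cap is a single hinge; beyond that it is 1 + H - N, which is less than H
    -- because N ≥ 2.
    Y<H : ∀ u → 2 ≤ H (suc u) → Y (suc u) < H (suc u)
    Y<H u 2≤H with H (suc u) ≤? N | few u
    ... | yes H≤N | f rewrite m≤n⇒m∸n≡0 H≤N = ≤-<-trans f 2≤H
    ... | no H≰N | f = ≤-<-trans f (≤-trans (≤-reflexive (cong (λ z → suc (suc (H (suc u) ∸ z))) N≡))
            (≤-trans (≤-reflexive (sym (+-∸-assoc 2 (≤-trans (≤-reflexive (sym N≡)) (<⇒≤ (≰⇒> H≰N))))))
              (∸-monoʳ-≤ (2 + H (suc u)) (s≤s (s≤s (z≤n {n}))))))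

    -- The set given by `big` has a hinge to pass and another one in reserve. What is not passed
    -- lands in the merged blob, which could otherwise never be joined to the remaining vertices.
    H′-pos : 0 < H′ (suc zero)
    H′-pos = from big
      where
      from : (∃ λ S → 0 < y S × 2 ≤ H (g S)) → 0 < H′ (suc zero)
      from (S , p , 2≤) with g S in gS
      ... | zero = ≤-trans (*-mono-≤ {1} (m<n⇒0<n∸m 2≤h) p) (≤-trans (≤-trans
              (≤-reflexive (sym (trans (cong (λ a → δ (fin (suc M)) a zero * ((h ∸ 1) * y S)) gS) (+-identityʳ _))))
              (∑-term (sub M) (λ S → δ (fin (suc M)) (g S) zero * ((h ∸ 1) * y S)) S))
              (≤-trans (∑-term (fin (suc M)) (λ a → ∑ (sub M) λ S → δ (fin (suc M)) (g S) a * Φ a S) zero) ∑Φ≤H′))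
      ... | suc u = ≤-trans (m<n⇒0<n∸m (Y<H u 2≤)) (kept u (≤-trans p (y-in-Y S gS)))

    attached′ : ∀ v → 0 < H′ (suc (ℓ′ v))
    attached′ zero = H′-pos
    attached′ (suc v) with touched? (ℓ v)
    ... | inj₁ p rewrite merge-touched (ℓ v) p = H′-pos
    ... | inj₂ p rewrite merge-untouched (ℓ v) p = subst (0 <_) (sym (H′-untouched (ℓ v) p)) (attached v)

    loose′ : loose x′ g′ + Y zero ≡ loose x g
    loose′ = trans (cong (λ z → z + B + Y zero) (∑-zero (sub M) λ S → refl))
      (trans (sym (∑-+ (sub M) _ _)) (∑-cong (sub M) pointwise))
      where
      B = ∑ (sub M) λ S → δ (fin (suc (suc M))) (shift (g S)) zero * (x S ∸ y S)
      pointwise : ∀ S → δ (fin (suc (suc M))) (shift (g S)) zero * (x S ∸ y S) + δ (fin (suc M)) (g S) zero * y S ≡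
        δ (fin (suc M)) (g S) zero * x S
      pointwise S with g S
      ... | zero = trans (cong₂ _+_ (+-identityʳ (x S ∸ y S)) (+-identityʳ (y S)))
                     (trans (m∸n+n≡m (y≤x S)) (sym (+-identityʳ _)))
      ... | suc _ = refl

    spares : ℕ
    spares = ∑ (fin M) (λ u → H′ (suc (suc u)) ∸ 1) + (h ∸ 1) * loose x′ g′

    -- If a blob passes two hinges, its cap forces H > N, and the N - 1 or more hinges that it
    -- retains are enough. Otherwise every touched blob passes exactly one, so its H - 1 spare
    -- hinges all become hinges of the merged blob; a hinge-only edge likewise contributes its h -
    -- 1.
    spare-bound : suc n ≤ H′ (suc zero) + spares
    spare-bound with search (fin M) (λ u → 1 <? Y (suc u))
    ... | yes (u , 1<Y) = ≤-trans (≤-trans enough (kept u (<-trans (s≤s z≤n) 1<Y))) (m≤m+n _ _)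
      where
      enough : suc n ≤ H (suc u) ∸ Y (suc u)
      enough = ≤-trans (≤-reflexive (sym (m+n∸m≡n (suc (H (suc u) ∸ N)) (suc n))))
        (≤-trans (∸-monoˡ-≤ (suc (H (suc u) ∸ N)) (≤-reflexive eq)) (∸-monoʳ-≤ (H (suc u)) (few u)))
        where
        N<H : N < H (suc u)
        N<H = m<n⇒0<n∸m⁻ (≤-pred (<-≤-trans 1<Y (few u)))
          where
          m<n⇒0<n∸m⁻ : ∀ {m n} → 0 < n ∸ m → m < n
          m<n⇒0<n∸m⁻ {m} {n} p = ≰⇒> λ n≤m → <-irrefl (sym (m≤n⇒m∸n≡0 n≤m)) p
        eq : suc (H (suc u) ∸ N) + suc n ≡ H (suc u)
        eq = trans (sym (+-suc (H (suc u) ∸ N) (suc n)))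
            (trans (cong (λ z → H (suc u) ∸ N + z) (sym N≡)) (m∸n+n≡m (<⇒≤ N<H)))
    ... | no ¬p = ≤-pred $ begin
      suc (suc n) ≡⟨ N≡ ⟨
      N ≤⟨ spare ⟩
      suc (∑ (fin M) (λ u → H (suc u) ∸ 1) + (h ∸ 1) * loose x g) ≤⟨ s≤s (+-mono-≤ (∑-mono (fin M) per-blob) (≤-reflexive looses)) ⟩
      suc (∑ (fin M) (λ u → Φ∑ (suc u) + (H′ (suc (suc u)) ∸ 1)) + ((h ∸ 1) * loose x′ g′ + Φ∑ zero))
        ≡⟨ cong (λ z → suc (z + ((h ∸ 1) * loose x′ g′ + Φ∑ zero))) (∑-+ (fin M) _ _) ⟩
      suc (∑ (fin M) (λ u → Φ∑ (suc u)) + ∑ (fin M) (λ u → H′ (suc (suc u)) ∸ 1) + ((h ∸ 1) * loose x′ g′ + Φ∑ zero))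
        ≡⟨ cong suc (lem (∑ (fin M) (λ u → Φ∑ (suc u))) _ _ (Φ∑ zero)) ⟩
      suc ((Φ∑ zero + ∑ (fin M) (λ u → Φ∑ (suc u))) + spares) ≤⟨ s≤s (+-monoˡ-≤ spares ∑Φ≤H′) ⟩
      suc (H′ (suc zero) + spares) ∎
      where
      open ≤-Reasoning
      Φ∑ : Fin (suc M) → ℕ
      Φ∑ a = ∑ (sub M) λ S → δ (fin (suc M)) (g S) a * Φ a S
      lem : ∀ a b c d → a + b + (c + d) ≡ d + a + (b + c)
      lem = solve-∀
      looses : (h ∸ 1) * loose x g ≡ (h ∸ 1) * loose x′ g′ + Φ∑ zero
      looses = trans (cong ((h ∸ 1) *_) (sym loose′)) (trans (*-distribˡ-+ (h ∸ 1) (loose x′ g′) (Y zero))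
        (cong ((h ∸ 1) * loose x′ g′ +_) (trans (sym (∑-* (sub M) (h ∸ 1) _))
          (∑-cong (sub M) λ S → lem₂ (h ∸ 1) (δ (fin (suc M)) (g S) zero) (y S)))))
        where
        lem₂ : ∀ a b c → a * (b * c) ≡ b * (a * c)
        lem₂ = solve-∀
      per-blob : ∀ u → H (suc u) ∸ 1 ≤ Φ∑ (suc u) + (H′ (suc (suc u)) ∸ 1)
      per-blob u rewrite ∑Φ-suc u with positive? (Y (suc u))
      ... | yes p rewrite ≤-antisym (≮⇒≥ λ q → ¬p (u , q)) p = ≤-trans (m≤m+n _ 0) (m≤m+n _ _)
      ... | no ¬q = ∸-monoˡ-≤ 1 (≤-reflexive (sym (H′-untouched u (n≤0⇒n≡0 (≮⇒≥ ¬q)))))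

    joined-split : Joined h (suc n) x′
    joined-split = record
      { g = g′ ; ℓ = ℓ′ ; g-zero = g-zero′ ; g-suc = g-suc′ ; linked = linked′ ; attached = attached′
      ; spare = ≤-trans spare-bound (≤-reflexive (trans (cong (_+ spares) (sym (m+[n∸m]≡n H′-pos)))
          (cong suc (sym (+-assoc (H′ (suc zero) ∸ 1) _ _))))) }

-- Complete detachment

⟦⟧-*-≤ : ∀ b n → ⟦ b ⟧ * n ≤ n
⟦⟧-*-≤ true n = ≤-reflexive (+-identityʳ n)
⟦⟧-*-≤ false n = z≤n

hinges-loose : ∀ {h M} {x : Subset M → ℕ} {g : Subset M → Fin (suc M)} →
  (∀ S → 0 < x S → g S ≡ zero → ∣ S ∣ ≡ 0) → hingesAt h x g zero ≡ h * loose x g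
hinges-loose {h} {M} {x} {g} g-zero = trans (∑-cong (sub M) pointwise) (∑-* (sub M) h _)
  where
  pointwise : ∀ S → δ (fin (suc M)) (g S) zero * ((h ∸ ∣ S ∣) * x S) ≡ h * (δ (fin (suc M)) (g S) zero * x S)
  pointwise S with g S in gS
  ... | suc _ = sym (*-zeroʳ h)
  ... | zero with x S in xS
  ...   | zero = trans (+-identityʳ _) (trans (*-zeroʳ (h ∸ ∣ S ∣)) (sym (*-zeroʳ h)))
  ...   | suc n = trans (+-identityʳ _) (cong₂ _*_ (cong (h ∸_) (g-zero S (subst (0 <_) (sym xS) (s≤s z≤n)) gS))
                    (sym (+-identityʳ (suc n))))

module Groups {h N M : ℕ} {x : Subset M → ℕ} (jo : Joined h N x) (r : ℕ) (2≤N : 2 ≤ N) where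
  open Joined jo

  private
    H : Fin (suc M) → ℕ
    H = hingesAt h x g

    z : Subset M → ℕ
    z S = (h ∸ ∣ S ∣) * x S

    F : Shape
    F = fin (suc M)

    G : Shape
    G = F ⊕ fin 1

  big : Fin (suc M) → Bool
  big a = does (positive? (H a ∸ 1))

  -- Blobs with at most one hinge share a group: each can pass no more than that hinge anyway, and
  -- only their total needs a cap.
  grp : Subset M → El G
  grp S = if big (g S) then inj₁ (g S) else inj₂ zero

  -- The bound r ∸ 1 on the blobs with a single hinge forces the new vertex to take a hinge from
  -- something that retains one.
  cap : El G → ℕ
  cap (inj₁ zero) = r
  cap (inj₁ (suc u)) = suc (H (suc u) ∸ N)
  cap (inj₂ _) = r ∸ 1

  private
    -- Counting all hinge-only edges as a single blob can only raise the number of spare hinges.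
    loose-spare : (h ∸ 1) * loose x g ≤ H zero ∸ 1
    loose-spare rewrite hinges-loose {h} {g = g} g-zero with loose x g
    ... | zero = ≤-trans (≤-reflexive (*-zeroʳ (h ∸ 1))) z≤n
    ... | suc l = ≤-trans (≤-reflexive (trans (*-distribʳ-∸ (suc l) h 1) (cong (h * suc l ∸_) (+-identityʳ (suc l)))))
            (∸-monoʳ-≤ (h * suc l) (s≤s (z≤n {l})))

    spare′ : N ≤ suc (∑ F (λ a → H a ∸ 1))
    spare′ = ≤-trans spare (s≤s (≤-trans (+-monoʳ-≤ _ loose-spare) (≤-reflexive (+-comm _ (H zero ∸ 1)))))

    -- A blob with one hinge has none to spare, so the big blobs carry all N - 1 spare ones. As N ≥
    -- 2 there is a big blob, and its remaining hinge makes N. At most N (r - 1) hinges are thus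
    -- left to the small blobs.
    big-hinges : N ≤ ∑ F (λ a → ⟦ big a ⟧ * H a)
    big-hinges with ∑-pos F (≤-pred (≤-trans 2≤N spare′))
    ... | a₀ , p = ≤-trans spare′ (∑-strict F a₀ bound strict)
      where
      bound : ∀ a → H a ∸ 1 ≤ ⟦ big a ⟧ * H a
      bound a with positive? (H a ∸ 1)
      ... | yes _ = ≤-trans (m∸n≤m (H a) 1) (m≤m+n (H a) 0)
      ... | no ¬q = ≮⇒≥ ¬q
      strict : H a₀ ∸ 1 < ⟦ big a₀ ⟧ * H a₀
      strict with positive? (H a₀ ∸ 1)
      ... | no ¬q = ⊥-elim (¬q p)
      ... | yes _ = pred< (H a₀) p
        where
        pred< : ∀ n → 0 < n ∸ 1 → n ∸ 1 < n + 0
        pred< (suc n) _ = s≤s (m≤m+n n 0)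

    big-sum : ∑ (sub M) (λ S → ⟦ big (g S) ⟧ * z S) ≡ ∑ F (λ a → ⟦ big a ⟧ * H a)
    big-sum = trans (∑-fibres (sub M) F g _) (∑-cong F λ a → trans
      (∑-cong (sub M) λ S → trans (δ-subst F (g S) a (λ b → ⟦ big b ⟧ * z S)) (lem (δ F (g S) a) ⟦ big a ⟧ (z S)))
      (∑-* (sub M) ⟦ big a ⟧ _))
      where
      lem : ∀ a b c → a * (b * c) ≡ b * (a * c)
      lem = solve-∀

    -- The fractional choice takes H / N hinges from a blob. The cap 1 + (H ∸ N) admits this, and
    -- whenever it exceeds 1 it leaves N - 1 hinges behind.
    H-bound : ∀ a → H a ≤ N * suc (H a ∸ N)
    H-bound a = ≤-trans (m≤n+m∸n (H a) N) (≤-trans (+-monoʳ-≤ N (≤-trans (≤-reflexive (sym (+-identityʳ _)))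
      (*-monoˡ-≤ (H a ∸ N) (≤-trans (s≤s z≤n) 2≤N)))) (≤-reflexive (sym (*-suc N (H a ∸ N)))))

  grp-cap : ∑ (sub M) z ≡ N * r → ∀ a → ∑ (sub M) (λ S → δ G (grp S) a * z S) ≤ N * cap a
  grp-cap total (inj₁ zero) =
    ≤-trans (∑-mono (sub M) λ S → ⟦⟧-*-≤ (does (equal? G (grp S) (inj₁ zero))) (z S)) (≤-reflexive total)
  grp-cap total (inj₁ (suc u)) = ≤-trans (∑-mono (sub M) bound) (H-bound (suc u))
    where
    bound : ∀ S → δ G (grp S) (inj₁ (suc u)) * z S ≤ δ F (g S) (suc u) * z S
    bound S with positive? (H (g S) ∸ 1)
    ... | yes _ = ≤-refl
    ... | no _ = z≤n
  grp-cap total (inj₂ zero) = ≤-trans (≤-reflexive (sym (m+n∸n≡m small (∑ F (λ a → ⟦ big a ⟧ * H a)))))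
    (≤-trans (∸-mono (≤-reflexive whole) big-hinges)
      (≤-reflexive (sym (trans (*-distribˡ-∸ N r 1) (cong (N * r ∸_) (*-identityʳ N))))))
    where
    small = ∑ (sub M) (λ S → δ G (grp S) (inj₂ zero) * z S)
    pointwise : ∀ S → δ G (grp S) (inj₂ zero) * z S + ⟦ big (g S) ⟧ * z S ≡ z S
    pointwise S with positive? (H (g S) ∸ 1)
    ... | yes _ = +-identityʳ (z S)
    ... | no _ = trans (+-identityʳ _) (+-identityʳ (z S))
    whole : small + ∑ F (λ a → ⟦ big a ⟧ * H a) ≡ N * r
    whole = trans (cong (small +_) (sym big-sum))
        (trans (sym (∑-+ (sub M) _ _)) (trans (∑-cong (sub M) pointwise) total))

  module _ {y : Subset M → ℕ} (y-grp : ∀ a → ∑ (sub M) (λ S → δ G (grp S) a * y S) ≤ cap a) where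

    grp-few : (∀ a → ∑ (sub M) (λ S → δ F (g S) a * y S) ≤ H a) →
      ∀ u → ∑ (sub M) (λ S → δ F (g S) (suc u) * y S) ≤ suc (H (suc u) ∸ N)
    grp-few Y≤H u with positive? (H (suc u) ∸ 1) in eq
    ... | no ¬p = ≤-trans (Y≤H (suc u)) (≤-trans (m≤n+m∸n (H (suc u)) 1) (s≤s (≤-trans (≮⇒≥ ¬p) z≤n)))
    ... | yes p = ≤-trans (∑-mono (sub M) bound) (y-grp (inj₁ (suc u)))
      where
      bound : ∀ S → δ F (g S) (suc u) * y S ≤ δ G (grp S) (inj₁ (suc u)) * y S
      bound S with positive? (H (g S) ∸ 1)
      ... | yes _ = ≤-refl
      ... | no ¬q = ≤-reflexive (cong (_* y S) (δ-≢ F {g S} λ e → ¬q (subst (λ a → 0 < H a ∸ 1) (sym e) p)))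

    -- If every passed hinge were the only one of its blob, all `r` of them would come from the
    -- group whose cap is `r ∸ 1`.
    grp-big : 0 < r → ∑ (sub M) y ≡ r → ∃ λ S → 0 < y S × 2 ≤ H (g S)
    grp-big 0<r total with search (sub M) {λ S → 0 < y S × 2 ≤ H (g S)} (λ S → positive? (y S) ×-dec (2 ≤? H (g S)))
    ... | yes p = p
    ... | no ¬p = ⊥-elim (<⇒≱ 0<r (≤-trans (m≤n⇒m≤1+n⇒ r (begin
      r ≡⟨ total ⟨
      ∑ (sub M) y ≤⟨ ∑-mono (sub M) bound ⟩
      ∑ (sub M) (λ S → δ G (grp S) (inj₂ zero) * y S) ≤⟨ y-grp (inj₂ zero) ⟩
      r ∸ 1 ∎)) z≤n))
      where
      open ≤-Reasoning
      m≤n⇒m≤1+n⇒ : ∀ n → n ≤ n ∸ 1 → n ≤ 0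
      m≤n⇒m≤1+n⇒ zero _ = z≤n
      m≤n⇒m≤1+n⇒ (suc n) p = ⊥-elim (<-irrefl refl p)
      bound : ∀ S → y S ≤ δ G (grp S) (inj₂ zero) * y S
      bound S with positive? (H (g S) ∸ 1)
      ... | no _ = m≤m+n (y S) 0
      ... | yes q = ≮⇒≥ λ 0<y → ¬p (S , 0<y , ≰⇒> λ H≤1 → <-irrefl (sym (m≤n⇒m∸n≡0 H≤1)) q)

ways-small : ∀ h N s → N + s < h → ways h N s ≡ 0
ways-small h zero s s<h = cong ⟦_⟧ (dec-false (s ≟ h) (<⇒≢ s<h))
ways-small h (suc N) s lt = cong₂ _+_ (ways-small h N s (<-trans (n<1+n _) lt))
  (ways-small h N (suc s) (subst (_< h) (sym (+-suc N s)) lt))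

module _ {h lam r k N M : ℕ} {X : Subset M → Fin k → ℕ} (am : Amalgam h lam r k (suc N) M X) where
  open Amalgam am

  -- The fraction passed on is at most 1: an edge with more hinges than there are amalgamated
  -- vertices would meet one of them twice, and `rows` gives it multiplicity zero.
  hinges-bound : ∀ S j → (h ∸ ∣ S ∣) * X S j ≤ suc N * X S j
  hinges-bound S j with h ∸ ∣ S ∣ ≤? suc N
  ... | yes le = *-monoˡ-≤ (X S j) le
  ... | no ¬le = ≤-reflexive (trans (cong ((h ∸ ∣ S ∣) *_) X≡0)
          (trans (*-zeroʳ (h ∸ ∣ S ∣)) (sym (trans (cong (suc N *_) X≡0) (*-zeroʳ (suc N))))))
    where
    X≡0 : X S j ≡ 0
    X≡0 = n≤0⇒n≡0 (≤-trans (∑-term (fin k) (X S) j) (≤-reflexive (trans (rows S)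
      (trans (cong (lam *_) (ways-small h (suc N) ∣ S ∣ (m<n∸o⇒m+o<n (≰⇒> ¬le)))) (*-zeroʳ lam)))))
      where
      m<n∸o⇒m+o<n : ∀ {m n o} → m < n ∸ o → m + o < n
      m<n∸o⇒m+o<n {m} {n} {o} p = ≰⇒> λ n≤ → <⇒≱ p (≤-trans (∸-monoˡ-≤ o n≤) (≤-reflexive (m+n∸n≡m m o)))

  hinges-row : ∀ S → ∑ (fin k) (λ j → (h ∸ ∣ S ∣) * X S j) ≡ suc N * (lam * ways h N (suc ∣ S ∣))
  hinges-row S = begin
    ∑ (fin k) (λ j → (h ∸ ∣ S ∣) * X S j) ≡⟨ ∑-* (fin k) (h ∸ ∣ S ∣) (X S) ⟩
    (h ∸ ∣ S ∣) * ∑ (fin k) (X S) ≡⟨ cong ((h ∸ ∣ S ∣) *_) (rows S) ⟩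
    (h ∸ ∣ S ∣) * (lam * ways h (suc N) ∣ S ∣) ≡⟨ lem (h ∸ ∣ S ∣) lam _ ⟩
    lam * ((h ∸ ∣ S ∣) * ways h (suc N) ∣ S ∣) ≡⟨ cong (lam *_) (ways-absorb h N ∣ S ∣) ⟩
    lam * (suc N * ways h N (suc ∣ S ∣)) ≡⟨ lem lam (suc N) _ ⟩
    suc N * (lam * ways h N (suc ∣ S ∣)) ∎
    where
    open ≡-Reasoning
    lem : ∀ a b c → a * (b * c) ≡ b * (a * c)
    lem = solve-∀

AllJoined : ∀ (h N : ℕ) {k M} → (Subset M → Fin k → ℕ) → Set
AllJoined h N X = ∀ j → Joined h N (λ S → X S j)

unsplit-full : ∀ {x y : ℕ} → y ≡ 0 → x ∸ y ≡ x
unsplit-full refl = refl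

module _ {h lam r k n M : ℕ} {X : Subset M → Fin k → ℕ} (2≤h : 2 ≤ h) (0<r : 0 < r)
  (am : Amalgam h lam r k (suc (suc n)) M X) (jo : AllJoined h (suc (suc n)) X) where

  private
    2≤N : 2 ≤ suc (suc n)
    2≤N = s≤s (s≤s z≤n)

    G : Shape
    G = fin (suc M) ⊕ fin 1

    grp : Fin k → Subset M → El G
    grp j = Groups.grp (jo j) r 2≤N

    cap : Fin k → El G → ℕ
    cap j = Groups.cap (jo j) r 2≤N

    Detached : Set
    Detached = ∃ λ (X′ : Subset (suc M) → Fin k → ℕ) → Amalgam h lam r k (suc n) (suc M) X′ × AllJoined h (suc n) X′ ×
      (∀ S j → h ≤ ∣ S ∣ → X′ (false ∷ S) j ≡ X S j)

    module _ (y : Subset M → Fin k → ℕ) (y≤X : ∀ S j → y S j ≤ X S j)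
      (y-rows : ∀ S → ∑ (fin k) (y S) ≡ lam * ways h (suc n) (suc ∣ S ∣))
      (y-cols : ∀ j → ∑ (sub M) (λ S → y S j) ≡ r)
      (y-grp : ∀ j a → ∑ (sub M) (λ S → δ G (grp j S) a * y S j) ≤ cap j a) where

      joined′ : AllJoined h (suc n) (λ S j → split-off (λ T → X T j) (λ T → y T j) S)
      joined′ j = Sp.joined-split 2≤h n refl
          (Groups.grp-few (jo j) r 2≤N {λ S → y S j} (y-grp j) Sp.Y≤H)
          (Groups.grp-big (jo j) r 2≤N {λ S → y S j} (y-grp j) 0<r (y-cols j))
        where
        module Sp = Split {x = λ S → X S j} {y = λ S → y S j} (jo j) (λ S → y≤X S j) (λ S → full-unsplit am y≤X y-rows S j)

      detached : Detached
      detached = (λ S j → split-off (λ T → X T j) (λ T → y T j) S) , amalgam-split am y≤X y-rows y-cols , joined′ ,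
        λ S j full → unsplit-full (full-unsplit am y≤X y-rows S j full)

  detach-one : Detached
  detach-one =
    -- With the number of amalgamated vertices as denominator, the hinge count `Amalgam.hinges` says
    -- precisely that the new vertex has fractional degree `r` in every colour.
    let y , y≤X , y-rows , y-cols , y-grp = integral-rounding (sub M) (fin k) G (suc (suc n)) X
          (λ S j → (h ∸ ∣ S ∣) * X S j) (λ S → lam * ways h (suc n) (suc ∣ S ∣)) r grp cap
          (hinges-bound am) (hinges-row am) (Amalgam.hinges am)
          (λ j → Groups.grp-cap (jo j) r 2≤N (Amalgam.hinges am j))
    in detached y y≤X y-rows y-cols y-grp

-- With one vertex left, every hinge is its hinge.
detach-last : ∀ {h lam r k M} {X : Subset M → Fin k → ℕ} →
  Amalgam h lam r k 1 M X → AllJoined h 1 X →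
  ∃ λ X′ → Amalgam h lam r k 0 (suc M) X′ × (∀ j u v → Linked (λ S → X′ S j) u v) ×
    (∀ S j → h ≤ ∣ S ∣ → X′ (false ∷ S) j ≡ X S j)
detach-last {h} {lam} {r} {k} {M} {X} am jo =
  (λ S j → split-off (λ T → X T j) (λ T → y T j) S) ,
  amalgam-split am y≤X y-rows (λ j → trans (Amalgam.hinges am j) (+-identityʳ r)) ,
  (λ j u v → linked-trans (to-new j u) (linked-sym (to-new j v))) ,
  λ S j full → unsplit-full (full-unsplit am y≤X y-rows S j full)
  where
  y : Subset M → Fin k → ℕ
  y S j = (h ∸ ∣ S ∣) * X S j
  y≤X : ∀ S j → y S j ≤ X S j
  y≤X S j = ≤-trans (hinges-bound am S j) (≤-reflexive (+-identityʳ _))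
  y-rows : ∀ S → ∑ (fin k) (y S) ≡ lam * ways h 0 (suc ∣ S ∣)
  y-rows S = trans (hinges-row am S) (+-identityʳ _)
  to-new : ∀ j v → Linked (split-off (λ T → X T j) (λ T → y T j)) v zero
  to-new j = Split.all-joined (jo j) (λ S → y≤X S j) (λ S → full-unsplit am y≤X y-rows S j) (λ S p → p)

∣pad∣ : ∀ i {m} (S : Subset m) → ∣ replicate i false ++ S ∣ ≡ ∣ S ∣
∣pad∣ zero S = refl
∣pad∣ (suc i) S = ∣pad∣ i S

-- Edges inside the old vertices have no hinges and never move; the last component records this,
-- because it is how the given colouring survives.
detach : ∀ {h lam r k m N} {X : Subset m → Fin k → ℕ} → 2 ≤ h → 0 < r →
  Amalgam h lam r k (suc N) m X → AllJoined h (suc N) X →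
  ∃ λ X′ → Amalgam h lam r k 0 (suc N + m) X′ × (∀ j u v → Linked (λ S → X′ S j) u v) ×
    (∀ S j → h ≤ ∣ S ∣ → X′ (replicate (suc N) false ++ S) j ≡ X S j)
detach {h} {lam} {r} {k} {m} {N} {X} 2≤h 0<r am jo =
  let X₁ , am₁ , jo₁ , keep₁ = stage N 0 (+-identityʳ N)
      X₂ , am₂ , linked , keep₂ = detach-last am₁ jo₁
  in X₂ , am₂ , linked , λ S j full →
       trans (keep₂ _ j (≤-trans full (≤-reflexive (sym (∣pad∣ N S))))) (keep₁ S j full)
  where
  stage : ∀ i n → i + n ≡ N → ∃ λ (X′ : Subset (i + m) → Fin k → ℕ) →
    Amalgam h lam r k (suc n) (i + m) X′ × AllJoined h (suc n) X′ ×
    (∀ S j → h ≤ ∣ S ∣ → X′ (replicate i false ++ S) j ≡ X S j)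
  stage zero n refl = X , am , jo , λ S j _ → refl
  stage (suc i) n eq =
    let X₁ , am₁ , jo₁ , keep₁ = stage i (suc n) (trans (+-suc i n) eq)
        X₂ , am₂ , jo₂ , keep₂ = detach-one 2≤h 0<r am₁ jo₁
    in X₂ , am₂ , jo₂ , λ S j full →
         trans (keep₂ _ j (≤-trans full (≤-reflexive (sym (∣pad∣ i S))))) (keep₁ S j full)

-- Colouring the amalgamated hypergraph

∑-lookup : ∀ {M} (S : Subset M) → ∑ (fin M) (λ v → ⟦ lookup S v ⟧) ≡ ∣ S ∣
∑-lookup [] = refl
∑-lookup (true ∷ S) = cong suc (∑-lookup S)
∑-lookup (false ∷ S) = ∑-lookup S

member-size : ∀ {M} (S : Subset M) v → lookup S v ≡ true → 0 < ∣ S ∣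
member-size {M} S v p = subst₂ _≤_ (cong ⟦_⟧ p) (∑-lookup S) (∑-term (fin M) (λ v → ⟦ lookup S v ⟧) v)

size-zero : ∀ {M} (S : Subset M) → ∣ S ∣ ≡ 0 → S ≡ replicate M false
size-zero [] _ = refl
size-zero (false ∷ S) p = cong (false ∷_) (size-zero S p)

∣replicate∣ : ∀ M → ∣ replicate M false ∣ ≡ 0
∣replicate∣ zero = refl
∣replicate∣ (suc M) = ∣replicate∣ M

∑-through : ∀ {M} (v : Fin (suc M)) (f : ℕ → ℕ) →
  ∑ (sub (suc M)) (λ S → ⟦ lookup S v ⟧ * f ∣ S ∣) ≡ ∑ (sub M) (λ S → f (suc ∣ S ∣))
∑-through {M} zero f = trans (cong₂ _+_
    (∑-cong (sub M) λ S → +-identityʳ _) (∑-zero (sub M) λ _ → refl)) (+-identityʳ _)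
∑-through {suc M} (suc v) f = cong₂ _+_ (∑-through v (f ∘ suc)) (∑-through v f)

∑-incidence : ∀ {M} (f : Subset M → ℕ) →
  ∑ (fin M) (λ v → ∑ (sub M) λ S → ⟦ lookup S v ⟧ * f S) ≡ ∑ (sub M) (λ S → ∣ S ∣ * f S)
∑-incidence {M} f = trans (∑-swap (fin M) (sub M) _)
  (∑-cong (sub M) λ S → trans (∑-*ʳ (fin M) (f S) _) (cong (_* f S) (∑-lookup S)))

module Fill (h lam r k N m : ℕ) where

  Family : Set
  Family = Subset m → Fin k → ℕ

  T : Subset m → ℕ
  T S = lam * ways h N ∣ S ∣

  deg : Family → Fin k → Fin m → ℕ
  deg x j v = ∑ (sub m) λ S → ⟦ lookup S v ⟧ * x S j

  row : Family → Subset m → ℕ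
  row x S = ∑ (fin k) (x S)

  -- An upper bound for the number of edges at v once all edges of size at least i are coloured.
  load : ℕ → Fin m → ℕ
  load i v = ∑ (sub m) λ S → ⟦ lookup S v ⟧ * (⟦ does (i ≤? ∣ S ∣) ⟧ * T S)

  record Partial (i : ℕ) (x : Family) : Set where
    field
      bounded : ∀ j v → deg x j v ≤ r
      below : ∀ S → row x S ≤ T S
      small : ∀ S j → ∣ S ∣ < i → x S j ≡ 0

  ∑-deg : ∀ x v → ∑ (fin k) (λ j → deg x j v) ≡ ∑ (sub m) (λ S → ⟦ lookup S v ⟧ * row x S)
  ∑-deg x v = trans (∑-swap (fin k) (sub m)
      (λ j S → ⟦ lookup S v ⟧ * x S j)) (∑-cong (sub m) λ S → ∑-* (fin k) ⟦ lookup S v ⟧ (x S))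

  module _ {i : ℕ} {x : Family} (px : Partial i x) (S₀ : Subset m) (size : ∣ S₀ ∣ ≡ i) (0<i : 0 < i)
    (open-row : row x S₀ < T S₀) (room : ∀ v → i * load i v ≤ k * r) where
    open Partial px

    load-strict : ∀ v → lookup S₀ v ≡ true → ∑ (fin k) (λ j → deg x j v) < load i v
    load-strict v v∈S₀ = subst (_< load i v) (sym (∑-deg x v)) (∑-strict (sub m) S₀ bound strict)
      where
      bound : ∀ S → ⟦ lookup S v ⟧ * row x S ≤ ⟦ lookup S v ⟧ * (⟦ does (i ≤? ∣ S ∣) ⟧ * T S)
      bound S with i ≤? ∣ S ∣
      ... | yes i≤ = *-monoʳ-≤ ⟦ lookup S v ⟧ (≤-trans (below S)
              (≤-reflexive (sym (trans (cong (λ b → ⟦ b ⟧ * T S) (dec-true (i ≤? ∣ S ∣) i≤)) (+-identityʳ _)))))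
      ... | no i≰ = *-monoʳ-≤ ⟦ lookup S v ⟧ (≤-trans (≤-reflexive (∑-zero (fin k) λ j → small S j (≰⇒> i≰))) z≤n)
      strict : ⟦ lookup S₀ v ⟧ * row x S₀ < ⟦ lookup S₀ v ⟧ * (⟦ does (i ≤? ∣ S₀ ∣) ⟧ * T S₀)
      strict rewrite v∈S₀ | dec-true (i ≤? ∣ S₀ ∣) (≤-reflexive (sym size)) 
          | +-identityʳ (T S₀) | +-identityʳ (row x S₀) | +-identityʳ (T S₀) = open-row

    -- If every colour were blocked, each would have degree at least `r` at some vertex of `S₀`,
    -- giving `k * r` altogether. But each of the i vertices has fewer than `load i v` coloured
    -- edges, and that is at most k r / i.
    free-colour : ∃ λ j → ∀ v → lookup S₀ v ≡ true → deg x j v < r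
    free-colour with search (fin k) (λ j → ¬? (blocked? j))
      where
      blocked? : ∀ j → Dec (∃ λ v → lookup S₀ v ≡ true × r ≤ deg x j v)
      blocked? j = search (fin m) (λ v → (lookup S₀ v Bool.≟ true) ×-dec (r ≤? deg x j v))
    ... | yes (j , free) = j , λ v v∈ → ≰⇒> λ r≤ → free (v , v∈ , r≤)
    ... | no none = ⊥-elim (<⇒≱ (m<m+n (i * (k * r)) {i * i} (*-mono-≤ 0<i 0<i)) (begin
      i * (k * r) + i * i ≡⟨ *-distribˡ-+ i (k * r) i ⟨
      i * (k * r + i) ≤⟨ *-monoʳ-≤ i crowded ⟩
      i * ∑ (fin m) (λ v → ⟦ lookup S₀ v ⟧ * suc (d v)) ≡⟨ ∑-* (fin m) i _ ⟨
      ∑ (fin m) (λ v → i * (⟦ lookup S₀ v ⟧ * suc (d v))) ≤⟨ ∑-mono (fin m) spread ⟩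
      ∑ (fin m) (λ v → ⟦ lookup S₀ v ⟧ * (k * r)) ≡⟨ ∑-*ʳ (fin m) (k * r) _ ⟩
      ∑ (fin m) (λ v → ⟦ lookup S₀ v ⟧) * (k * r) ≡⟨ cong (_* (k * r)) (trans (∑-lookup S₀) size) ⟩
      i * (k * r) ∎))
      where
      open ≤-Reasoning
      d : Fin m → ℕ
      d v = ∑ (fin k) (λ j → deg x j v)
      blocked : ∀ j → r ≤ ∑ (fin m) (λ v → ⟦ lookup S₀ v ⟧ * deg x j v)
      blocked j with r ≤? ∑ (fin m) (λ v → ⟦ lookup S₀ v ⟧ * deg x j v)
      ... | yes le = le
      ... | no ¬le = ⊥-elim (none (j , λ (v , v∈ , r≤) → ¬le (≤-trans (≤-trans r≤ (≤-reflexive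
              (sym (trans (cong (λ b → ⟦ b ⟧ * deg x j v) v∈) (+-identityʳ _)))))
              (∑-term (fin m) (λ v → ⟦ lookup S₀ v ⟧ * deg x j v) v))))
      crowded : k * r + i ≤ ∑ (fin m) (λ v → ⟦ lookup S₀ v ⟧ * suc (d v))
      crowded = begin
        k * r + i ≡⟨ cong₂ _+_ (∑-const k r) (trans (∑-lookup S₀) size) ⟨
        ∑ (fin k) (λ _ → r) + ∑ (fin m) (λ v → ⟦ lookup S₀ v ⟧) ≤⟨ +-monoˡ-≤ _ (∑-mono (fin k) blocked) ⟩
        ∑ (fin k) (λ j → ∑ (fin m) (λ v → ⟦ lookup S₀ v ⟧ * deg x j v)) + ∑ (fin m) (λ v → ⟦ lookup S₀ v ⟧)
          ≡⟨ cong (_+ ∑ (fin m) (λ v → ⟦ lookup S₀ v ⟧)) (trans (∑-swap (fin k) (fin m) (λ j v → ⟦ lookup S₀ v ⟧ * deg x j v))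
               (∑-cong (fin m) λ v → ∑-* (fin k) ⟦ lookup S₀ v ⟧ _)) ⟩
        ∑ (fin m) (λ v → ⟦ lookup S₀ v ⟧ * d v) + ∑ (fin m) (λ v → ⟦ lookup S₀ v ⟧) ≡⟨ ∑-+ (fin m) _ _ ⟨
        ∑ (fin m) (λ v → ⟦ lookup S₀ v ⟧ * d v + ⟦ lookup S₀ v ⟧)
          ≡⟨ ∑-cong (fin m) (λ v → trans (+-comm _ ⟦ lookup S₀ v ⟧) (sym (*-suc ⟦ lookup S₀ v ⟧ (d v)))) ⟩
        ∑ (fin m) (λ v → ⟦ lookup S₀ v ⟧ * suc (d v)) ∎
      spread : ∀ v → i * (⟦ lookup S₀ v ⟧ * suc (d v)) ≤ ⟦ lookup S₀ v ⟧ * (k * r)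
      spread v with lookup S₀ v in v∈
      ... | false = ≤-reflexive (*-zeroʳ i)
      ... | true = ≤-trans (≤-reflexive (cong (i *_) (+-identityʳ _))) (≤-trans (*-monoʳ-≤ i (load-strict v v∈))
              (≤-trans (room v) (≤-reflexive (sym (+-identityʳ _)))))

    add-edge : ∃ λ x′ → Partial i x′ × (∀ S → row x′ S ≡ row x S + δ (sub m) S S₀) ×
      (∀ S j → ∣ S ∣ ≢ i → x′ S j ≡ x S j)
    add-edge = x′ , record { bounded = bounded′ ; below = below′ ; small = small′ } , row′ , other
      where
      j₀ : Fin k
      j₀ = proj₁ free-colour
      x′ : Family
      x′ S j = x S j + δ (sub m) S S₀ * δ (fin k) j j₀
      row′ : ∀ S → row x′ S ≡ row x S + δ (sub m) S S₀
      row′ S = trans (∑-+ (fin k) (x S) _) (cong (row x S +_) (trans (∑-* (fin k) (δ (sub m) S S₀) _)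
        (trans (cong (δ (sub m) S S₀ *_) (∑-δ-1 (fin k) j₀)) (*-identityʳ _))))
      deg′ : ∀ j v → deg x′ j v ≡ deg x j v + ⟦ lookup S₀ v ⟧ * δ (fin k) j j₀
      deg′ j v = trans (∑-cong (sub m) λ S → trans (*-distribˡ-+ ⟦ lookup S v ⟧ (x S j) _)
          (cong (⟦ lookup S v ⟧ * x S j +_) (lem ⟦ lookup S v ⟧ (δ (sub m) S S₀) _)))
        (trans (∑-+ (sub m) _ _) (cong (deg x j v +_) (∑-δ (sub m) S₀ (λ S → ⟦ lookup S v ⟧ * δ (fin k) j j₀))))
        where
        lem : ∀ a b c → a * (b * c) ≡ b * (a * c)
        lem = solve-∀
      bounded′ : ∀ j v → deg x′ j v ≤ r
      bounded′ j v = subst (_≤ r) (sym (deg′ j v)) (within (equal? (fin k) j j₀) (lookup S₀ v) refl)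
        where
        within : (d : Dec (j ≡ j₀)) → ∀ b → lookup S₀ v ≡ b → deg x j v + ⟦ b ⟧ * ⟦ does d ⟧ ≤ r
        within (yes refl) true v∈ = ≤-trans (≤-reflexive (+-comm _ 1)) (proj₂ free-colour v v∈)
        within (yes refl) false v∈ = ≤-trans (≤-reflexive (+-identityʳ _)) (bounded j v)
        within (no _) b v∈ = ≤-trans (≤-reflexive (trans (cong (deg x j v +_) (*-zeroʳ ⟦ b ⟧)) (+-identityʳ _)))
            (bounded j v)
      below′ : ∀ S → row x′ S ≤ T S
      below′ S rewrite row′ S with equal? (sub m) S S₀
      ... | yes refl = ≤-trans (≤-reflexive (+-comm _ 1)) open-row
      ... | no _ = ≤-trans (≤-reflexive (+-identityʳ _)) (below S)
      other : ∀ S j → ∣ S ∣ ≢ i → x′ S j ≡ x S j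
      other S j ne = trans (cong (λ z → x S j + z * δ (fin k) j j₀) (δ-≢ (sub m) {S} {S₀} λ e → ne (trans (cong ∣_∣ e) size))) (+-identityʳ _)
      small′ : ∀ S j → ∣ S ∣ < i → x′ S j ≡ 0
      small′ S j lt = trans (other S j (<⇒≢ lt)) (small S j lt)

  fill : ∀ {i} {x : Family} → Partial i x → 0 < i → (∀ v → i * load i v ≤ k * r) →
    ∃ λ x′ → Partial i x′ × (∀ S j → ∣ S ∣ ≢ i → x′ S j ≡ x S j) × (∀ S → ∣ S ∣ ≡ i → row x′ S ≡ T S)
  fill {i} {x} px 0<i room = go (suc (missing x)) x px ≤-refl
    where
    missing : Family → ℕ
    missing x = ∑ (sub m) λ S → T S ∸ row x S
    Filled : Family → Set
    Filled x = ∃ λ x′ → Partial i x′ × (∀ S j → ∣ S ∣ ≢ i → x′ S j ≡ x S j) × (∀ S → ∣ S ∣ ≡ i → row x′ S ≡ T S)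
    less-missing : ∀ {x x₁} → Partial i x₁ → ∀ S₀ → (∀ S → row x₁ S ≡ row x S + δ (sub m) S S₀) →
        missing x₁ < missing x
    less-missing {x} {x₁} px₁ S₀ row₁ = ∑-strict (sub m) S₀ bound strict
      where
      bound : ∀ S → T S ∸ row x₁ S ≤ T S ∸ row x S
      bound S = ∸-monoʳ-≤ (T S) (≤-trans (m≤m+n (row x S) _) (≤-reflexive (sym (row₁ S))))
      strict : T S₀ ∸ row x₁ S₀ < T S₀ ∸ row x S₀
      strict = ∸-monoʳ-< (≤-trans (≤-reflexive (+-comm 1 (row x S₀)))
        (≤-reflexive (sym (trans (row₁ S₀) (cong (row x S₀ +_) (δ-refl (sub m) S₀))))))
        (Partial.below px₁ S₀)
    go : ∀ n x → Partial i x → missing x < n → Filled x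
    go (suc n) x px le with search (sub m) {λ S → ∣ S ∣ ≡ i × row x S < T S} (λ S → (∣ S ∣ ≟ i) ×-dec (row x S <? T S))
    ... | no none = x , px , (λ S j _ → refl) , λ S size → ≤-antisym (Partial.below px S) (≮⇒≥ λ lt → none (S , size , lt))
    ... | yes (S₀ , size , open-row) =
      let x₁ , px₁ , row₁ , other₁ = add-edge px S₀ size 0<i open-row room
          x₂ , px₂ , other₂ , full₂ = go n x₁ px₁ (<-≤-trans (less-missing px₁ S₀ row₁) (≤-pred le))
      in x₂ , px₂ , (λ S j ne → trans (other₂ S j ne) (other₁ S j ne)) , full₂

  -- The descending order matters: while size l is being coloured, all coloured edges have size at
  -- least l, and only these are bounded by `load l`.
  fill-all : ∀ i {x : Family} → (∀ l v → 0 < l → l ≤ i → l * load l v ≤ k * r) → Partial (suc i) x →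
    (∀ S → i < ∣ S ∣ → row x S ≡ T S) →
    ∃ λ x′ → Partial 1 x′ × (∀ S j → i < ∣ S ∣ → x′ S j ≡ x S j) × (∀ S → 0 < ∣ S ∣ → row x′ S ≡ T S)
  fill-all zero {x} room px full = x , px , (λ _ _ _ → refl) , full
  fill-all (suc i) {x} room px full =
    let x₁ , px₁ , other₁ , full₁ = fill px′ (s≤s z≤n) (λ v → room (suc i) v (s≤s z≤n) ≤-refl)
        x₂ , px₂ , other₂ , full₂ = fill-all i (λ l v 0<l l≤ → room l v 0<l (m≤n⇒m≤1+n l≤)) px₁ (above x₁ other₁ full₁)
    in x₂ , px₂ , (λ S j lt → trans (other₂ S j (<-trans (n<1+n i) lt)) (other₁ S j (<⇒≢ lt ∘ sym))) , full₂
    where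
    px′ : Partial (suc i) x
    px′ = record { bounded = Partial.bounded px ; below = Partial.below px
                 ; small = λ S j lt → Partial.small px S j (m<n⇒m<1+n lt) }
    above : ∀ x₁ → (∀ S j → ∣ S ∣ ≢ suc i → x₁ S j ≡ x S j) → (∀ S → ∣ S ∣ ≡ suc i → row x₁ S ≡ T S) →
      ∀ S → i < ∣ S ∣ → row x₁ S ≡ T S
    above x₁ other₁ full₁ S i< with ∣ S ∣ ≟ suc i
    ... | yes eq = full₁ S eq
    ... | no ne = trans (∑-cong (fin k) λ j → other₁ S j ne) (full S (≤∧≢⇒< i< (ne ∘ sym)))

  module _ {e : ℕ} {x : Family} (px : Partial 1 x) (full : ∀ S → 0 < ∣ S ∣ → row x S ≡ T S)
    (0<h : 0 < h) (he : h * e ≡ r * (m + N)) (hm≤n : h * m ≤ m + N)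
    (vertex-total : ∀ (v : Fin m) → k * r ≤ ∑ (sub m) (λ S → ⟦ lookup S v ⟧ * T S))
    (edge-total : k * e ≡ ∑ (sub m) T) where
    open Partial px

    private
      empty : Subset m
      empty = replicate m false

      used : Fin k → ℕ
      used j = ∑ (sub m) λ S → x S j

      -- An r-factor on m + N vertices has e = r (m + N) / h edges. All edges with an old vertex
      -- being coloured, those that colour j still lacks must consist of hinges only.
      X : Family
      X S j = x S j + δ (sub m) S empty * (e ∸ used j)

      -- No colour can fall short at `v`: the k degrees are at most `r` each, and the edges at `v`,
      -- all coloured, number at least `k * r`.
      deg≡r : ∀ j v → deg x j v ≡ r
      deg≡r j v = ∑-tight (fin k) (λ j → bounded j v) (≤-trans (≤-reflexive (∑-const k r))
        (≤-trans (vertex-total v) (≤-reflexive (sym (trans (∑-deg x v) (∑-cong (sub m) pointwise)))))) j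
        where
        pointwise : ∀ S → ⟦ lookup S v ⟧ * row x S ≡ ⟦ lookup S v ⟧ * T S
        pointwise S with lookup S v in v∈
        ... | false = refl
        ... | true = cong (1 *_) (full S (member-size S v v∈))

      sizes : ∀ j → ∑ (sub m) (λ S → ∣ S ∣ * x S j) ≡ m * r
      sizes j = trans (sym (∑-incidence (λ S → x S j))) (trans (∑-cong (fin m) (deg≡r j)) (∑-const m r))

      -- A used edge has an old vertex, so there are at most m r of them, which is at most `e` by
      -- `hm≤n`. Hence no colour is overfull before the hinge-only edges are added.
      used≤e : ∀ j → used j ≤ e
      used≤e j = *-cancelˡ-≤ h {{>-nonZero 0<h}} (begin
        h * used j ≤⟨ *-monoʳ-≤ h (∑-mono (sub m) pointwise) ⟩
        h * ∑ (sub m) (λ S → ∣ S ∣ * x S j) ≡⟨ cong (h *_) (sizes j) ⟩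
        h * (m * r) ≡⟨ *-assoc h m r ⟨
        h * m * r ≤⟨ *-monoˡ-≤ r hm≤n ⟩
        (m + N) * r ≡⟨ *-comm (m + N) r ⟩
        r * (m + N) ≡⟨ he ⟨
        h * e ∎)
        where
        open ≤-Reasoning
        pointwise : ∀ S → x S j ≤ ∣ S ∣ * x S j
        pointwise S with ∣ S ∣ in size
        ... | zero = ≤-reflexive (small S j (s≤s (≤-reflexive size)))
        ... | suc _ = m≤m+n _ _

      x-large : ∀ S j → h < ∣ S ∣ → x S j ≡ 0
      x-large S j lt = n≤0⇒n≡0 (≤-trans (∑-term (fin k) (x S) j) (≤-trans (below S)
        (≤-reflexive (trans (cong (lam *_) (ways-large h N _ lt)) (*-zeroʳ lam)))))

      hinges′ : ∀ j → ∑ (sub m) (λ S → (h ∸ ∣ S ∣) * X S j) ≡ N * r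
      hinges′ j = +-cancelʳ-≡ (m * r) _ _ (begin
        ∑ (sub m) (λ S → (h ∸ ∣ S ∣) * X S j) + m * r ≡⟨ cong (∑ (sub m) (λ S → (h ∸ ∣ S ∣) * X S j) +_) (sizes j) ⟨
        ∑ (sub m) (λ S → (h ∸ ∣ S ∣) * X S j) + ∑ (sub m) (λ S → ∣ S ∣ * x S j) ≡⟨ ∑-+ (sub m) _ _ ⟨
        ∑ (sub m) (λ S → (h ∸ ∣ S ∣) * X S j + ∣ S ∣ * x S j) ≡⟨ ∑-cong (sub m) pointwise ⟩
        ∑ (sub m) (λ S → h * x S j + h * (δ (sub m) S empty * (e ∸ used j))) ≡⟨ ∑-+ (sub m) _ _ ⟩
        ∑ (sub m) (λ S → h * x S j) + ∑ (sub m) (λ S → h * (δ (sub m) S empty * (e ∸ used j)))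
          ≡⟨ cong₂ _+_ (∑-* (sub m) h _) (trans (∑-* (sub m) h _)
              (cong (h *_) (∑-δ (sub m) empty (λ _ → e ∸ used j)))) ⟩
        h * used j + h * (e ∸ used j) ≡⟨ *-distribˡ-+ h (used j) _ ⟨
        h * (used j + (e ∸ used j)) ≡⟨ cong (h *_) (m+[n∸m]≡n (used≤e j)) ⟩
        h * e ≡⟨ he ⟩
        r * (m + N) ≡⟨ lem r m N ⟩
        N * r + m * r ∎)
        where
        open ≡-Reasoning
        lem : ∀ r m N → r * (m + N) ≡ N * r + m * r
        lem = solve-∀
        lem₂ : ∀ a b c d → a * (b + c) + d * b ≡ (a + d) * b + a * c
        lem₂ = solve-∀
        pointwise : ∀ S → (h ∸ ∣ S ∣) * X S j + ∣ S ∣ * x S j ≡ h * x S j + h * (δ (sub m) S empty * (e ∸ used j))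
        pointwise S = trans (lem₂ (h ∸ ∣ S ∣) (x S j) _ ∣ S ∣) (cong₂ _+_ first second)
          where
          first : (h ∸ ∣ S ∣ + ∣ S ∣) * x S j ≡ h * x S j
          first with ∣ S ∣ ≤? h
          ... | yes le = cong (_* x S j) (m∸n+n≡m le)
          ... | no ¬le rewrite x-large S j (≰⇒> ¬le) = trans (*-zeroʳ (h ∸ ∣ S ∣ + ∣ S ∣)) (sym (*-zeroʳ h))
          second : (h ∸ ∣ S ∣) * (δ (sub m) S empty * (e ∸ used j)) ≡ h * (δ (sub m) S empty * (e ∸ used j))
          second with equal? (sub m) S empty
          ... | no _ = trans (*-zeroʳ (h ∸ ∣ S ∣)) (sym (*-zeroʳ h))
          ... | yes refl = cong (λ z → (h ∸ z) * ((e ∸ used j) + 0)) (∣replicate∣ m)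

      degrees′ : ∀ j v → deg X j v ≡ r
      degrees′ j v = trans (∑-cong (sub m) pointwise) (deg≡r j v)
        where
        pointwise : ∀ S → ⟦ lookup S v ⟧ * X S j ≡ ⟦ lookup S v ⟧ * x S j
        pointwise S with equal? (sub m) S empty
        ... | no _ = cong (⟦ lookup S v ⟧ *_) (+-identityʳ _)
        ... | yes refl rewrite Vec.lookup-replicate v false = refl

      rows-empty : ∑ (fin k) (λ j → e ∸ used j) ≡ T empty
      rows-empty = +-cancelʳ-≡ (∑ (fin k) used) _ _ (begin
        ∑ (fin k) (λ j → e ∸ used j) + ∑ (fin k) used ≡⟨ ∑-+ (fin k) _ _ ⟨
        ∑ (fin k) (λ j → e ∸ used j + used j) ≡⟨ ∑-cong (fin k) (λ j → m∸n+n≡m (used≤e j)) ⟩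
        ∑ (fin k) (λ _ → e) ≡⟨ ∑-const k e ⟩
        k * e ≡⟨ edge-total ⟩
        ∑ (sub m) T ≡⟨ ∑-cong (sub m) pointwise ⟩
        ∑ (sub m) (λ S → δ (sub m) S empty * T empty + row x S) ≡⟨ ∑-+ (sub m) _ _ ⟩
        ∑ (sub m) (λ S → δ (sub m) S empty * T empty) + ∑ (sub m) (row x)
          ≡⟨ cong₂ _+_ (∑-δ (sub m) empty (λ _ → T empty)) (∑-swap (sub m) (fin k) x) ⟩
        T empty + ∑ (fin k) used ∎)
        where
        open ≡-Reasoning
        pointwise : ∀ S → T S ≡ δ (sub m) S empty * T empty + row x S
        pointwise S with equal? (sub m) S empty
        ... | yes refl = sym (trans (cong₂ _+_ (+-identityʳ _)
                (∑-zero (fin k) λ j → small empty j (s≤s (≤-reflexive (∣replicate∣ m))))) (+-identityʳ _))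
        ... | no ne = sym (full S (n≢0⇒n>0 λ size → ne (size-zero S size)))

      rows′ : ∀ S → row X S ≡ T S
      rows′ S = trans (∑-+ (fin k) (x S) _) (trans (cong (row x S +_) (∑-* (fin k) (δ (sub m) S empty) _)) (rest S))
        where
        rest : ∀ S → row x S + δ (sub m) S empty * ∑ (fin k) (λ j → e ∸ used j) ≡ T S
        rest S with equal? (sub m) S empty
        ... | yes refl = trans (cong₂ _+_ (∑-zero
                (fin k) λ j → small empty j (s≤s (≤-reflexive (∣replicate∣ m)))) (+-identityʳ _)) rows-empty
        ... | no ne = trans (+-identityʳ _) (full S (n≢0⇒n>0 λ size → ne (size-zero S size)))

    add-loose : ∃ λ X′ → Amalgam h lam r k N m X′ × (∀ S j → 0 < ∣ S ∣ → X′ S j ≡ x S j)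
    add-loose = X , record { rows = rows′ ; degrees = degrees′ ; hinges = hinges′ } ,
      λ S j 0< → trans (cong (λ z → x S j + z * (e ∸ used j)) (δ-≢ (sub m) {S} {empty} λ { refl → <-irrefl (sym (∣replicate∣ m)) 0< })) (+-identityʳ _)

-- Components and the room for the greedy colouring

-- Picks a canonical representative: it depends on the truth values alone, so that all vertices of a
-- component get the same root.
leastTrue : ∀ {q} → (Fin (suc q) → Bool) → Fin (suc q)
leastTrue {zero} f = zero
leastTrue {suc q} f = if f zero then zero else suc (leastTrue (f ∘ suc))

leastTrue-cong : ∀ {q} {f f′ : Fin (suc q) → Bool} → (∀ v → f v ≡ f′ v) → leastTrue f ≡ leastTrue f′
leastTrue-cong {zero} eq = refl
leastTrue-cong {suc q} eq = cong₂ (λ b v → if b then zero else suc v) (eq zero) (leastTrue-cong (eq ∘ suc))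

leastTrue-true : ∀ {q} (f : Fin (suc q) → Bool) v → f v ≡ true → f (leastTrue f) ≡ true
leastTrue-true {zero} f zero p = p
leastTrue-true {suc q} f v p with f zero in f0
... | true = f0
leastTrue-true {suc q} f zero p | false with trans (sym p) f0
... | ()
leastTrue-true {suc q} f (suc v) p | false = leastTrue-true (f ∘ suc) v p

module Components {q : ℕ} (x : Subset (suc q) → ℕ) where

  private
    Adjacent : Fin (suc q) → Fin (suc q) → Set
    Adjacent u w = ∃ λ S → 0 < x S × lookup S u ≡ true × lookup S w ≡ true

    adjacent? : ∀ u w → Dec (Adjacent u w)
    adjacent? u w = search (sub (suc q)) λ S → positive? (x S) ×-dec (lookup S u Bool.≟ true) ×-dec (lookup S w Bool.≟ true)

    abstract
      component : ∀ v → ∃ λ (Y : Fin (suc q) → Bool) → (∀ w → Y w ≡ true → Linked x v w) ×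
        (∀ w → insert (fin (suc q)) v (λ _ → false) w ≡ true → Y w ≡ true) ×
        (∀ u w → Y u ≡ true → Adjacent u w → Y w ≡ true)
      component v = closure (fin (suc q)) adjacent? (λ Y → ∀ w → Y w ≡ true → Linked x v w) grow
        (insert (fin (suc q)) v (λ _ → false)) start
        where
        grow : ∀ X u w → X u ≡ true → X w ≡ false → Adjacent u w → (∀ t → X t ≡ true → Linked x v t) →
          ∀ t → insert (fin (suc q)) w X t ≡ true → Linked x v t
        grow X u w Xu _ (S , p , u∈ , w∈) old t Xt with insert-true (fin (suc q)) w X t Xt
        ... | inj₁ X-t = old t X-t
        ... | inj₂ refl = linked-trans (old u Xu) (via S p u∈ w∈ stay)
        start : ∀ w → insert (fin (suc q)) v (λ _ → false) w ≡ true → Linked x v w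
        start w p with insert-true (fin (suc q)) v (λ _ → false) w p
        ... | inj₂ refl = stay

    reach : Fin (suc q) → Fin (suc q) → Bool
    reach v = proj₁ (component v)

    reach-linked : ∀ v w → reach v w ≡ true → Linked x v w
    reach-linked v = proj₁ (proj₂ (component v))

    reach-self : ∀ v → reach v v ≡ true
    reach-self v = proj₁ (proj₂ (proj₂ (component v))) v (insert-self (fin (suc q)) v (λ _ → false))

    linked-reach : ∀ v {u w} → reach v u ≡ true → Linked x u w → reach v w ≡ true
    linked-reach v p stay = p
    linked-reach v p (via S a b c l) = linked-reach v (proj₂ (proj₂ (proj₂ (component v))) _ _ p (S , a , b , c)) l

  root : Fin (suc q) → Fin (suc q)
  root v = leastTrue (reach v)

  root-linked : ∀ v → Linked x v (root v)
  root-linked v = reach-linked v _ (leastTrue-true (reach v) v (reach-self v))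

  linked-root : ∀ {u v} → Linked x u v → root u ≡ root v
  linked-root {u} {v} l = leastTrue-cong λ w → same w (reach u w) (reach v w) refl refl
    where
    same : ∀ w a b → reach u w ≡ a → reach v w ≡ b → a ≡ b
    same w true true _ _ = refl
    same w false false _ _ = refl
    same w true false p p′ = trans (sym (linked-reach v (reach-self v)
        (linked-trans (linked-sym l) (reach-linked u w p)))) p′
    same w false true p p′ = trans (sym p) (linked-reach u (reach-self u) (linked-trans l (reach-linked v w p′)))

  member? : ∀ S → Dec (∃ λ v → lookup S v ≡ true)
  member? S = search (fin (suc q)) λ v → lookup S v Bool.≟ true

  label : Subset (suc q) → Fin (suc (suc q))
  label S with member? S
  ... | yes (v , _) = suc (root v)
  ... | no _ = zero

  label-zero : ∀ S → label S ≡ zero → ∣ S ∣ ≡ 0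
  label-zero S p with member? S
  ... | no none = trans (sym (∑-lookup S)) (∑-zero (fin (suc q)) λ v → cong ⟦_⟧ (Bool.¬-not λ v∈ → none (v , v∈)))

  label-suc : ∀ S u → label S ≡ suc u → ∃ λ v → lookup S v ≡ true × Linked x v u
  label-suc S u p with member? S
  label-suc S .(root v) refl | yes (v , v∈) = v , v∈ , root-linked v

  label-member : ∀ S w → 0 < x S → lookup S w ≡ true → label S ≡ suc (root w)
  label-member S w p w∈ with member? S
  ... | yes (v , v∈) = cong suc (linked-root (via S p v∈ w∈ stay))
  ... | no none = ⊥-elim (none (w , w∈))

  module _ (h N r : ℕ) (hinges : ∑ (sub (suc q)) (λ S → (h ∸ ∣ S ∣) * x S) ≡ N * r) (2≤r : 2 ≤ r)
    (2≤h : 2 ≤ h) (wide : (h ∸ 1) * suc q ≤ (h ∸ 2) * N)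
    (open-component : ∀ v → ¬ (∀ w → Linked x v w → ∀ S → lookup S w ≡ true → 0 < x S → h ≤ ∣ S ∣)) where

    private
      F : Shape
      F = fin (suc (suc q))

      H : Fin (suc (suc q)) → ℕ
      H = hingesAt h x label

    -- In a component without hinges, all edges have at least h old vertices, which `open-component`
    -- excludes.
    component-attached : ∀ v → 0 < H (suc (root v))
    component-attached v with positive? (H (suc (root v)))
    ... | yes p = p
    ... | no ¬p = ⊥-elim (open-component v λ w l S w∈ 0<x → m∸n≡0⇒m≤n (vanish w l S w∈ 0<x))
      where
      vanish : ∀ w → Linked x v w → ∀ S → lookup S w ≡ true → 0 < x S → h ∸ ∣ S ∣ ≡ 0
      vanish w l S w∈ 0<x with m*n≡0⇒m≡0∨n≡0 (h ∸ ∣ S ∣) {x S} (n≤0⇒n≡0 (begin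
        (h ∸ ∣ S ∣) * x S ≡⟨ +-identityʳ _ ⟨
        1 * ((h ∸ ∣ S ∣) * x S) ≡⟨ cong (_* ((h ∸ ∣ S ∣) * x S)) (trans (cong (λ a → δ F a (suc (root v)))
          (trans (label-member S w 0<x w∈) (cong suc (sym (linked-root l))))) (δ-refl F (suc (root v)))) ⟨
        δ F (label S) (suc (root v)) * ((h ∸ ∣ S ∣) * x S)
            ≤⟨ ∑-term (sub (suc q)) (λ T → δ F (label T) (suc (root v)) * ((h ∸ ∣ T ∣) * x T)) S ⟩
        H (suc (root v)) ≤⟨ ≮⇒≥ ¬p ⟩
        0 ∎))
        where open ≤-Reasoning
      ... | inj₁ h≡0 = h≡0
      ... | inj₂ x≡0 = ⊥-elim (<-irrefl (sym x≡0) 0<x)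

    -- There are at least 2 N hinges, as r ≥ 2. Each of the at most q + 1 components with a vertex
    -- ties up one of them, and `wide` leaves enough after this loss.
    component-spare : N ≤ suc (∑ (fin (suc q)) (λ u → H (suc u) ∸ 1) + (h ∸ 1) * loose x label)
    component-spare = ≤-trans (*-cancelˡ-≤ h {{>-nonZero (<-trans (s≤s z≤n) 2≤h)}} (arith h 2≤h wide total)) (n≤1+n _)
      where
      open ≤-Reasoning
      P = ∑ (fin (suc q)) (λ u → H (suc u) ∸ 1)
      L = loose x label
      total : N * 2 ≤ h * L + (P + suc q)
      total = begin
        N * 2 ≤⟨ *-monoʳ-≤ N 2≤r ⟩
        N * r ≡⟨ hinges ⟨
        ∑ (sub (suc q)) (λ S → (h ∸ ∣ S ∣) * x S) ≡⟨ ∑-fibres (sub (suc q)) F label (λ S → (h ∸ ∣ S ∣) * x S) ⟩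
        H zero + ∑ (fin (suc q)) (λ u → H (suc u)) ≤⟨ +-mono-≤ (≤-reflexive (hinges-loose {h} {x = x} {g = label} (λ S _ → label-zero S)))
          (∑-mono (fin (suc q)) λ u → ≤-trans (m≤n+m∸n (H (suc u)) 1) (≤-reflexive (+-comm 1 _))) ⟩
        h * L + ∑ (fin (suc q)) (λ u → H (suc u) ∸ 1 + 1) ≡⟨ cong (h * L +_) (trans (∑-+ (fin (suc q)) (λ u → H (suc u) ∸ 1) (λ _ → 1))
          (cong (P +_) (trans (∑-const (suc q) 1) (*-identityʳ (suc q))))) ⟩
        h * L + (P + suc q) ∎
      arith : ∀ h → 2 ≤ h → (h ∸ 1) * suc q ≤ (h ∸ 2) * N → N * 2 ≤ h * L + (P + suc q) →
        h * N ≤ h * (P + (h ∸ 1) * L)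
      arith (suc zero) (s≤s ()) _ _
      -- A hinge-only edge of size s has s hinges, s - 1 of them spare, so the claim is multiplied
      -- by s. With m old vertices, s (P + (s - 1) L) ≥ (s - 1)(P + s L) ≥ (s - 1)(2 N - m) ≥ s N,
      -- the last by `wide`.
      arith (suc (suc h)) _ wide total = +-cancelʳ-≤ (suc h * suc q) _ _ (begin
        suc (suc h) * N + suc h * suc q ≤⟨ +-monoʳ-≤ (suc (suc h) * N) wide ⟩
        suc (suc h) * N + h * N ≡⟨ lem₁ h N ⟩
        suc h * (N * 2) ≤⟨ *-monoʳ-≤ (suc h) total ⟩
        suc h * (suc (suc h) * L + (P + suc q)) ≡⟨ lem₂ h L P (suc q) ⟩
        suc h * P + suc (suc h) * (suc h * L) + suc h * suc q ≤⟨ +-monoˡ-≤ (suc h * suc q)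
          (+-monoˡ-≤ (suc (suc h) * (suc h * L)) (*-monoˡ-≤ P (n≤1+n (suc h)))) ⟩
        suc (suc h) * P + suc (suc h) * (suc h * L) + suc h * suc q
          ≡⟨ cong (_+ suc h * suc q) (*-distribˡ-+ (suc (suc h)) P (suc h * L)) ⟨
        suc (suc h) * (P + suc h * L) + suc h * suc q ∎)
        where
        lem₁ : ∀ h N → suc (suc h) * N + h * N ≡ suc h * (N * 2)
        lem₁ = solve-∀
        lem₂ : ∀ h L P s → suc h * (suc (suc h) * L + (P + s)) ≡ suc h * P + suc (suc h) * (suc h * L) + suc h * s
        lem₂ = solve-∀

    joined-components : Joined h N x
    joined-components = record
      { g = label ; ℓ = root ; g-zero = λ S _ → label-zero S ; g-suc = λ S u _ → label-suc S u
      ; linked = root-linked ; attached = component-attached ; spare = component-spare }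

-- Bounds on the loads of the old vertices

module Room (h lam r k N q : ℕ) where

  open Fill h lam r k N (suc (suc q))

  private
    m′ W₁ : ℕ
    m′ = suc q
    W₁ = ways h (m′ + N) 1

    ways-through : ∑ (sub m′) (λ S → ways h N (suc ∣ S ∣)) ≡ W₁
    ways-through = trans (∑-cong (sub m′) λ S → cong (ways h N) (+-comm 1 ∣ S ∣)) (ways-Vandermonde h N m′ 1)

  vertex-total : ∀ v → ∑ (sub (suc m′)) (λ S → ⟦ lookup S v ⟧ * T S) ≡ lam * W₁
  vertex-total v = trans (∑-through v (λ s → lam * ways h N s)) (trans (∑-* (sub m′) lam (λ S → ways h N (suc ∣ S ∣))) (cong (lam *_) ways-through))

  private
    load-through : ∀ i v → load i v ≡ ∑ (sub m′) (λ S → ⟦ does (i ≤? suc ∣ S ∣) ⟧ * (lam * ways h N (suc ∣ S ∣)))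
    load-through i v = ∑-through v (λ s → ⟦ does (i ≤? s) ⟧ * (lam * ways h N s))

  room-1 : ∀ v → 1 * load 1 v ≤ lam * W₁
  room-1 v = ≤-reflexive (trans (+-identityʳ _) (trans (load-through 1 v)
    (trans (∑-cong (sub m′) {g = λ S → lam * ways h N (suc ∣ S ∣)} λ S → +-identityʳ _) (trans (∑-* (sub m′) lam (λ S → ways h N (suc ∣ S ∣))) (cong (lam *_) ways-through)))))

  -- Up to the factor `lam`, `ways h N 1` counts the edges whose only old vertex is `v`. Once these
  -- are at least half of the edges at `v`, the others, counted by `load 2`, are at most half.
  room-2 : W₁ ≤ 2 * ways h N 1 → ∀ v → 2 * load 2 v ≤ lam * W₁
  room-2 half v = +-cancelʳ-≤ (lam * W₁) _ _ (begin
    2 * load 2 v + lam * W₁ ≤⟨ +-monoʳ-≤ (2 * load 2 v) (*-monoʳ-≤ lam half) ⟩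
    2 * load 2 v + lam * (2 * ways h N 1) ≡⟨ lem (load 2 v) lam (ways h N 1) ⟩
    2 * (lam * ways h N 1 + load 2 v) ≡⟨ cong (2 *_) total ⟩
    2 * (lam * W₁) ≡⟨ cong (lam * W₁ +_) (+-identityʳ _) ⟩
    lam * W₁ + lam * W₁ ∎)
    where
    open ≤-Reasoning
    lem : ∀ l a w → 2 * l + a * (2 * w) ≡ 2 * (a * w + l)
    lem = solve-∀
    empty : Subset m′
    empty = replicate m′ false
    pointwise : ∀ S → δ (sub m′) S empty * (lam * ways h N 1) + 
        ⟦ does (2 ≤? suc ∣ S ∣) ⟧ * (lam * ways h N (suc ∣ S ∣)) ≡
      lam * ways h N (suc ∣ S ∣)
    pointwise S with equal? (sub m′) S empty
    ... | yes refl = trans (cong₂ _+_ (+-identityʳ _)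
            (cong (λ s → ⟦ does (2 ≤? suc s) ⟧ * (lam * ways h N (suc s))) (∣replicate∣ m′)))
                       (trans (+-identityʳ _) (cong (λ s → lam * ways h N (suc s)) (sym (∣replicate∣ m′))))
    ... | no ne = trans (cong (λ b → ⟦ b ⟧ * (lam * ways h N (suc ∣ S ∣)))
                       (dec-true (2 ≤? suc ∣ S ∣) (s≤s (n≢0⇒n>0 λ size → ne (size-zero S size))))) (+-identityʳ _)
    total : lam * ways h N 1 + load 2 v ≡ lam * W₁
    total = trans (cong₂ _+_ (sym (∑-δ (sub m′) empty (λ _ → lam * ways h N 1))) (load-through 2 v))
      (trans (sym (∑-+ (sub m′) (λ S → δ (sub m′) S empty * (lam * ways h N 1)) (λ S → ⟦ does (2 ≤? suc ∣ S ∣) ⟧ * (lam * ways h N (suc ∣ S ∣))))) (trans (∑-cong (sub m′) {g = λ S → lam * ways h N (suc ∣ S ∣)} pointwise) (trans (∑-* (sub m′) lam (λ S → ways h N (suc ∣ S ∣))) (cong (lam *_) ways-through))))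

  -- Markov's inequality for the number of further old vertices of an edge at v.
  room-Markov : ∀ i → 0 < i → suc i * ((h ∸ 1) * m′) ≤ i * (m′ + N) → ∀ v → suc i * load (suc i) v ≤ lam * W₁
  -- The factor `m′ + N` lets the absorption identity compare `ways h (q + N) 2`, the number of
  -- edges through two given vertices, with the number `W₁` through one.
  room-Markov i 0<i few v = *-cancelˡ-≤ (i * (m′ + N)) {{>-nonZero (*-mono-≤ 0<i (s≤s {n = q + N} z≤n))}} (begin
    i * (m′ + N) * (suc i * load (suc i) v) ≡⟨ lem₁ i (m′ + N) (suc i) (load (suc i) v) ⟩
    suc i * ((m′ + N) * (i * load (suc i) v)) ≤⟨ *-monoʳ-≤ (suc i) (*-monoʳ-≤ (m′ + N) markov) ⟩
    suc i * ((m′ + N) * (lam * (m′ * ways h (q + N) 2))) ≡⟨ lem₂ (suc i) (m′ + N) lam m′ (ways h (q + N) 2) ⟩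
    suc i * (lam * (m′ * ((m′ + N) * ways h (q + N) 2)))
        ≡⟨ cong (λ z → suc i * (lam * (m′ * z))) (ways-absorb h (q + N) 1) ⟨
    suc i * (lam * (m′ * ((h ∸ 1) * W₁))) ≡⟨ lem₃ (suc i) lam m′ (h ∸ 1) W₁ ⟩
    suc i * ((h ∸ 1) * m′) * (lam * W₁) ≤⟨ *-monoˡ-≤ (lam * W₁) few ⟩
    i * (m′ + N) * (lam * W₁) ∎)
    where
    open ≤-Reasoning
    lem₁ : ∀ a b c d → a * b * (c * d) ≡ c * (b * (a * d))
    lem₁ = solve-∀
    lem₂ : ∀ a b c d e → a * (b * (c * (d * e))) ≡ a * (c * (d * (b * e)))
    lem₂ = solve-∀
    lem₃ : ∀ a b c d e → a * (b * (c * (d * e))) ≡ a * (d * c) * (b * e)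
    lem₃ = solve-∀
    pointwise : ∀ s w → i * (⟦ does (suc i ≤? suc s) ⟧ * w) ≤ s * w
    pointwise s w with suc i ≤? suc s
    ... | yes i≤s = ≤-trans (≤-reflexive (cong (λ b → i * (⟦ b ⟧ * w)) (dec-true (suc i ≤? suc s) i≤s)))
            (≤-trans (≤-reflexive (cong (i *_) (+-identityʳ w))) (*-monoˡ-≤ w (≤-pred i≤s)))
    ... | no ¬i≤s = ≤-trans (≤-reflexive (trans
            (cong (λ b → i * (⟦ b ⟧ * w)) (dec-false (suc i ≤? suc s) ¬i≤s)) (*-zeroʳ i))) z≤n
    markov : i * load (suc i) v ≤ lam * (m′ * ways h (q + N) 2)
    markov = begin
      i * load (suc i) v ≡⟨ cong (i *_) (load-through (suc i) v) ⟩
      i * ∑ (sub m′) (λ S → ⟦ does (suc i ≤? suc ∣ S ∣) ⟧ * (lam * ways h N (suc ∣ S ∣))) ≡⟨ ∑-* (sub m′) i (λ S → ⟦ does (suc i ≤? suc ∣ S ∣) ⟧ * (lam * ways h N (suc ∣ S ∣))) ⟨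
      ∑ (sub m′) (λ S → i * (⟦ does (suc i ≤? suc ∣ S ∣) ⟧ * (lam * ways h N (suc ∣ S ∣))))
        ≤⟨ ∑-mono (sub m′) (λ S → pointwise ∣ S ∣ (lam * ways h N (suc ∣ S ∣))) ⟩
      ∑ (sub m′) (λ S → ∣ S ∣ * (lam * ways h N (suc ∣ S ∣))) ≡⟨ ∑-incidence {m′} (λ S → lam * ways h N (suc ∣ S ∣)) ⟨
      ∑ (fin m′) (λ u → ∑ (sub m′) λ S → ⟦ lookup S u ⟧ * (lam * ways h N (suc ∣ S ∣)))
        ≡⟨ ∑-cong (fin m′) (λ u → ∑-through u (λ s → lam * ways h N (suc s))) ⟩
      ∑ (fin m′) (λ u → ∑ (sub q) λ S → lam * ways h N (suc (suc ∣ S ∣))) ≡⟨ ∑-const m′ (∑ (sub q) λ S → lam * ways h N (suc (suc ∣ S ∣))) ⟩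
      m′ * ∑ (sub q) (λ S → lam * ways h N (suc (suc ∣ S ∣))) ≡⟨ cong (m′ *_) (∑-* (sub q) lam (λ S → ways h N (suc (suc ∣ S ∣)))) ⟩
      m′ * (lam * ∑ (sub q) (λ S → ways h N (suc (suc ∣ S ∣))))
        ≡⟨ cong (λ z → m′ * (lam * z)) (trans (∑-cong (sub q) λ S → cong (ways h N) (+-comm 2 ∣ S ∣)) (ways-Vandermonde h N q 2)) ⟩
      m′ * (lam * ways h (q + N) 2) ≡⟨ lem₄ m′ lam _ ⟩
      lam * (m′ * ways h (q + N) 2) ∎
      where
      lem₄ : ∀ a b c → a * (b * c) ≡ b * (a * c)
      lem₄ = solve-∀

-- The ratio of binomial coefficients behind the constant

ways-top : ∀ h N → ways h N h ≡ 1
ways-top h zero = cong ⟦_⟧ (dec-true (h ≟ h) refl)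
ways-top h (suc N) = cong₂ _+_ (ways-top h N) (ways-large h N (suc h) (n<1+n h))

24*ways : ∀ p → 24 * ways 5 (4 + p) 1 ≡ (4 + p) * ((3 + p) * ((2 + p) * (1 + p)))
24*ways p = begin
  24 * ways 5 (4 + p) 1 ≡⟨ lem₀ (ways 5 (4 + p) 1) ⟩
  6 * (4 * ways 5 (4 + p) 1) ≡⟨ cong (6 *_) (ways-absorb 5 (3 + p) 1) ⟩
  6 * ((4 + p) * ways 5 (3 + p) 2) ≡⟨ lem₁ (4 + p) (ways 5 (3 + p) 2) ⟩
  (4 + p) * (2 * (3 * ways 5 (3 + p) 2)) ≡⟨ cong (λ z → (4 + p) * (2 * z)) (ways-absorb 5 (2 + p) 2) ⟩
  (4 + p) * (2 * ((3 + p) * ways 5 (2 + p) 3)) ≡⟨ cong ((4 + p) *_) (lem₂ 2 (3 + p) (ways 5 (2 + p) 3)) ⟩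
  (4 + p) * ((3 + p) * (2 * ways 5 (2 + p) 3)) ≡⟨ cong (λ z → (4 + p) * ((3 + p) * z)) (ways-absorb 5 (1 + p) 3) ⟩
  (4 + p) * ((3 + p) * ((2 + p) * ways 5 (1 + p) 4)) ≡⟨ cong (λ z → (4 + p) * ((3 + p) * ((2 + p) * z))) last ⟩
  (4 + p) * ((3 + p) * ((2 + p) * (1 + p))) ∎
  where
  open ≡-Reasoning
  lem₀ : ∀ w → 24 * w ≡ 6 * (4 * w)
  lem₀ = solve-∀
  lem₁ : ∀ a w → 6 * (a * w) ≡ a * (2 * (3 * w))
  lem₁ = solve-∀
  lem₂ : ∀ a b c → a * (b * c) ≡ b * (a * c)
  lem₂ = solve-∀
  last : ways 5 (1 + p) 4 ≡ 1 + p
  last = trans (sym (+-identityʳ _)) (trans (ways-absorb 5 p 4)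
      (trans (cong (suc p *_) (ways-top 5 p)) (*-identityʳ _)))

-- Shifting every factor of the numerator by one leaves room for the ratio P / Q.
ways-ratio : ∀ P Q → .{{_ : NonZero Q}} → P ≤ 2 * Q → 2 * P ≤ 3 * Q → 3 * P ≤ 4 * Q →
  P * (P * (P * P)) ≤ 2 * (Q * (Q * (Q * Q))) →
  ∀ t p → Q * (5 + t) ≤ P * (4 + p) → ways 5 (4 + t) 1 ≤ 2 * ways 5 (4 + p) 1
ways-ratio P Q le₁ le₂ le₃ le₄ t p ratio = *-cancelˡ-≤ 24 (≤-trans (≤-reflexive (24*ways t))
  (≤-trans (*-cancelˡ-≤ (Q * (Q * (Q * Q))) {{m*n≢0 Q (Q * (Q * Q))}} products)
    (≤-reflexive (trans (cong (2 *_) (sym (24*ways p))) (lem₀ (ways 5 (4 + p) 1))))))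
  where
  instance
    Q²≢0 : NonZero (Q * Q)
    Q²≢0 = m*n≢0 Q Q
    Q³≢0 : NonZero (Q * (Q * Q))
    Q³≢0 = m*n≢0 Q (Q * Q)
  open ≤-Reasoning
  lem₀ : ∀ w → 2 * (24 * w) ≡ 24 * (2 * w)
  lem₀ = solve-∀
  -- Lowering 5 + t by c and 4 + p by d preserves the ratio bound if d P ≤ c Q. The factors are
  -- paired with c = d + 1 for d = 0, ..., 3, whence the side conditions P ≤ 2 Q, 2 P ≤ 3 Q and 3 P
  -- ≤ 4 Q.
  shifted : ∀ c d → d * P ≤ c * Q → c + (5 + t ∸ c) ≡ 5 + t → d + (4 + p ∸ d) ≡ 4 + p →
    Q * (5 + t ∸ c) ≤ P * (4 + p ∸ d)
  shifted c d le eq₁ eq₂ = +-cancelˡ-≤ (c * Q) _ _ (begin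
    c * Q + Q * (5 + t ∸ c) ≡⟨ lem c Q (5 + t ∸ c) ⟩
    Q * (c + (5 + t ∸ c)) ≡⟨ cong (Q *_) eq₁ ⟩
    Q * (5 + t) ≤⟨ ratio ⟩
    P * (4 + p) ≡⟨ cong (P *_) eq₂ ⟨
    P * (d + (4 + p ∸ d)) ≡⟨ lem d P (4 + p ∸ d) ⟨
    d * P + P * (4 + p ∸ d) ≤⟨ +-monoˡ-≤ _ le ⟩
    c * Q + P * (4 + p ∸ d) ∎)
    where
    lem : ∀ c Q z → c * Q + Q * z ≡ Q * (c + z)
    lem = solve-∀
  products : Q * (Q * (Q * Q)) * ((4 + t) * ((3 + t) * ((2 + t) * (1 + t)))) ≤
    Q * (Q * (Q * Q)) * (2 * ((4 + p) * ((3 + p) * ((2 + p) * (1 + p)))))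
  products = begin
    Q * (Q * (Q * Q)) * ((4 + t) * ((3 + t) * ((2 + t) * (1 + t)))) ≡⟨ spread Q (4 + t) (3 + t) (2 + t) (1 + t) ⟩
    Q * (4 + t) * (Q * (3 + t) * (Q * (2 + t) * (Q * (1 + t))))
      ≤⟨ *-mono-≤ (shifted 1 0 z≤n refl refl) (*-mono-≤
          (shifted 2 1 (≤-trans (≤-reflexive (+-identityʳ P)) le₁) refl refl)
           (*-mono-≤ (shifted 3 2 le₂ refl refl) (shifted 4 3 le₃ refl refl))) ⟩
    P * (4 + p) * (P * (3 + p) * (P * (2 + p) * (P * (1 + p)))) ≡⟨ spread P (4 + p) (3 + p) (2 + p) (1 + p) ⟨
    P * (P * (P * P)) * ((4 + p) * ((3 + p) * ((2 + p) * (1 + p)))) ≤⟨ *-monoˡ-≤ _ le₄ ⟩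
    2 * (Q * (Q * (Q * Q))) * ((4 + p) * ((3 + p) * ((2 + p) * (1 + p)))) ≡⟨ move (Q * (Q * (Q * Q))) _ ⟩
    Q * (Q * (Q * Q)) * (2 * ((4 + p) * ((3 + p) * ((2 + p) * (1 + p))))) ∎
    where
    spread : ∀ Q a b c d → Q * (Q * (Q * Q)) * (a * (b * (c * d))) ≡ Q * a * (Q * b * (Q * c * (Q * d)))
    spread = solve-∀
    move : ∀ a b → 2 * a * b ≡ a * (2 * b)
    move = solve-∀

-- Edge colourings and their edge counts

does-∈? : ∀ {N} (v : Fin N) (S : Subset N) → does (v ∈? S) ≡ lookup S v
does-∈? zero (true ∷ S) = refl
does-∈? zero (false ∷ S) = refl
does-∈? (suc v) (_ ∷ S) = does-∈? v S

copies : ∀ {h l N} → (Edge h l N → Bool) → (S : Subset N) → Dec (∣ S ∣ ≡ h) → ℕ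
copies {l = l} f S (yes p) = ∑ (fin l) (λ i → ⟦ f ((S , p) , i) ⟧)
copies f S (no _) = 0

-- The local function of countEdges cannot be named; its type is left to unification.
mutual
  count-copies : ∀ {h l N} (f : Edge h l N → Bool) → countEdges h l N f ≡ ∑ (sub N) (λ S → copies f S (∣ S ∣ ≟ h))
  count-copies {h} {l} {N} f = ∑-cong (sub N) (λ S → contrib-copies f S)

  contrib-copies : ∀ {h l N} (f : Edge h l N → Bool) (S : Subset N) → _ ≡ copies f S (∣ S ∣ ≟ h)
  contrib-copies {h} f S with ∣ S ∣ ≟ h
  ... | yes _ = refl
  ... | no _ = refl

edgeCount : ∀ {h l N k} → (Edge h l N → Fin k) → Fin k → Subset N → ℕ
edgeCount {h} {k = k} c j S = copies (λ e → does (equal? (fin k) (c e) j)) S (∣ S ∣ ≟ h)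

degree-edgeCount : ∀ {h l N k} (c : Edge h l N → Fin k) j v →
  degree c j v ≡ ∑ (sub N) (λ S → ⟦ lookup S v ⟧ * edgeCount c j S)
degree-edgeCount {h} {l} {N} {k} c j v = trans
  (count-copies {h} {l} {N} (λ e → does (v ∈? vertices e) ∧ does (c e Fin.≟ j)))
  (∑-cong (sub N) λ S → pointwise S (∣ S ∣ ≟ h))
  where
  pointwise : ∀ S d → copies (λ e → does (v ∈? vertices e) ∧ does (equal? (fin k) (c e) j)) S d ≡
    ⟦ lookup S v ⟧ * copies (λ e → does (equal? (fin k) (c e) j)) S d
  pointwise S (no _) = sym (*-zeroʳ ⟦ lookup S v ⟧)
  pointwise S (yes p) rewrite does-∈? v S with lookup S v
  ... | true = sym (+-identityʳ _)
  ... | false = ∑-zero (fin l) λ _ → refl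

module _ {h l N k : ℕ} (c : Edge h l N → Fin k) where

  edgeCount-size : ∀ j S → 0 < edgeCount c j S → ∣ S ∣ ≡ h
  edgeCount-size j S = size (∣ S ∣ ≟ h)
    where
    size : (d : Dec (∣ S ∣ ≡ h)) → 0 < copies (λ e → does (equal? (fin k) (c e) j)) S d → ∣ S ∣ ≡ h
    size (yes p) _ = p

  edgeCount-wrong-size : ∀ j S → ∣ S ∣ ≢ h → edgeCount c j S ≡ 0
  edgeCount-wrong-size j S ne = n≤0⇒n≡0 (≮⇒≥ λ 0< → ne (edgeCount-size j S 0<))

  edge-counted : ∀ j e → c e ≡ j → 0 < edgeCount c j (vertices e)
  edge-counted j ((S , p) , i) eq = counted (∣ S ∣ ≟ h)
    where
    counted : (d : Dec (∣ S ∣ ≡ h)) → 0 < copies (λ e → does (equal? (fin k) (c e) j)) S d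
    counted (no ¬p) = ⊥-elim (¬p p)
    counted (yes p′) rewrite ≡-irrelevant p′ p = ≤-trans
        (≤-reflexive (sym (trans (cong (λ a → δ (fin k) a j) eq) (δ-refl (fin k) j))))
      (∑-term (fin l) (λ i → δ (fin k) (c ((S , p) , i)) j) i)

  counted-edge : ∀ j S → 0 < edgeCount c j S → ∃ λ e → vertices e ≡ S × c e ≡ j
  counted-edge j S = edge (∣ S ∣ ≟ h)
    where
    edge : (d : Dec (∣ S ∣ ≡ h)) → 0 < copies (λ e → does (equal? (fin k) (c e) j)) S d →
      ∃ λ e → vertices e ≡ S × c e ≡ j
    edge (yes p) 0< with ∑-pos (fin l) 0<
    ... | i , 0<δ = ((S , p) , i) , refl , δ-pos (fin k) 0<δ

  edgeCount-row : ∀ S → ∑ (fin k) (λ j → edgeCount c j S) ≡ l * ways h 0 ∣ S ∣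
  edgeCount-row S = row (∣ S ∣ ≟ h)
    where
    row : (d : Dec (∣ S ∣ ≡ h)) → ∑ (fin k) (λ j → copies (λ e → does (equal? (fin k) (c e) j)) S d) ≡ l * ways h 0 ∣ S ∣
    row (no ne) = trans (∑-zero (fin k) λ _ → refl) (sym (trans (cong (λ b → l * ⟦ b ⟧) (dec-false (∣ S ∣ ≟ h) ne)) (*-zeroʳ l)))
    row (yes p) = trans (∑-swap (fin k) (fin l) (λ j i → δ (fin k) (c ((S , p) , i)) j))
      (trans (∑-cong (fin l) λ i → trans (∑-cong (fin k) λ j → δ-sym (fin k) (c ((S , p) , i)) j) (∑-δ-1 (fin k) (c ((S , p) , i))))
      (trans (∑-const l 1) (cong (λ b → l * ⟦ b ⟧) (sym (dec-true (∣ S ∣ ≟ h) p)))))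

-- Turns the colour counts of a vertex set back into a colouring of its individual copies.
distribute : ∀ {k} l (z : Fin k → ℕ) → ∑ (fin k) z ≡ l →
    ∃ λ (a : Fin l → Fin k) → ∀ j → ∑ (fin l) (λ i → δ (fin k) (a i) j) ≡ z j
distribute {k} zero z total = (λ ()) , λ j → sym (n≤0⇒n≡0 (≤-trans (∑-term (fin k) z j) (≤-reflexive total)))
distribute {k} (suc l) z total with ∑-pos (fin k) (≤-trans (s≤s z≤n) (≤-reflexive (sym total)))
... | j₀ , 0<z = extend (distribute l z′ (+-cancelˡ-≡ 1 _ _ (trans (cong (_+ ∑ (fin k) z′) (sym (∑-δ-1 (fin k) j₀)))
        (trans (sym (∑-+ (fin k) _ z′)) (trans (∑-cong (fin k) restore) total)))))
  where
  z′ : Fin k → ℕ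
  z′ j = z j ∸ δ (fin k) j j₀
  restore : ∀ j → δ (fin k) j j₀ + z′ j ≡ z j
  restore j with equal? (fin k) j j₀
  ... | yes refl = m+[n∸m]≡n 0<z
  ... | no _ = refl
  extend : (∃ λ (a : Fin l → Fin k) → ∀ j → ∑ (fin l) (λ i → δ (fin k) (a i) j) ≡ z′ j) →
    ∃ λ (a : Fin (suc l) → Fin k) → ∀ j → ∑ (fin (suc l)) (λ i → δ (fin k) (a i) j) ≡ z j
  extend (a , p) = (λ { zero → j₀ ; (suc i) → a i }) , λ j → trans (cong₂ _+_ (δ-sym (fin k) j₀ j) (p j)) (restore j)

∣++∣ : ∀ {m a} (S : Subset m) (T : Subset a) → ∣ S ++ T ∣ ≡ ∣ S ∣ + ∣ T ∣
∣++∣ [] T = refl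
∣++∣ (true ∷ S) T = cong suc (∣++∣ S T)
∣++∣ (false ∷ S) T = ∣++∣ S T

∑-++ : ∀ m {a} (f : Subset (m + a) → ℕ) → ∑ (sub (m + a)) f ≡ ∑ (sub m) (λ S → ∑ (sub a) λ T → f (S ++ T))
∑-++ zero f = refl
∑-++ (suc m) f = cong₂ _+_ (∑-++ m (f ∘ (true ∷_))) (∑-++ m (f ∘ (false ∷_)))

take-drop-++ : ∀ {m a} (S : Subset m) (T : Subset a) → take m (S ++ T) ≡ S × drop m (S ++ T) ≡ T
take-drop-++ {m} S T = Vec.++-injective (take m (S ++ T)) S (Vec.take++drop≡id m (S ++ T))

-- Detachment puts new vertices in front, whereas embed puts them at the end.
rotate : ∀ m {a} → Subset (m + a) → Subset (a + m)
rotate m S = drop m S ++ take m S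

rotateFin : ∀ m {a} → Fin (m + a) → Fin (a + m)
rotateFin m {a} v = join a m (swap (splitAt m v))

rotate-++ : ∀ {m a} (S : Subset m) (T : Subset a) → rotate m (S ++ T) ≡ T ++ S
rotate-++ S T = cong₂ _++_ (proj₂ (take-drop-++ S T)) (proj₁ (take-drop-++ S T))

rotate-rotate : ∀ m {a} (S : Subset (m + a)) → rotate a (rotate m S) ≡ S
rotate-rotate m S = trans (rotate-++ (drop m S) (take m S)) (Vec.take++drop≡id m S)

∣rotate∣ : ∀ m {a} (S : Subset (m + a)) → ∣ rotate m S ∣ ≡ ∣ S ∣
∣rotate∣ m S = trans (∣++∣ (drop m S) (take m S)) (trans (+-comm ∣ drop m S ∣ _)
  (trans (sym (∣++∣ (take m S) (drop m S))) (cong ∣_∣ (Vec.take++drop≡id m S))))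

rotateFin-rotateFin : ∀ m {a} (v : Fin (m + a)) → rotateFin a (rotateFin m v) ≡ v
rotateFin-rotateFin m {a} v = trans (cong (join m a ∘ swap) (Fin.splitAt-join a m (swap (splitAt m v))))
  (trans (cong (join m a) (Sum.swap-involutive (splitAt m v))) (Fin.join-splitAt m a v))

lookup-rotate : ∀ m {a} (S : Subset (m + a)) v → lookup (rotate m S) (rotateFin m v) ≡ lookup S v
lookup-rotate m {a} S v = begin
  lookup (drop m S ++ take m S) (join a m (swap (splitAt m v))) ≡⟨ Vec.lookup-splitAt a (drop m S) (take m S) _ ⟩
  [ lookup (drop m S) , lookup (take m S) ]′ (splitAt a (join a m (swap (splitAt m v))))
    ≡⟨ cong [ lookup (drop m S) , lookup (take m S) ]′ (Fin.splitAt-join a m (swap (splitAt m v))) ⟩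
  [ lookup (drop m S) , lookup (take m S) ]′ (swap (splitAt m v)) ≡⟨ swapped (splitAt m v) ⟩
  [ lookup (take m S) , lookup (drop m S) ]′ (splitAt m v) ≡⟨ Vec.lookup-splitAt m (take m S) (drop m S) v ⟨
  lookup (take m S ++ drop m S) v ≡⟨ cong (λ T → lookup T v) (Vec.take++drop≡id m S) ⟩
  lookup S v ∎
  where
  open ≡-Reasoning
  swapped : ∀ s → [ lookup (drop m S) , lookup (take m S) ]′ (swap s) ≡ [ lookup (take m S) , lookup (drop m S) ]′ s
  swapped (inj₁ _) = refl
  swapped (inj₂ _) = refl

∑-rotate : ∀ m {a} (f : Subset (a + m) → ℕ) → ∑ (sub (m + a)) (f ∘ rotate m) ≡ ∑ (sub (a + m)) f
∑-rotate m {a} f = trans (∑-++ m (f ∘ rotate m))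
    (trans (∑-cong (sub m) λ S → ∑-cong (sub a) λ T → cong f (rotate-++ S T))
  (trans (∑-swap (sub m) (sub a) _) (sym (∑-++ a f))))

mutual
  embed-++ : ∀ {m a} (S : Subset m) → embed m (m + a) S ≡ S ++ replicate a false
  embed-++ {m} {a} S = trans (Vec.tabulate-cong
      (λ x → pick-lookup S x)) (Vec.tabulate∘lookup (S ++ replicate a false))

  pick-lookup : ∀ {m a} (S : Subset m) (x : Fin (m + a)) → _ ≡ lookup (S ++ replicate a false) x
  pick-lookup {m} {a} S x with toℕ x <? m
  ... | yes p = sym (Vec.lookup-++-< S (replicate a false) x p)
  ... | no ¬p = sym (trans (Vec.lookup-++-≥ S (replicate a false) x (≮⇒≥ ¬p))
          (Vec.lookup-replicate (reduce≥ x (≮⇒≥ ¬p)) false))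

-- From edge counts back to an edge colouring

module Realise {h l k m a : ℕ} (c : Edge h l m → Fin k) (X : Subset (a + m) → Fin k → ℕ)
  (rows : ∀ S → ∑ (fin k) (X S) ≡ l * ways h 0 ∣ S ∣)
  (keeps : ∀ S j → h ≤ ∣ S ∣ → X (replicate a false ++ S) j ≡ edgeCount c j S) where

  private
    none : Subset a
    none = replicate a false

    take-size : ∀ {S} → drop m {a} S ≡ none → ∣ S ∣ ≡ h → ∣ take m {a} S ∣ ≡ h
    take-size {S} eq p = trans (trans (sym (+-identityʳ _))
        (trans (cong (∣ take m S ∣ +_) (sym (trans (cong ∣_∣ eq) (∣replicate∣ a))))
      (trans (sym (∣++∣ (take m S) (drop m S))) (cong ∣_∣ (Vec.take++drop≡id m S))))) p

    row-l : ∀ S → ∣ S ∣ ≡ h → ∑ (fin k) (X (rotate m S)) ≡ l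
    row-l S p = trans (rows _) (trans (cong (λ b → l * ⟦ b ⟧) (dec-true (∣ rotate m S ∣ ≟ h) (trans (∣rotate∣ m S) p))) (*-identityʳ l))

    -- Agreement with `c` concerns each single copy on the old vertices, not only the colour counts,
    -- so these copies take their colours from `c`. On other sets any distribution with the right
    -- counts will do.
    colour : ∀ S → ∣ S ∣ ≡ h → Dec (drop m S ≡ none) → Fin l → Fin k
    colour S p (yes old) i = c ((take m S , take-size old p) , i)
    colour S p (no _) i = proj₁ (distribute l (X (rotate m S)) (row-l S p)) i

  Col : Edge h l (m + a) → Fin k
  Col ((S , p) , i) = colour S p (equal? (sub a) (drop m S) none) i

  private
    colour-count : ∀ S p d j → ∑ (fin l) (λ i → δ (fin k) (colour S p d i) j) ≡ X (rotate m S) j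
    colour-count S p (no _) j = proj₂ (distribute l (X (rotate m S)) (row-l S p)) j
    colour-count S p (yes old) j = trans (sym (counts (∣ take m S ∣ ≟ h)))
      (trans (sym (keeps (take m S) j (≤-reflexive (sym (take-size old p)))))
          (cong (λ T → X (T ++ take m S) j) (sym old)))
      where
      counts : (d : Dec (∣ take m S ∣ ≡ h)) → copies (λ e → does (equal? (fin k) (c e) j)) (take m S) d ≡
        ∑ (fin l) (λ i → δ (fin k) (c ((take m S , take-size old p) , i)) j)
      counts (no ne) = ⊥-elim (ne (take-size old p))
      counts (yes q) rewrite ≡-irrelevant q (take-size old p) = refl

  Col-count : ∀ j S → edgeCount Col j S ≡ X (rotate m S) j
  Col-count j S = count (∣ S ∣ ≟ h)
    where
    count : (d : Dec (∣ S ∣ ≡ h)) → copies (λ e → does (equal? (fin k) (Col e) j)) S d ≡ X (rotate m S) j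
    count (yes p) = colour-count S p (equal? (sub a) (drop m S) none) j
    count (no ne) = sym (n≤0⇒n≡0 (≤-trans (∑-term (fin k) (X (rotate m S)) j) (≤-reflexive (trans (rows _)
      (trans (cong (λ b → l * ⟦ b ⟧) (dec-false (∣ rotate m S ∣ ≟ h) (ne ∘ trans (sym (∣rotate∣ m S))))) (*-zeroʳ l))))))

  Col-agrees : Agrees Col c
  Col-agrees S p q i = agree (embed m (m + a) S) q (embed-++ S)
    where
    same : ∀ S′ (p′ : ∣ S′ ∣ ≡ h) → S′ ≡ S → c ((S′ , p′) , i) ≡ c ((S , p) , i)
    same S′ p′ refl = cong (λ z → c ((S , z) , i)) (≡-irrelevant p′ p)
    agree : ∀ S′ (q : ∣ S′ ∣ ≡ h) → S′ ≡ S ++ none → Col ((S′ , q) , i) ≡ c ((S , p) , i)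
    agree S′ q refl with equal? (sub a) (drop m (S ++ none)) none
    ... | yes old = same _ _ (proj₁ (take-drop-++ S none))
    ... | no new = ⊥-elim (new (proj₂ (take-drop-++ S none)))

  Col-degree : ∀ j v → degree Col j v ≡ ∑ (sub (a + m)) (λ S → ⟦ lookup S (rotateFin m v) ⟧ * X S j)
  Col-degree j v = trans (degree-edgeCount Col j v) (trans
    (∑-cong (sub (m + a)) λ S → cong₂ (λ b z → ⟦ b ⟧ * z) (sym (lookup-rotate m S v)) (Col-count j S))
    (∑-rotate m (λ S → ⟦ lookup S (rotateFin m v) ⟧ * X S j)))

  Col-reach : ∀ j {u v} → Linked (λ S → X S j) u v → Reach Col j (rotateFin a u) (rotateFin a v)
  Col-reach j stay = here
  Col-reach j (via {u} {w} S 0<X u∈ w∈ rest)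
    with counted-edge Col j (rotate a S) (subst (0 <_)
        (sym (trans (Col-count j (rotate a S)) (cong (λ T → X T j) (rotate-rotate a S)))) 0<X)
  ... | e , refl , col = step e col (member u∈) (member w∈) (Col-reach j rest)
    where
    member : ∀ {u} → lookup S u ≡ true → rotateFin a u ∈ vertices e
    member {u} p = Vec.lookup⇒[]= _ _ (trans (lookup-rotate a S u) p)

  Col-connected : ∀ j → (∀ u v → Linked (λ S → X S j) u v) → Connected Col j
  Col-connected j linked u v = subst₂ (Reach Col j) (rotateFin-rotateFin m u) (rotateFin-rotateFin m v)
    (Col-reach j (linked (rotateFin m u) (rotateFin m v)))

-- Restriction and extension

ways-C : ∀ h N s → s ≤ h → ways h N s ≡ N C (h ∸ s)
ways-C h zero s s≤h with s ≟ h
... | yes refl = trans (ways-top h 0) (cong (0 C_) (sym (n∸n≡0 h)))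
... | no s≢h = trans (ways-small h 0 s s<h) (cong (0 C_) (sym (+-∸-assoc 1 s<h)))
  where
  s<h : s < h
  s<h = ≤∧≢⇒< s≤h s≢h
ways-C h (suc N) s s≤h with s ≟ h
... | yes refl = trans (ways-top h (suc N)) (cong (suc N C_) (sym (n∸n≡0 h)))
... | no s≢h = trans (cong₂ _+_ (trans (ways-C h N s s≤h) (cong (N C_) pred)) (ways-C h N (suc s) s<h))
    (trans (+-comm _ (N C (h ∸ suc s))) (trans (nCk+nC[k+1]≡[n+1]C[k+1] N (h ∸ suc s)) (cong (suc N C_) (sym pred))))
  where
  s<h : s < h
  s<h = ≤∧≢⇒< s≤h s≢h
  pred : h ∸ s ≡ suc (h ∸ suc s)
  pred = +-∸-assoc 1 s<h

degree-total : ∀ {h l N k} (c : Edge h l (suc N) → Fin k) v → ∑ (fin k) (λ j → degree c j v) ≡ l * ways h N 1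
degree-total {h} {l} {N} {k} c v = begin
  ∑ (fin k) (λ j → degree c j v) ≡⟨ ∑-cong (fin k) (λ j → degree-edgeCount c j v) ⟩
  ∑ (fin k) (λ j → ∑ (sub (suc N)) λ S → ⟦ lookup S v ⟧ * edgeCount c j S)
    ≡⟨ ∑-swap (fin k) (sub (suc N)) (λ j S → ⟦ lookup S v ⟧ * edgeCount c j S) ⟩
  ∑ (sub (suc N)) (λ S → ∑ (fin k) λ j → ⟦ lookup S v ⟧ * edgeCount c j S)
    ≡⟨ ∑-cong (sub (suc N)) {g = λ S → ⟦ lookup S v ⟧ * (l * ways h 0 ∣ S ∣)} (λ S → trans (∑-* (fin k) ⟦ lookup S v ⟧ (λ j → edgeCount c j S)) (cong (⟦ lookup S v ⟧ *_) (edgeCount-row c S))) ⟩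
  ∑ (sub (suc N)) (λ S → ⟦ lookup S v ⟧ * (l * ways h 0 ∣ S ∣)) ≡⟨ ∑-through v (λ s → l * ways h 0 s) ⟩
  ∑ (sub N) (λ S → l * ways h 0 (suc ∣ S ∣)) ≡⟨ ∑-* (sub N) l (λ S → ways h 0 (suc ∣ S ∣)) ⟩
  l * ∑ (sub N) (λ S → ways h 0 (suc ∣ S ∣)) ≡⟨ cong (l *_) (trans (∑-cong (sub N) λ S → cong (ways h 0) (+-comm 1 ∣ S ∣)) (ways-Vandermonde h 0 N 1)) ⟩
  l * ways h (N + 0) 1 ≡⟨ cong (λ M → l * ways h M 1) (+-identityʳ N) ⟩
  l * ways h N 1 ∎
  where open ≡-Reasoning

degree-sum : ∀ {h l N k} (c : Edge h l N → Fin k) j → ∑ (fin N) (degree c j) ≡ h * ∑ (sub N) (edgeCount c j)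
degree-sum {h} {l} {N} {k} c j = trans (∑-cong (fin N) (degree-edgeCount c j)) (trans (∑-incidence (edgeCount c j))
  (trans (∑-cong (sub N) sized) (∑-* (sub N) h (edgeCount c j))))
  where
  sized : ∀ S → ∣ S ∣ * edgeCount c j S ≡ h * edgeCount c j S
  sized S with positive? (edgeCount c j S)
  ... | yes p = cong (_* edgeCount c j S) (edgeCount-size c j S p)
  ... | no ¬p rewrite n≤0⇒n≡0 (≮⇒≥ ¬p) = trans (*-zeroʳ ∣ S ∣) (sym (*-zeroʳ h))

reach-trans : ∀ {h l N k} {c : Edge h l N → Fin k} {j u v w} → Reach c j u v → Reach c j v w → Reach c j u w
reach-trans here q = q
reach-trans (step e p a b l) q = step e p a b (reach-trans l q)

∑-other : ∀ A (f : El A → ℕ) {a b} → a ≢ b → 0 < f b → f a < ∑ A f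
∑-other A f {a} {b} a≢b 0<fb = subst (_< ∑ A f) (∑-δ A a f)
  (∑-strict A b (λ x → ⟦⟧-*-≤ (does (equal? A x a)) (f x))
    (≤-trans (≤-reflexive (cong (λ z → suc (z * f b)) (δ-≢ A {b} {a} (a≢b ∘ sym)))) 0<fb))

-- A regular component obstructs extension

module Restrict {h l m a k r : ℕ} (c : Edge h l m → Fin k) (Col : Edge h l (m + a) → Fin k)
  (agrees : Agrees Col c) (regular : ∀ j v → degree Col j v ≡ r) where

  private
    none : Subset a
    none = replicate a false

    size-none : ∀ (S : Subset m) → ∣ S ++ none ∣ ≡ ∣ S ∣
    size-none S = trans (∣++∣ S none) (trans (cong (∣ S ∣ +_) (∣replicate∣ a)) (+-identityʳ _))

  old-edgeCount : ∀ j S → edgeCount Col j (S ++ none) ≡ edgeCount c j S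
  old-edgeCount j S = same (∣ S ++ none ∣ ≟ h) (∣ S ∣ ≟ h)
    where
    colour : ∀ p i S′ (q : ∣ S′ ∣ ≡ h) → S′ ≡ embed m (m + a) S → Col ((S′ , q) , i) ≡ c ((S , p) , i)
    colour p i S′ q refl = agrees S p q i
    same : (d : Dec (∣ S ++ none ∣ ≡ h)) (d′ : Dec (∣ S ∣ ≡ h)) →
      copies (λ e → does (equal? (fin k) (Col e) j)) (S ++ none) d ≡ copies (λ e → does (equal? (fin k) (c e) j)) S d′
    same (yes q) (yes p) = ∑-cong (fin l) λ i → cong (λ z → δ (fin k) z j) (colour p i (S ++ none) q (sym (embed-++ S)))
    same (yes q) (no ¬p) = ⊥-elim (¬p (trans (sym (size-none S)) q))
    same (no ¬q) (yes p) = ⊥-elim (¬q (trans (size-none S) p))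
    same (no _) (no _) = refl

  degree-split : ∀ j u → degree Col j (u ↑ˡ a) ≡
    ∑ (sub m) (λ S → ⟦ lookup S u ⟧ * ∑ (sub a) (λ T → edgeCount Col j (S ++ T)))
  degree-split j u = trans (degree-edgeCount Col j (u ↑ˡ a)) (trans (∑-++ m _) (∑-cong (sub m) λ S →
    trans (∑-cong (sub a) λ T → cong (λ b → ⟦ b ⟧ * edgeCount Col j (S ++ T)) (Vec.lookup-++ˡ S T u))
      (∑-* (sub a) ⟦ lookup S u ⟧ (λ T → edgeCount Col j (S ++ T)))))

  -- At a vertex that has degree `r` within the old vertices, an edge leading to a new vertex would
  -- raise the degree above `r`.
  full-inside : ∀ j u → degree c j u ≡ r → ∀ S T → 0 < edgeCount Col j (S ++ T) → lookup S u ≡ true → T ≡ none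
  full-inside j u full S T 0< u∈ with equal? (sub a) T none
  ... | yes eq = eq
  ... | no ne = ⊥-elim (<-irrefl (trans full (sym (regular j (u ↑ˡ a)))) (begin-strict
    degree c j u ≡⟨ degree-edgeCount c j u ⟩
    ∑ (sub m) (λ S → ⟦ lookup S u ⟧ * edgeCount c j S) <⟨ ∑-strict (sub m) S
      (λ S → *-monoʳ-≤ ⟦ lookup S u ⟧ (≤-trans (≤-reflexive (sym (old-edgeCount j S))) (∑-term (sub a) (λ T → edgeCount Col j (S ++ T)) none)))
      (≤-trans (≤-reflexive (cong suc (trans (cong (λ b → ⟦ b ⟧ * edgeCount c j S) u∈) (+-identityʳ _))))
        (≤-trans (≤-trans (≤-reflexive (cong suc (sym (old-edgeCount j S))))
            (∑-other (sub a) (λ T → edgeCount Col j (S ++ T)) (ne ∘ sym) 0<))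
          (≤-reflexive (sym (trans (cong (λ b → ⟦ b ⟧ * ∑ (sub a) (λ T → edgeCount Col j (S ++ T))) u∈) (+-identityʳ _)))))) ⟩
    ∑ (sub m) (λ S → ⟦ lookup S u ⟧ * ∑ (sub a) (λ T → edgeCount Col j (S ++ T))) ≡⟨ degree-split j u ⟨
    degree Col j (u ↑ˡ a) ∎))
    where open ≤-Reasoning

  module _ (j : Fin k) (v : Fin m) (closed : ∀ w → Reach c j v w → degree c j w ≡ r) where

    private
      edge-inside : ∀ u → Reach c j v u → ∀ S T → 0 < edgeCount Col j (S ++ T) → lookup S u ≡ true →
        ∀ y → lookup (S ++ T) y ≡ true → ∃ λ w → y ≡ w ↑ˡ a × Reach c j v w
      edge-inside u l S T 0< u∈ y y∈ = new-or-old (splitAt m y) refl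
        where
        T-none : T ≡ none
        T-none = full-inside j u (closed u l) S T 0< u∈
        y∈′ : [ lookup S , lookup T ]′ (splitAt m y) ≡ true
        y∈′ = trans (sym (Vec.lookup-splitAt m S T y)) y∈
        new-or-old : ∀ s → splitAt m y ≡ s → ∃ λ w → y ≡ w ↑ˡ a × Reach c j v w
        new-or-old (inj₂ i) eq = ⊥-elim (false≢true
            (trans (sym (trans (cong (λ z → lookup z i) T-none) (Vec.lookup-replicate i false)))
          (trans (cong [ lookup S , lookup T ]′ (sym eq)) y∈′)))
          where
          false≢true : false ≡ true → ⊥
          false≢true ()
        new-or-old (inj₁ w) eq with counted-edge c j S
            (subst (0 <_) (trans (cong (λ z → edgeCount Col j (S ++ z)) T-none) (old-edgeCount j S)) 0<)
        ... | e , refl , col = w , sym (Fin.splitAt⁻¹-↑ˡ eq) , reach-trans l (step e col (Vec.lookup⇒[]= u S u∈)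
                (Vec.lookup⇒[]= w S (trans (cong [ lookup S , lookup T ]′ (sym eq)) y∈′)) here)

      stays : ∀ {x y} → Reach Col j x y → ∀ u → x ≡ u ↑ˡ a → Reach c j v u → ∃ λ w → y ≡ w ↑ˡ a × Reach c j v w
      stays here u eq l = u , eq , l
      stays (step {w = y} e col x∈ y∈ rest) u refl l =
        let S = take m (vertices e) ; T = drop m (vertices e) ; back = Vec.take++drop≡id m (vertices e)
            w , eq , l′ = edge-inside u l S T (subst (λ z → 0 < edgeCount Col j z) (sym back) (edge-counted Col j e col))
              (trans (sym (Vec.lookup-++ˡ S T u)) (trans (cong (λ z → lookup z (u ↑ˡ a)) back) (Vec.[]=⇒lookup x∈)))
              y (trans (cong (λ z → lookup z y) back) (Vec.[]=⇒lookup y∈))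
        in stays rest w eq l′

    -- Every edge of the colour that meets the component stays inside it, so no path from `v`
    -- reaches a new vertex, and `0 < a` provides one.
    closed-disconnects : 0 < a → ¬ Connected Col j
    closed-disconnects (s≤s z≤n) connected with stays (connected (v ↑ˡ a) (m ↑ʳ zero)) v refl here
    ... | w , eq , _ = inj-absurd (trans (sym (Fin.splitAt-↑ʳ m a zero))
            (trans (cong (splitAt m) eq) (Fin.splitAt-↑ˡ m w a)))
      where
      inj-absurd : ∀ {i : Fin a} → inj₂ i ≡ inj₁ w → ⊥
      inj-absurd ()

ways-const : ∀ h N s → h ≤ s → ways h N s ≡ ways h 0 s
ways-const h zero s _ = refl
ways-const h (suc N) s h≤s = trans (cong₂ _+_ (ways-const h N s h≤s) (ways-large h N (suc s) (s≤s h≤s)))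
    (+-identityʳ _)

module Extend {h₂ lam k q N₁ r : ℕ} (c : Edge (suc (suc h₂)) lam (suc (suc q)) → Fin k)
  (partial : IsPartialFactorization r c) (2≤r : 2 ≤ r) where

  private
    h m N : ℕ
    h = suc (suc h₂)
    m = suc (suc q)
    N = suc N₁

    open Fill h lam r k N m

    x₀ : Subset m → Fin k → ℕ
    x₀ S j = edgeCount c j S

    full₀ : ∀ S → h ≤ ∣ S ∣ → row x₀ S ≡ T S
    full₀ S h≤ = trans (edgeCount-row c S) (cong (lam *_) (sym (ways-const h N ∣ S ∣ h≤)))

    partial₀ : Partial h x₀
    partial₀ = record
      { bounded = λ j v → ≤-trans (≤-reflexive (sym (degree-edgeCount c j v))) (partial j v)
      ; below = below
      ; small = λ S j lt → edgeCount-wrong-size c j S (<⇒≢ lt) }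
      where
      below : ∀ S → row x₀ S ≤ T S
      below S with h ≤? ∣ S ∣
      ... | yes h≤ = ≤-reflexive (full₀ S h≤)
      ... | no h≰ = ≤-trans (≤-reflexive (trans (edgeCount-row c S)
              (trans (cong (lam *_) (ways-small h 0 ∣ S ∣ (≰⇒> h≰))) (*-zeroʳ lam)))) z≤n

    module _ (X : Subset m → Fin k → ℕ) (am : Amalgam h lam r k N m X)
        (kept : ∀ S j → h ≤ ∣ S ∣ → X S j ≡ x₀ S j) where

      coloured-kept : ∀ j S → 0 < x₀ S j → X S j ≡ x₀ S j
      coloured-kept j S 0< = kept S j (≤-reflexive (sym (edgeCount-size c j S 0<)))

      reach-linked : ∀ j {u w} → Reach c j u w → Linked (λ S → X S j) u w
      reach-linked j here = stay
      reach-linked j (step e col u∈ w∈ rest) = via (vertices e)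
        (subst (0 <_) (sym (coloured-kept j (vertices e) 0<)) 0<) (Vec.[]=⇒lookup u∈) (Vec.[]=⇒lookup w∈)
            (reach-linked j rest)
        where
        0< = edge-counted c j e col

      -- Edges without hinges are edges of `c`, so a vertex that meets only such edges has its full
      -- degree already in `c`. This is how a component without hinges becomes an r-regular one.
      closed-degree : ∀ j w → (∀ S → lookup S w ≡ true → 0 < X S j → h ≤ ∣ S ∣) → degree c j w ≡ r
      closed-degree j w closed = trans (degree-edgeCount c j w)
        (trans (∑-cong (sub m) {g = λ S → ⟦ lookup S w ⟧ * X S j} pointwise) (Amalgam.degrees am j w))
        where
        same : ∀ S → lookup S w ≡ true → x₀ S j ≡ X S j
        same S w∈ with positive? (X S j)
        ... | yes p = sym (kept S j (closed S w∈ p))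
        ... | no ¬p = trans (n≤0⇒n≡0 (≮⇒≥ λ 0< → ¬p (subst (0 <_) (sym (coloured-kept j S 0<)) 0<))) (sym (n≤0⇒n≡0 (≮⇒≥ ¬p)))
        pointwise : ∀ S → ⟦ lookup S w ⟧ * x₀ S j ≡ ⟦ lookup S w ⟧ * X S j
        pointwise S with lookup S w in w∈
        ... | false = refl
        ... | true = cong (1 *_) (same S w∈)

      amalgam-joined : NoRegularComponent r c → (h ∸ 1) * m ≤ (h ∸ 2) * N → AllJoined h N X
      amalgam-joined irregular wide j = Components.joined-components (λ S → X S j) h N r (Amalgam.hinges am j) 2≤r
        (s≤s (s≤s z≤n)) wide λ v closed → irregular j v λ w l → closed-degree j w (closed w (reach-linked j l))

  module _ (kr : k * r ≡ lam * ways h (suc q + N) 1) (h∣rn : h ∣ r * (m + N)) (hm≤n : h * m ≤ m + N)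
    (wide : (h ∸ 1) * m ≤ (h ∸ 2) * N)
    (room : ∀ i v → 0 < i → i ≤ suc h₂ → i * load i v ≤ lam * ways h (suc q + N) 1) where

    private
      e : ℕ
      e = _∣_.quotient h∣rn

      he : h * e ≡ r * (m + N)
      he = trans (*-comm h e) (sym (_∣_.equality h∣rn))

      -- Multiplied by h, both sides count incidences: with n = m + N, k r n = λ n C(n - 1, h - 1) =
      -- h λ C(n, h).
      edge-total : k * e ≡ ∑ (sub m) T
      edge-total = *-cancelˡ-≡ _ _ h (begin
        h * (k * e) ≡⟨ lem₁ h k e ⟩
        k * (h * e) ≡⟨ cong (k *_) he ⟩
        k * (r * (m + N)) ≡⟨ *-assoc k r (m + N) ⟨
        k * r * (m + N) ≡⟨ cong (_* (m + N)) kr ⟩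
        lam * ways h (suc q + N) 1 * (m + N) ≡⟨ lem₂ lam (ways h (suc q + N) 1) (m + N) ⟩
        lam * ((m + N) * ways h (suc q + N) 1) ≡⟨ cong (lam *_) (ways-absorb h (suc q + N) 0) ⟨
        lam * (h * ways h (m + N) 0) ≡⟨ lem₁ lam h _ ⟩
        h * (lam * ways h (m + N) 0) ≡⟨ cong (λ z → h * (lam * z)) (trans (∑-cong (sub m) {g = λ S → ways h N (∣ S ∣ + 0)} λ S → cong (ways h N) (sym (+-identityʳ ∣ S ∣))) (ways-Vandermonde h N m 0)) ⟨
        h * (lam * ∑ (sub m) (λ S → ways h N ∣ S ∣)) ≡⟨ cong (h *_) (∑-* (sub m) lam (λ S → ways h N ∣ S ∣)) ⟨
        h * ∑ (sub m) T ∎)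
        where
        open ≡-Reasoning
        lem₁ : ∀ a b c → a * (b * c) ≡ b * (a * c)
        lem₁ = solve-∀
        lem₂ : ∀ a b c → a * b * c ≡ a * (c * b)
        lem₂ = solve-∀

      amalgam : ∃ λ X → Amalgam h lam r k N m X × (∀ S j → h ≤ ∣ S ∣ → X S j ≡ x₀ S j)
      amalgam =
        let x₁ , px₁ , same₁ , full₁ = fill-all (suc h₂)
                (λ i v 0<i i≤ → ≤-trans (room i v 0<i i≤) (≤-reflexive (sym kr))) partial₀ full₀
            X , am , same₂ = add-loose px₁ full₁ (s≤s z≤n) he hm≤n
              (λ v → ≤-reflexive (trans kr (sym (Room.vertex-total h lam r k N q v)))) edge-total
        in X , am , λ S j h≤ → trans (same₂ S j (≤-trans (s≤s z≤n) h≤)) (same₁ S j h≤)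

    extension : NoRegularComponent r c → ExtendsToConnectedFactorization (m + N) r c
    extension irregular =
      let X , am , kept = amalgam
          X′ , am′ , linked , kept′ = detach {m = m} (s≤s (s≤s z≤n)) (≤-trans (s≤s z≤n) 2≤r) am
                (amalgam-joined X am kept irregular wide)
          module R = Realise {m = m} {a = N} c X′ (Amalgam.rows am′) (λ S j h≤ → trans (kept′ S j h≤) (kept S j h≤))
      in R.Col , R.Col-agrees , λ j → (λ v → trans (R.Col-degree j v) (Amalgam.degrees am′ j (rotateFin m v))) ,
           R.Col-connected j (linked j)

-- Every vertex of the component of an edge lies on some edge of its colour, so with degrees at most
-- 1 the component is 1-regular. This rules out r = 1, where the hinges would be too few.
no-1-factor : ∀ {h l m k} (c : Edge h l m → Fin k) → IsPartialFactorization 1 c →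
  ∀ e v → v ∈ vertices e → ¬ NoRegularComponent 1 c
no-1-factor c partial e v v∈ irregular = irregular
    (c e) v λ w l → ≤-antisym (partial (c e) w) (covered (e , refl , v∈) l)
  where
  touches : ∀ f → c f ≡ c e → ∀ {u} → u ∈ vertices f → 1 ≤ degree c (c e) u
  touches f col {u} u∈ = ≤-trans (edge-counted c (c e) f col) (≤-trans (≤-reflexive (sym (trans
    (cong (λ b → ⟦ b ⟧ * edgeCount c (c e) (vertices f)) (Vec.[]=⇒lookup u∈)) (+-identityʳ _))))
    (≤-trans (∑-term (sub _) (λ S → ⟦ lookup S u ⟧ * edgeCount c (c e) S) (vertices f)) (≤-reflexive (sym (degree-edgeCount c (c e) u)))))
  covered : ∀ {u w} → (∃ λ f → c f ≡ c e × u ∈ vertices f) → Reach c (c e) u w → 1 ≤ degree c (c e) w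
  covered (f , col , u∈) here = touches f col u∈
  covered _ (step f col _ w∈ rest) = covered (f , col , w∈) rest

-- An edge supplies a colour class in which to count incidences, for the divisibility of r n, and
-- the component that rules out r = 1.
some-edge : ∀ {m lam} → 5 < m → 0 < lam → ∃ λ (e : Edge 5 lam m) → ∃ λ v → v ∈ vertices e
some-edge {suc (suc (suc (suc (suc m))))} {suc lam} (s≤s (s≤s (s≤s (s≤s (s≤s _))))) (s≤s _) =
  ((true ∷ true ∷ true ∷ true ∷ true ∷ replicate m false , cong (5 +_) (∣replicate∣ m)) , zero) , zero ,
  Vec.lookup⇒[]= zero _ refl

-- Consequences of the bound on n

module _ (P Q D m N : ℕ) .{{_ : NonZero D}} (P≡ : Q + D ≡ P) (large : P * m ≤ D * (m + N)) where

  -- `P / D` stands for the constant of the theorem and `Q / D` for one less, because N is n - m.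
  -- Then n / N is at most `P / Q`, the ratio whose fourth power matters.
  ratio-N : Q * m ≤ D * N
  ratio-N = +-cancelʳ-≤ (D * m) _ _ (begin
    Q * m + D * m ≡⟨ *-distribʳ-+ m Q D ⟨
    (Q + D) * m ≡⟨ cong (_* m) P≡ ⟩
    P * m ≤⟨ large ⟩
    D * (m + N) ≡⟨ lem D m N ⟩
    D * N + D * m ∎)
    where
    open ≤-Reasoning
    lem : ∀ D m N → D * (m + N) ≡ D * N + D * m
    lem = solve-∀

  ratio-n : Q * (m + N) ≤ P * N
  ratio-n = begin
    Q * (m + N) ≡⟨ *-distribˡ-+ Q m N ⟩
    Q * m + Q * N ≤⟨ +-monoˡ-≤ (Q * N) ratio-N ⟩
    D * N + Q * N ≡⟨ trans (+-comm (D * N) _) (sym (*-distribʳ-+ N Q D)) ⟩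
    (Q + D) * N ≡⟨ cong (_* N) P≡ ⟩
    P * N ∎
    where open ≤-Reasoning

  ratio-multiple : ∀ s → D * s ≤ Q → s * m ≤ N
  ratio-multiple s Ds≤Q = *-cancelˡ-≤ D (≤-trans (≤-reflexive (sym (*-assoc D s m)))
      (≤-trans (*-monoˡ-≤ m Ds≤Q) ratio-N))

module _ (q N₁ : ℕ) (5m≤N : 5 * suc (suc q) ≤ suc N₁) where

  private
    m N : ℕ
    m = suc (suc q)
    N = suc N₁

    5m′≤N : 5 * suc q ≤ N
    5m′≤N = ≤-trans (*-monoʳ-≤ 5 (n≤1+n (suc q))) 5m≤N

  -- Markov's inequality needs N ≥ 5 (m - 1) for i = 3 and N ≥ (13 / 3)(m - 1) for i = 4. Both
  -- follow from N ≥ 5 m, so only i = 2 depends on `half`.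
  load-bound : ∀ {lam r k} → ways 5 (suc q + N) 1 ≤ 2 * ways 5 N 1 → ∀ i (v : Fin m) → 0 < i → i ≤ 4 →
    i * Fill.load 5 lam r k N m i v ≤ lam * ways 5 (suc q + N) 1
  load-bound {lam} {r} {k} half 1 v _ _ = Room.room-1 5 lam r k N q v
  load-bound {lam} {r} {k} half 2 v _ _ = Room.room-2 5 lam r k N q half v
  load-bound {lam} {r} {k} half 3 v _ _ = Room.room-Markov 5 lam r k N q 2 (s≤s z≤n) (begin
    3 * (4 * suc q) ≡⟨ lem (suc q) ⟩
    2 * (suc q + 5 * suc q) ≤⟨ *-monoʳ-≤ 2 (+-monoʳ-≤ (suc q) 5m′≤N) ⟩
    2 * (suc q + N) ∎) v
    where
    open ≤-Reasoning
    lem : ∀ m → 3 * (4 * m) ≡ 2 * (m + 5 * m)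
    lem = solve-∀
  load-bound {lam} {r} {k} half 4 v _ _ = Room.room-Markov 5 lam r k N q 3 (s≤s z≤n) (begin
    4 * (4 * suc q) ≤⟨ m≤m+n (4 * (4 * suc q)) (2 * suc q) ⟩
    4 * (4 * suc q) + 2 * suc q ≡⟨ lem (suc q) ⟩
    3 * (suc q + 5 * suc q) ≤⟨ *-monoʳ-≤ 3 (+-monoʳ-≤ (suc q) 5m′≤N) ⟩
    3 * (suc q + N) ∎) v
    where
    open ≤-Reasoning
    lem : ∀ m → 4 * (4 * m) + 2 * m ≡ 3 * (m + 5 * m)
    lem = solve-∀
  load-bound half (suc (suc (suc (suc (suc i))))) v _ (s≤s (s≤s (s≤s (s≤s ()))))

  module _ (r lam : ℕ) .{{_ : NonZero r}} (lam>0 : 0 < lam) (5<m : 5 < m)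
    (c : Edge 5 lam m → Fin (numColours 5 (m + N) r lam)) (partial : IsPartialFactorization r c) where

    private
      k : ℕ
      k = numColours 5 (m + N) r lam

      binomial : ways 5 (suc q + N) 1 ≡ (suc q + N) C 4
      binomial = ways-C 5 (suc q + N) 1 (s≤s z≤n)

    -- Admissibility comes from two counts: the incidences in one colour class, and the degrees of
    -- all colours at one vertex.
    necessary : ExtendsToConnectedFactorization (m + N) r c → Admissible 5 (m + N) r lam × NoRegularComponent r c
    necessary (Col , agrees , factor) =
      (divides (∑ (sub (m + N)) (edgeCount Col (c e)))
        (trans (*-comm r (m + N)) (trans (sym (∑-const (m + N) r))
          (trans (sym (∑-cong (fin (m + N)) {degree Col (c e)} (regular (c e))))
              (trans (degree-sum Col (c e)) (*-comm 5 (∑ (sub (m + N)) (edgeCount Col (c e)))))))) ,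
       divides k (trans (cong (lam *_) (sym binomial)) (trans (sym (degree-total Col zero))
         (trans (∑-cong (fin k) (λ j → regular j zero)) (∑-const k r))))) ,
      λ j v closed → Restrict.closed-disconnects c Col agrees regular j v closed (s≤s z≤n) (proj₂ (factor j))
      where
      e : Edge 5 lam m
      e = proj₁ (some-edge 5<m lam>0)
      regular : ∀ j v → degree Col j v ≡ r
      regular j = proj₁ (factor j)

    2≤r : NoRegularComponent r c → 2 ≤ r
    2≤r irregular = ≤∧≢⇒< (n≢0⇒n>0 (≢-nonZero⁻¹ r)) λ { refl →
      let e , v , v∈ = some-edge 5<m lam>0 in no-1-factor c partial e v v∈ irregular }

    sufficient : ways 5 (suc q + N) 1 ≤ 2 * ways 5 N 1 →
      Admissible 5 (m + N) r lam × NoRegularComponent r c → ExtendsToConnectedFactorization (m + N) r c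
    sufficient half ((h∣rn , r∣) , irregular) = Extend.extension c partial (2≤r irregular)
      (trans (m/n*n≡m r∣) (cong (lam *_) (sym binomial))) h∣rn
      (≤-trans 5m≤N (m≤n+m N m))
      (≤-trans (*-monoˡ-≤ m (n≤1+n 4)) (≤-trans 5m≤N (m≤m+n N (2 * N))))
      (load-bound {lam} {r} {k} half) irregular

ways-half : ∀ P Q → .{{_ : NonZero Q}} → P ≤ 2 * Q → 2 * P ≤ 3 * Q → 3 * P ≤ 4 * Q →
  P * (P * (P * P)) ≤ 2 * (Q * (Q * (Q * Q))) →
  ∀ q N → 4 ≤ N → Q * (suc (suc q) + N) ≤ P * N → ways 5 (suc q + N) 1 ≤ 2 * ways 5 N 1
ways-half P Q le₁ le₂ le₃ le₄ q N 4≤N ratio with m≤n⇒∃[o]m+o≡n 4≤N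
... | p , refl = subst (λ t → ways 5 t 1 ≤ 2 * ways 5 (4 + p) 1) (lem (suc q) p) (ways-ratio P Q le₁ le₂ le₃ le₄ (suc q + p) p
  (subst (λ t → Q * suc t ≤ P * (4 + p)) (sym (lem (suc q) p)) ratio))
  where
  lem : ∀ a p → 4 + (a + p) ≡ a + (4 + p)
  lem = solve-∀

theorem7p11 : (n m r lam : ℕ) → .{{_ : NonZero r}} →
    0 < n → 0 < m → 0 < lam → 5 < m →
    6285214 * m ≤ 1000000 * n →
    (c : Edge 5 lam m → Fin (numColours 5 n r lam)) →
    IsPartialFactorization r c →
    (ExtendsToConnectedFactorization n r c ⇔
    (Admissible 5 n r lam × NoRegularComponent r c))
theorem7p11 n m r lam _ _ lam>0 5<m large c partial =
  -- The last check is (P / Q)^4 ≤ 2. It holds because 1 / (1 - 2^(-1/4)) = 6.2852135... has been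
  -- rounded up at the sixth decimal.
  split 6285214 5285214 1000000 refl (≤ᵇ⇒≤ 1000000 6285214 tt) (≤ᵇ⇒≤ (1000000 * 5) 5285214 tt)
    (≤ᵇ⇒≤ 6285214 (2 * 5285214) tt) (≤ᵇ⇒≤ (2 * 6285214) (3 * 5285214) tt) (≤ᵇ⇒≤ (3 * 6285214) (4 * 5285214) tt)
    (≤ᵇ⇒≤ (6285214 * (6285214 * (6285214 * 6285214))) (2 * (5285214 * (5285214 * (5285214 * 5285214)))) tt)
    n m 5<m large c partial
  where
  Claim : ∀ n m → (Edge 5 lam m → Fin (numColours 5 n r lam)) → Set
  Claim n m c = ExtendsToConnectedFactorization n r c ⇔ (Admissible 5 n r lam × NoRegularComponent r c)
  -- Abstract in the constants, so that products with large literals are never unfolded.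
  split : ∀ P Q D → .{{_ : NonZero Q}} → .{{_ : NonZero D}} → Q + D ≡ P → D ≤ P → D * 5 ≤ Q → P ≤ 2 * Q →
      2 * P ≤ 3 * Q → 3 * P ≤ 4 * Q →
    P * (P * (P * P)) ≤ 2 * (Q * (Q * (Q * Q))) →
    ∀ n m → 5 < m → P * m ≤ D * n → (c : Edge 5 lam m → Fin (numColours 5 n r lam)) → IsPartialFactorization r c →
        Claim n m c
  split P Q D P≡ D≤P 5D≤Q le₁ le₂ le₃ le₄ n m 5<m large c partial =
    cases m 5<m large c partial (m≤n⇒∃[o]m+o≡n (*-cancelˡ-≤ D (≤-trans (*-monoˡ-≤ m D≤P) large)))
    where
    cases : ∀ m → 5 < m → P * m ≤ D * n → (c : Edge 5 lam m → Fin (numColours 5 n r lam)) →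
        IsPartialFactorization r c →
      (∃ λ a → m + a ≡ n) → Claim n m c
    cases (suc zero) (s≤s ()) _ _ _ _
    cases (suc (suc q)) 5<m large c partial (a , refl) =
        gap a (ratio-multiple P Q D (suc (suc q)) a P≡ large 5 5D≤Q) large c partial
      where
      gap : ∀ a → 5 * suc (suc q) ≤ a → P * suc (suc q) ≤ D * (suc (suc q) + a) →
        (c : Edge 5 lam (suc (suc q)) → Fin (numColours 5 (suc (suc q) + a) r lam)) → IsPartialFactorization r c →
        Claim (suc (suc q) + a) (suc (suc q)) c
      gap (suc N₁) 5m≤a large c partial = mk⇔ (necessary q N₁ 5m≤a r lam lam>0 5<m c partial)
        (sufficient q N₁ 5m≤a r lam lam>0 5<m c partial
          (ways-half P Q le₁ le₂ le₃ le₄ q (suc N₁)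
              (≤-trans (≤-trans (n≤1+n 4) (*-monoʳ-≤ 5 {1} {suc (suc q)} (s≤s z≤n))) 5m≤a)
              (ratio-n P Q D (suc (suc q)) (suc N₁) P≡ large)))
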